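{- Let $k\geq 2$ and let $C$ be the centipede obtained from the path $P_k$ by appending one pendant vertex to each vertex of degree $2$ of $P_k$ (so $C$ has $n=2k-2$ vertices). If $G$ is any finite simple graph whose Laplacian matrix has the same spectrum (with multiplicities) as the Laplacian matrix of $C$, then $G$ is isomorphic to $C$. That is, the centipede is determined by its Laplacian spectrum.
   Context: Graphs are finite, simple and undirected. The Laplacian of a graph is $L=D-A$, where $A$ is the adjacency matrix and $D$ is the diagonal matrix of vertex degrees. $P_k$ denotes the path on $k$ vertices. A centipede is a tree obtained by appending a pendant vertex (a new vertex of degree $1$) to each vertex of degree $2$ of a path. -}

module Defs where

open import Data.Nat as ℕ using (ℕ; zero; suc; _<ᵇ_; _≤ᵇ_)
open import Data.Nat.Properties as ℕP using ()
open import Data.Integer as ℤ using (ℤ; +_; _-_; _*_; _+_; -_)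
open import Data.Fin using (Fin; zero; suc; toℕ; punchIn)
open import Data.Fin.Properties using (_≟_)
open import Data.Bool using (Bool; true; false; if_then_else_; _∧_; _∨_; not)
open import Data.Bool.Properties using (∨-comm)
open import Relation.Nullary using (yes; no)
open import Relation.Nullary.Decidable using (⌊_⌋)
open import Relation.Binary.PropositionalEquality using (_≡_; refl; sym; cong; cong₂)
open import Function.Bundles using (_↔_; Inverse)
open import Data.Empty using (⊥-elim)
open import Data.Product using (Σ)

record Graph (n : ℕ) : Set where
  field
    adj    : Fin n → Fin n → Bool
    adj-sym    : ∀ i j → adj i j ≡ adj j i
    adj-irrefl : ∀ i → adj i i ≡ false
open Graph public

_≅_ : ∀ {m n} → Graph m → Graph n → Set
_≅_ {m} {n} G H = Σ (Fin m ↔ Fin n) λ f → ∀ i j → adj G i j ≡ adj H (Inverse.to f i) (Inverse.to f j)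

sumFin : ∀ {n} → (Fin n → ℤ) → ℤ
sumFin {zero}  f = + 0
sumFin {suc n} f = f zero + sumFin (λ i → f (suc i))

sgn : ℕ → ℤ
sgn zero          = + 1
sgn (suc zero)    = - (+ 1)
sgn (suc (suc i)) = sgn i

det : ∀ {n} → (Fin n → Fin n → ℤ) → ℤ
det {zero}  M = + 1
det {suc n} M = sumFin λ j → sgn (toℕ j) * (M zero j * det (λ r c → M (suc r) (punchIn j c)))

δ : ∀ {n} → Fin n → Fin n → Bool
δ i j = ⌊ i ≟ j ⌋

b2z : Bool → ℤ
b2z true  = + 1
b2z false = + 0

degree : ∀ {n} → Graph n → Fin n → ℤ
degree G i = sumFin λ j → b2z (adj G i j)

laplacian : ∀ {n} → Graph n → Fin n → Fin n → ℤ
laplacian G i j = (if δ i j then degree G i else + 0) - b2z (adj G i j)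

lapCharPoly : ∀ {n} → Graph n → ℤ → ℤ
lapCharPoly G x = det λ i j → (if δ i j then x else + 0) - laplacian G i j

-- Centipede on P_k: path vertices 0..k-1 (edges i—i+1), and for each internal path
-- vertex u (1 ≤ u ≤ k-2) a pendant vertex k+u-1 adjacent to u.  Vertex set Fin (2k-2).
edge : ℕ → ℕ → ℕ → Bool
edge k u v = (⌊ v ℕ.≟ suc u ⌋ ∧ (v <ᵇ k))
           ∨ ((1 ≤ᵇ u) ∧ (suc u <ᵇ k) ∧ ⌊ v ℕ.≟ (k ℕ.+ u ℕ.∸ 1) ⌋)

private
  δ-sym : ∀ {n} (i j : Fin n) → δ i j ≡ δ j i
  δ-sym i j with i ≟ j | j ≟ i
  ... | yes _ | yes _ = refl
  ... | no _  | no _  = refl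
  ... | yes p | no q  = ⊥-elim (q (sym p))
  ... | no p  | yes q = ⊥-elim (p (sym q))

  δ-refl : ∀ {n} (i : Fin n) → δ i i ≡ true
  δ-refl i with i ≟ i
  ... | yes _ = refl
  ... | no p  = ⊥-elim (p refl)

centipedeAdj : (k : ℕ) → Fin (2 ℕ.* k ℕ.∸ 2) → Fin (2 ℕ.* k ℕ.∸ 2) → Bool
centipedeAdj k a b = not (δ a b) ∧ (edge k (toℕ a) (toℕ b) ∨ edge k (toℕ b) (toℕ a))

centipede : (k : ℕ) → Graph (2 ℕ.* k ℕ.∸ 2)
centipede k = record
  { adj    = centipedeAdj k
  ; adj-sym    = λ i j → cong₂ _∧_ (cong not (δ-sym i j)) (∨-comm (edge k (toℕ i) (toℕ j)) (edge k (toℕ j) (toℕ i)))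
  ; adj-irrefl = λ i → cong (λ b → not b ∧ (edge k (toℕ i) (toℕ i) ∨ edge k (toℕ i) (toℕ i))) (δ-refl i)
  }

module Submission where

-- The traces of L, L² and L³ can be read off the leading terms of the characteristic polynomial, and its linear
-- coefficient decides connectedness; hence G is a tree. As a tree has no triangles, the traces give that
-- Σ(d-1)(d-2)(d-3) and Σ(d-1)(d-3) vanish over the degrees d, so d ∈ {1,2,3} and then d ∈ {1,3}.
-- Counting leaf edges, Σ(π(v) - 1) = 2 over the internal vertices v with π(v) leaf neighbours, so an internal
-- vertex without a leaf forces three pairs of twin leaves and (x - 1)³ divides the characteristic polynomial;
-- for the centipede the root 1 is at most double. So every internal vertex carries a leaf, and walking down the
-- tree from a leaf of a vertex with two leaves traces out the spine.

open import Data.Nat as ℕ using (ℕ; zero; suc; z≤n; s≤s; _≤_)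
import Data.Nat.Properties as ℕP
open import Data.Integer using (ℤ; +_; -_; _+_; _*_; _-_; ∣_∣)
import Data.Integer as ℤ
import Data.Integer.Properties as ℤP
open import Data.Integer.Tactic.RingSolver using (solve-∀)
open import Data.Fin using (Fin; zero; suc; toℕ; fromℕ<; punchIn; punchOut; inject₁)
open import Data.Fin.Properties using (_≟_; any?; suc-injective; toℕ<n; toℕ-injective; toℕ-fromℕ<; punchInᵢ≢i; punchIn-injective; punchIn-punchOut; punchOut-punchIn; punchOut-cong; cantor-schröder-bernstein)
open import Data.Bool using (Bool; true; false; if_then_else_; _∧_; _∨_; not; T) renaming (_≟_ to _𝔹≟_)
open import Data.Bool.Properties using (∨-zeroʳ)
open import Data.Product using (Σ; ∃; ∃₂; _×_; _,_; proj₁; proj₂)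
open import Data.Sum using (_⊎_; inj₁; inj₂)
open import Data.Empty using (⊥; ⊥-elim)
open import Function using (_∘_)
open import Function.Bundles using (mk↔ₛ′)
open import Relation.Nullary using (¬_; Dec; yes; no)
open import Relation.Nullary.Decidable using (⌊_⌋; ¬?; _×-dec_; decidable-stable)
open import Relation.Binary.Definitions using (tri<; tri≈; tri>)
open import Relation.Binary.PropositionalEquality
open import Defs

-- The spectrum is available only as an integer function, so coefficients must be recovered from
-- values. High ones come from growth: a function of order `n` in the sense of `O` cannot equal
-- `c xⁿ⁺¹` with `c` nonzero. Low ones come from congruences: a determinant at `x` is congruent
-- modulo `x` to the one at zero, and integers congruent modulo every positive integer are equal.
-- Substituting `x = 1 + y` brings the eigenvalue 1 within reach of the second method. Connectedness
-- has to precede the degrees: it excludes degree 0, the only one at which (d-1)(d-2)(d-3) is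
-- negative. On {1,2,3} the product (d-1)(d-3) is nonpositive, which then removes 2. An internal
-- vertex without a leaf contributes -1 to a sum equal to 2, so the others contribute 3. Each
-- contributes at most 1, because a vertex with three leaves would form a whole component; hence
-- three vertices carry two leaves each. That 1 is at most a double root for the centipede is the
-- nonvanishing of one determinant, from which the factors of the two end pairs have been divided
-- out.

ind : ∀ {n} → Fin n → Fin n → ℤ
ind i j = if δ i j then + 1 else + 0

δ-refl : ∀ {n} (i : Fin n) → δ i i ≡ true
δ-refl i with i ≟ i
... | yes _ = refl
... | no p  = ⊥-elim (p refl)

δ-≢ : ∀ {n} {i j : Fin n} → i ≢ j → δ i j ≡ false
δ-≢ {i = i} {j} i≢j with i ≟ j
... | yes p = ⊥-elim (i≢j p)
... | no _  = refl

δ-true : ∀ {n} {i j : Fin n} → δ i j ≡ true → i ≡ j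
δ-true {i = i} {j} e with i ≟ j
... | yes p = p

ind-refl : ∀ {n} (i : Fin n) → ind i i ≡ + 1
ind-refl i rewrite δ-refl i = refl

ind-≢ : ∀ {n} {i j : Fin n} → i ≢ j → ind i j ≡ + 0
ind-≢ i≢j rewrite δ-≢ i≢j = refl

ind-sym : ∀ {n} (i j : Fin n) → ind i j ≡ ind j i
ind-sym i j with i ≟ j
... | yes refl = sym (ind-refl i)
... | no i≢j = sym (ind-≢ (i≢j ∘ sym))

-- Finite sums

sum-cong : ∀ {n} {f g : Fin n → ℤ} → (∀ i → f i ≡ g i) → sumFin f ≡ sumFin g
sum-cong {zero}  e = refl
sum-cong {suc n} e = cong₂ _+_ (e zero) (sum-cong (e ∘ suc))

sum-zero : ∀ {n} {f : Fin n → ℤ} → (∀ i → f i ≡ + 0) → sumFin f ≡ + 0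
sum-zero {zero}  e = refl
sum-zero {suc n} e = cong₂ _+_ (e zero) (sum-zero (e ∘ suc))

sum-+ : ∀ {n} (f g : Fin n → ℤ) → sumFin (λ i → f i + g i) ≡ sumFin f + sumFin g
sum-+ {zero}  f g = refl
sum-+ {suc n} f g = trans (cong (_+_ (f zero + g zero)) (sum-+ (f ∘ suc) (g ∘ suc)))
                          (interchange (f zero) (g zero) (sumFin (f ∘ suc)) (sumFin (g ∘ suc)))
  where
  interchange : ∀ a b c d → (a + b) + (c + d) ≡ (a + c) + (b + d)
  interchange = solve-∀

sum-*ˡ : ∀ {n} (c : ℤ) (f : Fin n → ℤ) → sumFin (λ i → c * f i) ≡ c * sumFin f
sum-*ˡ {zero}  c f = sym (ℤP.*-zeroʳ c)
sum-*ˡ {suc n} c f = trans (cong (_+_ (c * f zero)) (sum-*ˡ c (f ∘ suc)))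
                           (sym (ℤP.*-distribˡ-+ c (f zero) (sumFin (f ∘ suc))))

sum-*ʳ : ∀ {n} (c : ℤ) (f : Fin n → ℤ) → sumFin (λ i → f i * c) ≡ sumFin f * c
sum-*ʳ c f = trans (sum-cong (λ i → ℤP.*-comm (f i) c)) (trans (sum-*ˡ c f) (ℤP.*-comm c (sumFin f)))

sum-neg : ∀ {n} (f : Fin n → ℤ) → sumFin (λ i → - f i) ≡ - sumFin f
sum-neg {zero}  f = refl
sum-neg {suc n} f = trans (cong (_+_ (- f zero)) (sum-neg (f ∘ suc))) (sym (ℤP.neg-distrib-+ (f zero) (sumFin (f ∘ suc))))

sum-minus : ∀ {n} (f g : Fin n → ℤ) → sumFin (λ i → f i - g i) ≡ sumFin f - sumFin g
sum-minus f g = trans (sum-+ f (λ i → - g i)) (cong (_+_ (sumFin f)) (sum-neg g))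

sum-swap : ∀ {m n} (f : Fin m → Fin n → ℤ) →
           sumFin (λ i → sumFin (λ j → f i j)) ≡ sumFin (λ j → sumFin (λ i → f i j))
sum-swap {zero} {n} f = sym (sum-zero {n} (λ _ → refl))
sum-swap {suc m} f = trans (cong (_+_ (sumFin (f zero))) (sum-swap (f ∘ suc)))
                           (sym (sum-+ (f zero) (λ j → sumFin (λ i → f (suc i) j))))

sum-punchIn : ∀ {n} (j : Fin (suc n)) (f : Fin (suc n) → ℤ) →
              sumFin f ≡ f j + sumFin (f ∘ punchIn j)
sum-punchIn zero f = refl
sum-punchIn {suc n} (suc j) f = trans (cong (_+_ (f zero)) (sum-punchIn j (f ∘ suc)))
                                      (rot (f zero) (f (suc j)) (sumFin (f ∘ suc ∘ punchIn j)))
  where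
  rot : ∀ a b c → a + (b + c) ≡ b + (a + c)
  rot = solve-∀

sum-single : ∀ {n} (j : Fin n) (f : Fin n → ℤ) → (∀ i → i ≢ j → f i ≡ + 0) → sumFin f ≡ f j
sum-single {suc n} j f z = trans (sum-punchIn j f)
  (trans (cong (_+_ (f j)) (sum-zero (λ i → z (punchIn j i) (punchInᵢ≢i j i)))) (ℤP.+-identityʳ (f j)))

sum-ind : ∀ {n} (j : Fin n) (f : Fin n → ℤ) → sumFin (λ i → ind i j * f i) ≡ f j
sum-ind j f = trans (sum-single j _ (λ i i≢j → cong (_* f i) (ind-≢ i≢j)))
                    (trans (cong (_* f j) (ind-refl j)) (ℤP.*-identityˡ (f j)))

sum-ind1 : ∀ {n} (j : Fin n) → sumFin (λ i → ind i j) ≡ + 1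
sum-ind1 j = trans (sum-cong (λ i → sym (ℤP.*-identityʳ (ind i j)))) (sum-ind j (λ _ → + 1))

-- Determinants as functions of the columns

Mat : ℕ → Set
Mat n = Fin n → Fin n → ℤ

minor : ∀ {n} → Fin (suc n) → Mat (suc n) → Mat n
minor j M r c = M (suc r) (punchIn j c)

det-cong : ∀ {n} {A B : Mat n} → (∀ r c → A r c ≡ B r c) → det A ≡ det B
det-cong {zero}  e = refl
det-cong {suc n} e = sum-cong λ j →
  cong (sgn (toℕ j) *_) (cong₂ _*_ (e zero j) (det-cong (λ r c → e (suc r) (punchIn j c))))

-- Expansion along row zero: at `i ≡ j` the minor omits column `j` and only the entry splits;
-- elsewhere the entry is common and the induction hypothesis splits the minor. Additivity,
-- homogeneity and the zero column are all instances.
det-linear : ∀ {n} (j : Fin n) (a b : ℤ) {A B C : Mat n} →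
             (∀ r → A r j ≡ a * B r j + b * C r j) →
             (∀ r c → c ≢ j → A r c ≡ B r c) → (∀ r c → c ≢ j → A r c ≡ C r c) →
             det A ≡ a * det B + b * det C
det-linear {suc n} j a b {A} {B} {C} ej eB eC =
  trans (sum-cong term)
  (trans (sum-+ (λ i → a * tB i) (λ i → b * tC i))
         (cong₂ _+_ (sum-*ˡ a tB) (sum-*ˡ b tC)))
  where
  tB tC : Fin (suc n) → ℤ
  tB i = sgn (toℕ i) * (B zero i * det (minor i B))
  tC i = sgn (toℕ i) * (C zero i * det (minor i C))
  alg₁ : ∀ s a b x y d → s * ((a * x + b * y) * d) ≡ a * (s * (x * d)) + b * (s * (y * d))
  alg₁ = solve-∀
  alg₂ : ∀ s a b x d e → s * (x * (a * d + b * e)) ≡ a * (s * (x * d)) + b * (s * (x * e))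
  alg₂ = solve-∀
  term : ∀ i → sgn (toℕ i) * (A zero i * det (minor i A)) ≡ a * tB i + b * tC i
  term i with i ≟ j
  ... | yes refl =
    trans (cong (λ z → sgn (toℕ i) * (z * det (minor i A))) (ej zero))
    (trans (alg₁ (sgn (toℕ i)) a b (B zero i) (C zero i) (det (minor i A)))
    (cong₂ (λ u v → a * (sgn (toℕ i) * (B zero i * u)) + b * (sgn (toℕ i) * (C zero i * v)))
      (det-cong (λ r c → eB (suc r) (punchIn i c) (punchInᵢ≢i i c)))
      (det-cong (λ r c → eC (suc r) (punchIn i c) (punchInᵢ≢i i c)))))
  ... | no i≢j =
    trans (cong (λ z → sgn (toℕ i) * (A zero i * z))
                (det-linear j′ a b {minor i A} {minor i B} {minor i C}
                  (λ r → subst (λ z → A (suc r) z ≡ a * B (suc r) z + b * C (suc r) z) (sym pj) (ej (suc r)))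
                  (λ r c c≢ → eB (suc r) (punchIn i c) (off c c≢))
                  (λ r c c≢ → eC (suc r) (punchIn i c) (off c c≢))))
    (trans (alg₂ (sgn (toℕ i)) a b (A zero i) (det (minor i B)) (det (minor i C)))
    (cong₂ (λ u v → a * (sgn (toℕ i) * (u * det (minor i B))) + b * (sgn (toℕ i) * (v * det (minor i C))))
      (eB zero i i≢j) (eC zero i i≢j)))
    where
    j′ : Fin n
    j′ = punchOut i≢j
    pj : punchIn i j′ ≡ j
    pj = punchIn-punchOut i≢j
    off : ∀ c → c ≢ j′ → punchIn i c ≢ j
    off c c≢ e = c≢ (punchIn-injective i c j′ (trans e (sym pj)))

det-zeroCol : ∀ {n} (j : Fin n) {A : Mat n} → (∀ r → A r j ≡ + 0) → det A ≡ + 0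
det-zeroCol j {A} z = trans (det-linear j (+ 0) (+ 0) {A} {A} {A} z (λ _ _ _ → refl) (λ _ _ _ → refl)) refl

-- Consecutive columns come first because deleting any third column keeps them consecutive, and
-- because deleting either of the two leaves the same minor when they are equal. General position is
-- reached later by moving columns.
data Adjacent : ∀ {n} → Fin n → Fin n → Set where
  here  : ∀ {n} → Adjacent {suc (suc n)} zero (suc zero)
  there : ∀ {n} {p q : Fin n} → Adjacent p q → Adjacent (suc p) (suc q)

sgn-suc : ∀ n → sgn (suc n) ≡ - sgn n
sgn-suc zero = refl
sgn-suc (suc zero) = refl
sgn-suc (suc (suc n)) = sgn-suc n

adjacent-toℕ : ∀ {n} {p q : Fin n} → Adjacent p q → toℕ q ≡ suc (toℕ p)
adjacent-toℕ here = refl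
adjacent-toℕ (there a) = cong suc (adjacent-toℕ a)

adjacent-≢ : ∀ {n} {p q : Fin n} → Adjacent p q → p ≢ q
adjacent-≢ (there a) e = adjacent-≢ a (suc-injective e)

adjacent-punchIn : ∀ {n} {p q : Fin (suc n)} → Adjacent p q → (j : Fin (suc n)) → j ≢ p → j ≢ q →
                   ∃₂ λ p′ q′ → Adjacent p′ q′ × punchIn j p′ ≡ p × punchIn j q′ ≡ q
adjacent-punchIn here zero j≢p j≢q = ⊥-elim (j≢p refl)
adjacent-punchIn here (suc zero) j≢p j≢q = ⊥-elim (j≢q refl)
adjacent-punchIn {suc (suc n)} here (suc (suc j)) j≢p j≢q = zero , suc zero , here , refl , refl
adjacent-punchIn (there {p = p} {q} a) zero j≢p j≢q = p , q , a , refl , refl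
adjacent-punchIn {suc n} (there a) (suc j) j≢p j≢q
  with adjacent-punchIn a j (j≢p ∘ cong suc) (j≢q ∘ cong suc)
... | p′ , q′ , a′ , ep , eq = suc p′ , suc q′ , there a′ , cong suc ep , cong suc eq

punchIn-adjacent : ∀ {n} {p q : Fin (suc n)} → Adjacent p q → (c : Fin n) →
                   punchIn p c ≡ punchIn q c ⊎ (punchIn p c ≡ q × punchIn q c ≡ p)
punchIn-adjacent here zero = inj₂ (refl , refl)
punchIn-adjacent here (suc c) = inj₁ refl
punchIn-adjacent (there a) zero = inj₁ refl
punchIn-adjacent (there a) (suc c) with punchIn-adjacent a c
... | inj₁ e = inj₁ (cong suc e)
... | inj₂ (e , f) = inj₂ (cong suc e , cong suc f)

sum-pair : ∀ {n} {p q : Fin n} → p ≢ q → (f : Fin n → ℤ) → f p + f q ≡ + 0 →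
           (∀ i → i ≢ p → i ≢ q → f i ≡ + 0) → sumFin f ≡ + 0
sum-pair {suc n} {p} {q} p≢q f e z =
  trans (sum-punchIn p f)
  (trans (cong (_+_ (f p)) (sum-single (punchOut p≢q) (f ∘ punchIn p)
           (λ i i≢ → z (punchIn p i) (punchInᵢ≢i p i)
              (λ e′ → i≢ (punchIn-injective p i _ (trans e′ (sym (punchIn-punchOut p≢q))))))))
  (trans (cong (λ z′ → f p + f z′) (punchIn-punchOut p≢q)) e))

-- The terms at `p` and `q` have equal entries, equal minors and opposite signs; every other minor
-- still contains two equal consecutive columns.
det-adjacent : ∀ {n} {p q : Fin n} → Adjacent p q → {A : Mat n} → (∀ r → A r p ≡ A r q) → det A ≡ + 0
det-adjacent {suc n} {p} {q} a {A} e = sum-pair (adjacent-≢ a) t cancel others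
  where
  t : Fin (suc n) → ℤ
  t i = sgn (toℕ i) * (A zero i * det (minor i A))
  minors : ∀ r c → minor p A r c ≡ minor q A r c
  minors r c with punchIn-adjacent a c
  ... | inj₁ e′ = cong (A (suc r)) e′
  ... | inj₂ (e₁ , e₂) = trans (cong (A (suc r)) e₁) (trans (sym (e (suc r))) (cong (A (suc r)) (sym e₂)))
  alg : ∀ s x d → s * (x * d) + - s * (x * d) ≡ + 0
  alg = solve-∀
  cancel : t p + t q ≡ + 0
  cancel = trans (cong₂ (λ u v → t p + u * v) (trans (cong sgn (adjacent-toℕ a)) (sgn-suc (toℕ p)))
                        (cong₂ _*_ (sym (e zero)) (sym (det-cong minors))))
                 (alg (sgn (toℕ p)) (A zero p) (det (minor p A)))
  others : ∀ i → i ≢ p → i ≢ q → t i ≡ + 0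
  others i i≢p i≢q with adjacent-punchIn a i i≢p i≢q
  ... | p′ , q′ , a′ , ep , eq =
    trans (cong (λ z → sgn (toℕ i) * (A zero i * z))
            (det-adjacent a′ {minor i A} (λ r → trans (cong (A (suc r)) ep) (trans (e (suc r)) (cong (A (suc r)) (sym eq))))))
          (trans (cong (sgn (toℕ i) *_) (ℤP.*-zeroʳ (A zero i))) (ℤP.*-zeroʳ (sgn (toℕ i))))

setCol : ∀ {m n} → (Fin m → Fin n → ℤ) → Fin n → (Fin m → ℤ) → Fin m → Fin n → ℤ
setCol M j v r c = if δ c j then v r else M r c

setCol-at : ∀ {m n} (M : Fin m → Fin n → ℤ) j v r → setCol M j v r j ≡ v r
setCol-at M j v r rewrite δ-refl j = refl

setCol-off : ∀ {m n} (M : Fin m → Fin n → ℤ) j v r {c} → c ≢ j → setCol M j v r c ≡ M r c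
setCol-off M j v r c≢j rewrite δ-≢ c≢j = refl

-- Polarisation: the determinant with `u + v` in both columns vanishes, and so do those with `u`
-- twice or `v` twice; the two mixed terms must therefore cancel.
det-swap : ∀ {n} {p q : Fin n} → Adjacent p q → {A B : Mat n} →
           (∀ r → B r p ≡ A r q) → (∀ r → B r q ≡ A r p) →
           (∀ r c → c ≢ p → c ≢ q → B r c ≡ A r c) → det B ≡ - det A
det-swap {n} {p} {q} a {A} {B} ep eq eo = conclude
  where
  p≢q = adjacent-≢ a
  u v s : Fin n → ℤ
  u r = A r p
  v r = A r q
  s r = u r + v r
  m : (Fin n → ℤ) → (Fin n → ℤ) → Mat n
  m x y = setCol (setCol A p x) q y
  m-q : ∀ x y r → m x y r q ≡ y r
  m-q x y r = setCol-at (setCol A p x) q y r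
  m-p : ∀ x y r → m x y r p ≡ x r
  m-p x y r = trans (setCol-off (setCol A p x) q y r p≢q) (setCol-at A p x r)
  m-offp : ∀ x x′ y r c → c ≢ p → m x y r c ≡ m x′ y r c
  m-offp x x′ y r c c≢p with c ≟ q
  ... | yes refl = refl
  ... | no c≢q = trans (setCol-off A p x r c≢p) (sym (setCol-off A p x′ r c≢p))
  m-offq : ∀ x y y′ r c → c ≢ q → m x y r c ≡ m x y′ r c
  m-offq x y y′ r c c≢q = trans (setCol-off (setCol A p x) q y r c≢q) (sym (setCol-off (setCol A p x) q y′ r c≢q))
  one : ∀ x y → x + y ≡ + 1 * x + + 1 * y
  one = solve-∀
  addp : ∀ y → det (m s y) ≡ + 1 * det (m u y) + + 1 * det (m v y)
  addp y = det-linear p (+ 1) (+ 1)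
    (λ r → trans (m-p s y r) (trans (one (u r) (v r)) (cong₂ (λ α β → + 1 * α + + 1 * β) (sym (m-p u y r)) (sym (m-p v y r)))))
    (m-offp s u y) (m-offp s v y)
  addq : ∀ x → det (m x s) ≡ + 1 * det (m x u) + + 1 * det (m x v)
  addq x = det-linear q (+ 1) (+ 1)
    (λ r → trans (m-q x s r) (trans (one (u r) (v r)) (cong₂ (λ α β → + 1 * α + + 1 * β) (sym (m-q x u r)) (sym (m-q x v r)))))
    (m-offq x s u) (m-offq x s v)
  same : ∀ x → det (m x x) ≡ + 0
  same x = det-adjacent a (λ r → trans (m-p x x r) (sym (m-q x x r)))
  isA : det (m u v) ≡ det A
  isA = det-cong λ r c → pw r c
    where
    pw : ∀ r c → m u v r c ≡ A r c
    pw r c with c ≟ q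
    ... | yes refl = refl
    ... | no c≢q with c ≟ p
    ... | yes refl = refl
    ... | no c≢p = refl
  isB : det (m v u) ≡ det B
  isB = det-cong λ r c → pw r c
    where
    pw : ∀ r c → m v u r c ≡ B r c
    pw r c with c ≟ q
    ... | yes refl = sym (eq r)
    ... | no c≢q with c ≟ p
    ... | yes refl = sym (ep r)
    ... | no c≢p = sym (eo r c c≢p c≢q)
  alg : ∀ x y → (+ 0 ≡ + 1 * (+ 1 * (+ 0) + + 1 * x) + + 1 * (+ 1 * y + + 1 * (+ 0))) → y ≡ - x
  alg x y e = trans (h x y) (trans (cong (_+_ (- x)) (sym e)) (ℤP.+-identityʳ (- x)))
    where
    h : ∀ x y → y ≡ - x + (+ 1 * (+ 1 * (+ 0) + + 1 * x) + + 1 * (+ 1 * y + + 1 * (+ 0)))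
    h = solve-∀
  total : + 0 ≡ + 1 * (+ 1 * (+ 0) + + 1 * det A) + + 1 * (+ 1 * det B + + 1 * (+ 0))
  total = trans (sym (same s)) (trans (addp s) (cong₂ (λ α β → + 1 * α + + 1 * β)
    (trans (addq u) (cong₂ (λ α β → + 1 * α + + 1 * β) (same u) isA))
    (trans (addq v) (cong₂ (λ α β → + 1 * α + + 1 * β) isB (same v)))))
  conclude : det B ≡ - det A
  conclude = alg (det A) (det B) total

adjacent-inject₁ : ∀ {n} (i : Fin n) → Adjacent (inject₁ i) (suc i)
adjacent-inject₁ zero = here
adjacent-inject₁ (suc i) = there (adjacent-inject₁ i)

punchIn-inject₁ : ∀ {n} (i : Fin n) → punchIn (inject₁ i) i ≡ suc i
punchIn-inject₁ zero = refl
punchIn-inject₁ (suc i) = cong suc (punchIn-inject₁ i)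

punchIn-suc : ∀ {n} (i : Fin n) → punchIn (suc i) i ≡ inject₁ i
punchIn-suc zero = refl
punchIn-suc (suc i) = cong suc (punchIn-suc i)

-- Inverse of the map sending `zero` to `p` and `suc c` to `punchIn p c`: a cycle on the first p+1
-- positions, hence of sign `sgn (toℕ p)`.
mv : ∀ {n} → Fin (suc n) → Fin (suc n) → Fin (suc n)
mv p c with p ≟ c
... | yes _ = zero
... | no p≢c = suc (punchOut p≢c)

mv-at : ∀ {n} (p : Fin (suc n)) → mv p p ≡ zero
mv-at p with p ≟ p
... | yes _ = refl
... | no p≢p = ⊥-elim (p≢p refl)

mv-punchIn : ∀ {n} (p : Fin (suc n)) c → mv p (punchIn p c) ≡ suc c
mv-punchIn p c with p ≟ punchIn p c
... | yes e = ⊥-elim (punchInᵢ≢i p c (sym e))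
... | no p≢c = cong suc (trans (punchOut-cong p refl) (punchOut-punchIn p))

det-mv : ∀ {n} (p : Fin (suc n)) (A : Mat (suc n)) → det (λ r c → A r (mv p c)) ≡ sgn (toℕ p) * det A
det-mv p A = go (toℕ p) p refl
  where
  -- The recursion runs on `t` since one swap replaces `suc i` by `inject₁ i`, which is not a
  -- subterm.
  go : ∀ t p → toℕ p ≡ t → det (λ r c → A r (mv p c)) ≡ sgn t * det A
  go zero zero e = trans (det-cong (λ r c → cong (A r) (mv-zero c))) (sym (ℤP.*-identityˡ (det A)))
    where
    mv-zero : ∀ {n} (c : Fin (suc n)) → mv zero c ≡ c
    mv-zero zero = refl
    mv-zero (suc c) = refl
  go (suc t) (suc i) e =
    trans (det-swap adj′ {λ r c → A r (mv q c)} (λ r → cong (A r) atq) (λ r → cong (A r) atp) (λ r c c≢q c≢p → cong (A r) (off c c≢q c≢p)))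
    (trans (cong -_ (go t q toq)) (trans (ℤP.neg-distribˡ-* (sgn t) (det A)) (cong (_* det A) (sym (sgn-suc t)))))
    where
    q = inject₁ i
    adj′ = adjacent-inject₁ i
    toq : toℕ q ≡ t
    toq = ℕP.suc-injective (trans (sym (adjacent-toℕ adj′)) e)
    atq : mv (suc i) q ≡ mv q (suc i)
    atq = trans (cong (mv (suc i)) (sym (punchIn-suc i))) (trans (mv-punchIn (suc i) i)
          (trans (sym (mv-punchIn q i)) (cong (mv q) (punchIn-inject₁ i))))
    atp : mv (suc i) (suc i) ≡ mv q q
    atp = trans (mv-at (suc i)) (sym (mv-at q))
    off : ∀ c → c ≢ q → c ≢ suc i → mv (suc i) c ≡ mv q c
    off c c≢q c≢p = trans (cong (mv (suc i)) (sym pc)) (trans (mv-punchIn (suc i) c′) (trans (sym (mv-punchIn q c′)) (cong (mv q) pc′)))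
      where
      c′ = punchOut (c≢p ∘ sym)
      pc : punchIn (suc i) c′ ≡ c
      pc = punchIn-punchOut (c≢p ∘ sym)
      pc′ : punchIn q c′ ≡ c
      pc′ with punchIn-adjacent adj′ c′
      ... | inj₁ e′ = trans e′ pc
      ... | inj₂ (_ , e₂) = ⊥-elim (c≢q (trans (sym pc) e₂))

sgn-sq : ∀ t → sgn t * sgn t ≡ + 1
sgn-sq zero = refl
sgn-sq (suc zero) = refl
sgn-sq (suc (suc t)) = sgn-sq t

det-moveFront : ∀ {n} (p : Fin (suc n)) {A B : Mat (suc n)} →
                (∀ r → A r p ≡ B r zero) → (∀ r c → A r (punchIn p c) ≡ B r (suc c)) →
                det A ≡ sgn (toℕ p) * det B
det-moveFront p {A} {B} e₀ e = trans (det-cong pw) (det-mv p B)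
  where
  pw : ∀ r c → A r c ≡ B r (mv p c)
  pw r c with p ≟ c
  ... | yes refl = e₀ r
  ... | no p≢c = trans (cong (A r) (sym (punchIn-punchOut p≢c))) (e r (punchOut p≢c))

sgn-cancel : ∀ t x → sgn t * x ≡ + 0 → x ≡ + 0
sgn-cancel t x e = trans (sym (ℤP.*-identityˡ x)) (trans (cong (_* x) (sym (sgn-sq t)))
  (trans (ℤP.*-assoc (sgn t) (sgn t) x) (trans (cong (sgn t *_) e) (ℤP.*-zeroʳ (sgn t)))))

det-alternating : ∀ {n} {p q : Fin n} → p ≢ q → {A : Mat n} → (∀ r → A r p ≡ A r q) → det A ≡ + 0
det-alternating {suc n} {p} {q} p≢q {A} e =
  trans (det-moveFront p {A} {B} (λ _ → refl) (λ _ _ → refl))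
        (trans (cong (sgn (toℕ p) *_) B≡0) (ℤP.*-zeroʳ (sgn (toℕ p))))
  where
  B : Mat (suc n)
  B r zero = A r p
  B r (suc c) = A r (punchIn p c)
  q′ : Fin n
  q′ = punchOut p≢q
  -- In `B` the column `p` stands in front and `q` at `suc q′`; moving the front column to
  -- `inject₁ q′` makes the two consecutive.
  p₂ = inject₁ q′
  B≡0 : det B ≡ + 0
  B≡0 = sgn-cancel (toℕ p₂) (det B) (trans (sym (det-mv p₂ B))
    (det-adjacent (adjacent-inject₁ q′) {λ r c → B r (mv p₂ c)} (λ r →
      trans (cong (B r) (mv-at p₂))
      (trans (e r)
      (trans (cong (A r) (sym (punchIn-punchOut p≢q)))
             (cong (B r) (trans (sym (mv-punchIn p₂ q′)) (cong (mv p₂) (punchIn-inject₁ q′)))))))))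

apply : ∀ {m n} → (Fin m → Fin n → ℤ) → (Fin n → ℤ) → Fin m → ℤ
apply M w r = sumFin λ c → M r c * w c

setCol-cong : ∀ {n} (M : Mat n) j {u v : Fin n → ℤ} → (∀ r → u r ≡ v r) → det (setCol M j u) ≡ det (setCol M j v)
setCol-cong M j {u} {v} e = det-cong λ r c → pw r c
  where
  pw : ∀ r c → setCol M j u r c ≡ setCol M j v r c
  pw r c with c ≟ j
  ... | yes _ = e r
  ... | no _ = refl

setCol-linear : ∀ {n} (M : Mat n) j a b (u v : Fin n → ℤ) →
                det (setCol M j (λ r → a * u r + b * v r)) ≡ a * det (setCol M j u) + b * det (setCol M j v)
setCol-linear {n} M j a b u v = det-linear j a b
  (λ r → trans (setCol-at M j s r) (cong₂ (λ α β → a * α + b * β) (sym (setCol-at M j u r)) (sym (setCol-at M j v r))))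
  (λ r c c≢j → trans (setCol-off M j s r c≢j) (sym (setCol-off M j u r c≢j)))
  (λ r c c≢j → trans (setCol-off M j s r c≢j) (sym (setCol-off M j v r c≢j)))
  where
  s : Fin n → ℤ
  s r = a * u r + b * v r

setCol-* : ∀ {n} (M : Mat n) j a (u : Fin n → ℤ) → det (setCol M j (λ r → a * u r)) ≡ a * det (setCol M j u)
setCol-* M j a u = trans (setCol-cong M j (λ r → pad a (u r)))
                   (trans (setCol-linear M j a (+ 0) u u) (sym (pad a (det (setCol M j u)))))
  where
  pad : ∀ a x → a * x ≡ a * x + + 0 * x
  pad = solve-∀

setCol-sum : ∀ {n} (M : Mat n) j {k} (w : Fin k → ℤ) (V : Fin k → Fin n → ℤ) →
             det (setCol M j (λ r → sumFin λ i → w i * V i r)) ≡ sumFin λ i → w i * det (setCol M j (V i))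
setCol-sum M j {zero} w V = det-zeroCol j (setCol-at M j (λ _ → + 0))
setCol-sum M j {suc k} w V =
  trans (setCol-cong M j (λ r → one (w zero * V zero r) (sumFin λ i → w (suc i) * V (suc i) r)))
  (trans (setCol-linear M j (w zero) (+ 1) (V zero) (λ r → sumFin λ i → w (suc i) * V (suc i) r))
  (cong (_+_ (w zero * det (setCol M j (V zero)))) (trans (ℤP.*-identityˡ _) (setCol-sum M j (w ∘ suc) (V ∘ suc)))))
  where
  one : ∀ x y → x + y ≡ x + + 1 * y
  one = solve-∀

-- Cramer's rule without division: expanding `apply M w` into columns of `M`, every summand but the
-- one at `j` repeats a column. With an eigenvector for `w` it extracts the eigenvalue as a factor
-- of the determinant.
det-cramer : ∀ {n} (M : Mat n) j (w : Fin n → ℤ) → det (setCol M j (apply M w)) ≡ w j * det M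
det-cramer M j w =
  trans (setCol-cong M j (λ r → sum-cong (λ c → ℤP.*-comm (M r c) (w c))))
  (trans (setCol-sum M j w (λ i r → M r i))
  (trans (sum-single j _ λ i i≢j → trans (cong (w i *_)
      (det-alternating i≢j (λ r → trans (setCol-off M j (λ r → M r i) r i≢j) (sym (setCol-at M j (λ r → M r i) r))))) (ℤP.*-zeroʳ (w i)))
  (cong (w j *_) (det-cong λ r c → pw r c))))
  where
  pw : ∀ r c → setCol M j (λ r → M r j) r c ≡ M r c
  pw r c with c ≟ j
  ... | yes refl = refl
  ... | no _ = refl

-- Congruence and nonsingularity

-- Congruence of `a` and `b` modulo `x`. It takes the place of evaluating a polynomial at zero: a
-- determinant with entries depending on `x` is compared with the one whose entries are taken at 0.
record Cong (x a b : ℤ) : Set where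
  constructor _,_
  field
    quot  : ℤ
    quot≡ : a ≡ b + x * quot

cong-+ : ∀ {x a b c d} → Cong x a b → Cong x c d → Cong x (a + c) (b + d)
cong-+ {x} {b = b} {d = d} (p , refl) (q , refl) = p + q , alg x b d p q
  where
  alg : ∀ x b d p q → (b + x * p) + (d + x * q) ≡ (b + d) + x * (p + q)
  alg = solve-∀

cong-* : ∀ {x a b c d} → Cong x a b → Cong x c d → Cong x (a * c) (b * d)
cong-* {x} {b = b} {d = d} (p , refl) (q , refl) = p * d + b * q + x * (p * q) , alg x b d p q
  where
  alg : ∀ x b d p q → (b + x * p) * (d + x * q) ≡ (b * d) + x * (p * d + b * q + x * (p * q))
  alg = solve-∀

cong-refl : ∀ {x a} → Cong x a a
cong-refl {x} {a} = + 0 , sym (trans (cong (_+_ a) (ℤP.*-zeroʳ x)) (ℤP.+-identityʳ a))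

cong-sum : ∀ {x n} {f g : Fin n → ℤ} → (∀ i → Cong x (f i) (g i)) → Cong x (sumFin f) (sumFin g)
cong-sum {n = zero}  e = cong-refl
cong-sum {n = suc n} e = cong-+ (e zero) (cong-sum (e ∘ suc))

cong-det : ∀ {x n} {A B : Mat n} → (∀ r c → Cong x (A r c) (B r c)) → Cong x (det A) (det B)
cong-det {n = zero}  e = cong-refl
cong-det {n = suc n} {A} {B} e = cong-sum λ j →
  cong-* (cong-refl {a = sgn (toℕ j)}) (cong-* (e zero j) (cong-det {A = minor j A} {minor j B} (λ r c → e (suc r) (punchIn j c))))

nz-* : ∀ a b → a ≢ + 0 → a * b ≡ + 0 → b ≡ + 0
nz-* a b a≢0 e with ℤP.i*j≡0⇒i≡0∨j≡0 a e
... | inj₁ p = ⊥-elim (a≢0 p)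
... | inj₂ p = p

Inj : ∀ {m n} → (Fin m → Fin n → ℤ) → Set
Inj M = ∀ w → (∀ r → apply M w r ≡ + 0) → ∀ c → w c ≡ + 0

-- Pivoting without fractions: each column is multiplied by the pivot `M zero j`, a multiple of
-- column `j` is subtracted to clear row zero, and then the pivot's row and column are dropped.
eliminate : ∀ {m n} → Fin (suc n) → (Fin (suc m) → Fin (suc n) → ℤ) → Fin m → Fin n → ℤ
eliminate j M r c = M zero j * M (suc r) (punchIn j c) + (- M zero (punchIn j c)) * M (suc r) j

eliminate-inj : ∀ {m n} (j : Fin (suc n)) (M : Fin (suc m) → Fin (suc n) → ℤ) → M zero j ≢ + 0 →
                Inj M → Inj (eliminate j M)
eliminate-inj {m} {n} j M a≢0 inj w′ ker c =
  nz-* a (w′ c) a≢0 (trans (sym (w-punchIn c)) (inj w kerM (punchIn j c)))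
  where
  a = M zero j
  β : ℤ
  -- The pivot coordinate that annihilates row zero once the other coordinates are `a` times those
  -- of `w′`.
  β = - sumFin (λ c → M zero (punchIn j c) * w′ c)
  w : Fin (suc n) → ℤ
  w c with j ≟ c
  ... | yes _ = β
  ... | no j≢c = a * w′ (punchOut j≢c)
  w-at : w j ≡ β
  w-at with j ≟ j
  ... | yes _ = refl
  ... | no j≢j = ⊥-elim (j≢j refl)
  w-punchIn : ∀ c → w (punchIn j c) ≡ a * w′ c
  w-punchIn c with j ≟ punchIn j c
  ... | yes e = ⊥-elim (punchInᵢ≢i j c (sym e))
  ... | no j≢c = cong (λ z → a * w′ z) (trans (punchOut-cong j refl) (punchOut-punchIn j))
  split : ∀ r → apply M w r ≡ M r j * β + sumFin (λ c → M r (punchIn j c) * (a * w′ c))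
  split r = trans (sum-punchIn j (λ c → M r c * w c))
    (cong₂ _+_ (cong (M r j *_) w-at) (sum-cong (λ c → cong (M r (punchIn j c) *_) (w-punchIn c))))
  kerM : ∀ r → apply M w r ≡ + 0
  kerM zero = trans (split zero)
    (trans (cong (_+_ (a * β)) (trans (sum-cong (λ c → alg₁ (M zero (punchIn j c)) a (w′ c))) (sum-*ˡ a (λ c → M zero (punchIn j c) * w′ c))))
           (alg₂ a (sumFin (λ c → M zero (punchIn j c) * w′ c))))
    where
    alg₁ : ∀ m a w → m * (a * w) ≡ a * (m * w)
    alg₁ = solve-∀
    alg₂ : ∀ a s → a * (- s) + a * s ≡ + 0
    alg₂ = solve-∀
  kerM (suc r) = trans (split (suc r)) (trans (sym fold) (ker r))
    where
    t = M (suc r) j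
    alg₁ : ∀ a m z t w → (a * m + (- z) * t) * w ≡ m * (a * w) + (- t) * (z * w)
    alg₁ = solve-∀
    alg₂ : ∀ x t s → x + (- t) * s ≡ t * (- s) + x
    alg₂ = solve-∀
    fold : apply (eliminate j M) w′ r ≡ t * β + sumFin (λ c → M (suc r) (punchIn j c) * (a * w′ c))
    fold = trans (sum-cong (λ c → alg₁ a (M (suc r) (punchIn j c)) (M zero (punchIn j c)) t (w′ c)))
      (trans (sum-+ (λ c → M (suc r) (punchIn j c) * (a * w′ c)) (λ c → (- t) * (M zero (punchIn j c) * w′ c)))
      (trans (cong (_+_ (sumFin (λ c → M (suc r) (punchIn j c) * (a * w′ c)))) (sum-*ˡ (- t) (λ c → M zero (punchIn j c) * w′ c)))
             (alg₂ _ t _)))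

nonzeroEntry? : ∀ {n} (f : Fin n → ℤ) → (∃ λ j → f j ≢ + 0) ⊎ (∀ j → f j ≡ + 0)
nonzeroEntry? f with any? (λ j → ¬? (f j ℤ.≟ + 0))
... | yes p = inj₁ p
... | no ¬p = inj₂ λ j → decidable-stable (f j ℤ.≟ + 0) (λ q → ¬p (j , q))

dropZeroRow-inj : ∀ {m n} (M : Fin (suc m) → Fin n → ℤ) → (∀ c → M zero c ≡ + 0) → Inj M → Inj (M ∘ suc)
dropZeroRow-inj M z inj w ker = inj w λ where
  zero → sum-zero (λ c → cong (_* w c) (z c))
  (suc r) → ker r

dropCol-inj : ∀ {m n} (M : Fin m → Fin (suc n) → ℤ) → Inj M → Inj (λ r c → M r (suc c))
dropCol-inj {m} {n} M inj w ker c = inj w⁺ (λ r → trans (cong (_+ apply (λ r c → M r (suc c)) w r) (ℤP.*-zeroʳ (M r zero)))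
                                           (trans (ℤP.+-identityˡ _) (ker r))) (suc c)
  where
  w⁺ : Fin (suc n) → ℤ
  w⁺ zero = + 0
  w⁺ (suc c) = w c

-- An underdetermined system has a nonzero solution. It settles the case of `inj⇒det≢0` where the
-- first row vanishes and nothing can serve as pivot.
wide-not-inj : ∀ {n} (M : Fin n → Fin (suc n) → ℤ) → ¬ Inj M
wide-not-inj {zero} M inj with inj (λ _ → + 1) (λ ()) zero
... | ()
wide-not-inj {suc n} M inj with nonzeroEntry? (M zero)
... | inj₁ (j , a≢0) = wide-not-inj (eliminate j M) (eliminate-inj j M a≢0 inj)
... | inj₂ z = wide-not-inj (λ r c → M (suc r) (suc c)) (dropCol-inj (M ∘ suc) (dropZeroRow-inj M z inj))

-- Only vanishing is carried over, because scaling the columns multiplies the determinant by the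
-- factors `a c` with `c ≢ j`.
det-addMultiples : ∀ {n} (j : Fin n) (a b : Fin n → ℤ) {A B : Mat n} →
                   (∀ r c → c ≢ j → B r c ≡ a c * A r c + b c * A r j) → (∀ r → B r j ≡ A r j) →
                   det A ≡ + 0 → det B ≡ + 0
det-addMultiples {n} j a b {A} {B} eo ej dA = trans (det-cong (λ r c → sym (K-below r c n (toℕ<n c)))) (go n ℕP.≤-refl)
  where
  -- A hybrid with the first `t` columns from `B` and the rest from `A`. Raising `t` changes one
  -- column, and by linearity the added multiple of column `j` contributes a matrix with two equal
  -- columns.
  K : ℕ → Mat n
  K t r c = if toℕ c ℕ.<ᵇ t then B r c else A r c
  K-below : ∀ r c t → toℕ c ℕ.< t → K t r c ≡ B r c
  K-below r c t lt with toℕ c ℕ.<ᵇ t | ℕP.<⇒<ᵇ lt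
  ... | true | _ = refl
  K-above : ∀ r c t → ¬ (toℕ c ℕ.< t) → K t r c ≡ A r c
  K-above r c t nlt with toℕ c ℕ.<ᵇ t in eq
  ... | true = ⊥-elim (nlt (ℕP.<ᵇ⇒< (toℕ c) t (subst T (sym eq) _)))
  ... | false = refl
  K-j : ∀ r t → K t r j ≡ A r j
  K-j r t with toℕ j ℕ.<ᵇ t
  ... | true = ej r
  ... | false = refl
  K-step : ∀ r c t → toℕ c ≢ t → K (suc t) r c ≡ K t r c
  K-step r c t c≢t with toℕ c ℕ.<? t
  ... | yes lt = trans (K-below r c (suc t) (ℕP.m<n⇒m<1+n lt)) (sym (K-below r c t lt))
  ... | no nlt = trans (K-above r c (suc t) (λ lt → nlt (ℕP.≤∧≢⇒< (ℕP.≤-pred lt) c≢t))) (sym (K-above r c t nlt))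
  go : ∀ t → t ℕ.≤ n → det (K t) ≡ + 0
  go zero _ = dA
  go (suc t) t<n with fromℕ< t<n ≟ j
  ... | yes i≡j = trans (det-cong pw) (go t (ℕP.<⇒≤ t<n))
    where
    pw : ∀ r c → K (suc t) r c ≡ K t r c
    pw r c with c ≟ j
    ... | yes refl = trans (K-j r (suc t)) (sym (K-j r t))
    ... | no c≢j = K-step r c t (λ e → c≢j (trans (toℕ-injective (trans e (sym (toℕ-fromℕ< t<n)))) i≡j))
  ... | no i≢j = trans
      (det-linear i (a i) (b i) {K (suc t)} {K t} {C} atI
        (λ r c c≢i → K-step r c t (c≢t c c≢i))
        (λ r c c≢i → trans (K-step r c t (c≢t c c≢i)) (sym (setCol-off (K t) i (λ r → A r j) r c≢i))))
      (trans (cong₂ (λ x y → a i * x + b i * y) (go t (ℕP.<⇒≤ t<n)) dC)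
             (cong₂ _+_ (ℤP.*-zeroʳ (a i)) (ℤP.*-zeroʳ (b i))))
    where
    i = fromℕ< t<n
    ti : toℕ i ≡ t
    ti = toℕ-fromℕ< t<n
    C : Mat n
    C = setCol (K t) i (λ r → A r j)
    c≢t : ∀ c → c ≢ i → toℕ c ≢ t
    c≢t c c≢i e = c≢i (toℕ-injective (trans e (sym ti)))
    dC : det C ≡ + 0
    dC = det-alternating i≢j {C} (λ r → trans (setCol-at (K t) i (λ r → A r j) r)
           (sym (trans (setCol-off (K t) i (λ r → A r j) r (i≢j ∘ sym)) (K-j r t))))
    atI : ∀ r → K (suc t) r i ≡ a i * K t r i + b i * C r i
    atI r = trans (K-below r i (suc t) (subst (ℕ._< suc t) (sym ti) (ℕP.n<1+n t)))
      (trans (eo r i i≢j) (cong₂ (λ x y → a i * x + b i * y)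
        (sym (K-above r i t (λ lt → ℕP.<-irrefl ti lt)))
        (sym (setCol-at (K t) i (λ r → A r j) r))))

eliminate-det : ∀ {n} (j : Fin (suc n)) (M : Mat (suc n)) → M zero j ≢ + 0 → det M ≡ + 0 → det (eliminate j M) ≡ + 0
eliminate-det {n} j M a≢0 dM = nz-* a (det (eliminate j M)) a≢0 (sgn-cancel (toℕ j) _ (trans (sym expand) dB))
  where
  a = M zero j
  B : Mat (suc n)
  B = setCol (λ r c → a * M r c + (- M zero c) * M r j) j (λ r → M r j)
  B-off : ∀ r c → c ≢ j → B r c ≡ a * M r c + (- M zero c) * M r j
  B-off r c c≢j = setCol-off (λ r c → a * M r c + (- M zero c) * M r j) j (λ r → M r j) r c≢j
  B-at : ∀ r → B r j ≡ M r j
  B-at = setCol-at (λ r c → a * M r c + (- M zero c) * M r j) j (λ r → M r j)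
  dB : det B ≡ + 0
  dB = det-addMultiples j (λ _ → a) (λ c → - M zero c) {M} {B} B-off B-at dM
  alg : ∀ a m → a * m + (- m) * a ≡ + 0
  alg = solve-∀
  expand : det B ≡ sgn (toℕ j) * (a * det (eliminate j M))
  expand = trans (sum-single j (λ i → sgn (toℕ i) * (B zero i * det (minor i B)))
      (λ i i≢j → trans (cong (λ z → sgn (toℕ i) * (z * det (minor i B))) (trans (B-off zero i i≢j) (alg a (M zero i))))
                       (ℤP.*-zeroʳ (sgn (toℕ i)))))
    (cong (sgn (toℕ j) *_) (cong₂ _*_ (B-at zero) (det-cong (λ r c → B-off (suc r) (punchIn j c) (punchInᵢ≢i j c)))))

inj⇒det≢0 : ∀ {n} (M : Mat n) → Inj M → det M ≢ + 0
inj⇒det≢0 {zero} M inj ()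
inj⇒det≢0 {suc n} M inj dM with nonzeroEntry? (M zero)
... | inj₁ (j , a≢0) = inj⇒det≢0 (eliminate j M) (eliminate-inj j M a≢0 inj) (eliminate-det j M a≢0 dM)
... | inj₂ z = wide-not-inj (M ∘ suc) (dropZeroRow-inj M z inj)

det≢0⇒inj : ∀ {n} (M : Mat n) → det M ≢ + 0 → Inj M
det≢0⇒inj M d≢0 w ker j = nz-* (det M) (w j) d≢0
  (trans (ℤP.*-comm (det M) (w j)) (trans (sym (det-cramer M j w))
    (det-zeroCol j (λ r → trans (setCol-at M j (apply M w) r) (ker r)))))

-- Growth of the characteristic polynomial

-- Bounding positive arguments only makes powers monotone in the exponent and allows a factor `x` to
-- be cancelled.
record O (d : ℕ) (f : ℕ → ℤ) : Set where
  constructor bounded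
  field
    const : ℕ
    bound : ∀ x → ∣ f (suc x) ∣ ℕ.≤ const ℕ.* suc x ℕ.^ d

module _ where
  open ℕP.≤-Reasoning

  O-cong : ∀ {d f g} → (∀ x → f x ≡ g x) → O d f → O d g
  O-cong e (bounded c b) = bounded c λ x → subst (λ z → ∣ z ∣ ℕ.≤ _) (e (suc x)) (b x)

  O-+ : ∀ {d f g} → O d f → O d g → O d (λ x → f x + g x)
  O-+ {d} {f} {g} (bounded c b) (bounded c′ b′) = bounded (c ℕ.+ c′) λ x → begin
    ∣ f (suc x) + g (suc x) ∣             ≤⟨ ℤP.∣i+j∣≤∣i∣+∣j∣ (f (suc x)) (g (suc x)) ⟩
    ∣ f (suc x) ∣ ℕ.+ ∣ g (suc x) ∣       ≤⟨ ℕP.+-mono-≤ (b x) (b′ x) ⟩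
    c ℕ.* suc x ℕ.^ d ℕ.+ c′ ℕ.* suc x ℕ.^ d ≡⟨ ℕP.*-distribʳ-+ (suc x ℕ.^ d) c c′ ⟨
    (c ℕ.+ c′) ℕ.* suc x ℕ.^ d ∎

  O-* : ∀ {d e f g} → O d f → O e g → O (d ℕ.+ e) (λ x → f x * g x)
  O-* {d} {e} {f} {g} (bounded c b) (bounded c′ b′) = bounded (c ℕ.* c′) λ x → begin
    ∣ f (suc x) * g (suc x) ∣             ≡⟨ ℤP.abs-* (f (suc x)) (g (suc x)) ⟩
    ∣ f (suc x) ∣ ℕ.* ∣ g (suc x) ∣       ≤⟨ ℕP.*-mono-≤ (b x) (b′ x) ⟩
    (c ℕ.* suc x ℕ.^ d) ℕ.* (c′ ℕ.* suc x ℕ.^ e) ≡⟨ ℕP.[m*n]*[o*p]≡[m*o]*[n*p] c (suc x ℕ.^ d) c′ (suc x ℕ.^ e) ⟩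
    (c ℕ.* c′) ℕ.* (suc x ℕ.^ d ℕ.* suc x ℕ.^ e) ≡⟨ cong ((c ℕ.* c′) ℕ.*_) (ℕP.^-distribˡ-+-* (suc x) d e) ⟨
    (c ℕ.* c′) ℕ.* suc x ℕ.^ (d ℕ.+ e) ∎

  O-weaken : ∀ {d e f} → d ℕ.≤ e → O d f → O e f
  O-weaken {d} {e} d≤e (bounded c b) = bounded c λ x → ℕP.≤-trans (b x) (ℕP.*-monoʳ-≤ c (ℕP.^-monoʳ-≤ (suc x) d≤e))

  O-const : ∀ c → O 0 (λ _ → c)
  O-const c = bounded ∣ c ∣ λ x → ℕP.≤-reflexive (sym (ℕP.*-identityʳ ∣ c ∣))

  O-zero : ∀ {d} → O d (λ _ → + 0)
  O-zero = bounded 0 λ x → z≤n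

  O-id : O 1 (λ x → + x)
  O-id = bounded 1 λ x → ℕP.≤-reflexive (sym (trans (ℕP.*-identityˡ (suc x ℕ.* 1)) (ℕP.*-identityʳ (suc x))))

  O-*x⁻¹ : ∀ {d f} → O (suc d) (λ x → + x * f x) → O d f
  O-*x⁻¹ {d} {f} (bounded c b) = bounded c λ x → ℕP.*-cancelˡ-≤ (suc x) (begin
    suc x ℕ.* ∣ f (suc x) ∣      ≡⟨ ℤP.abs-* (+ suc x) (f (suc x)) ⟨
    ∣ + suc x * f (suc x) ∣      ≤⟨ b x ⟩
    c ℕ.* (suc x ℕ.* suc x ℕ.^ d) ≡⟨ ℕP.*-assoc c (suc x) (suc x ℕ.^ d) ⟨
    c ℕ.* suc x ℕ.* suc x ℕ.^ d   ≡⟨ cong (ℕ._* suc x ℕ.^ d) (ℕP.*-comm c (suc x)) ⟩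
    suc x ℕ.* c ℕ.* suc x ℕ.^ d   ≡⟨ ℕP.*-assoc (suc x) c (suc x ℕ.^ d) ⟩
    suc x ℕ.* (c ℕ.* suc x ℕ.^ d) ∎)

O-neg : ∀ {d f} → O d f → O d (λ x → - f x)
O-neg {d} {f} (bounded c b) = bounded c λ x → subst (ℕ._≤ _) (sym (ℤP.∣-i∣≡∣i∣ (f (suc x)))) (b x)

O-scale : ∀ {d f} c → O d f → O d (λ x → c * f x)
O-scale c o = O-* (O-const c) o

O-*x : ∀ {d f} → O d f → O (suc d) (λ x → + x * f x)
O-*x o = O-* O-id o

O-sum : ∀ {d n} {F : Fin n → ℕ → ℤ} → (∀ i → O d (F i)) → O d (λ x → sumFin λ i → F i x)
O-sum {n = zero} o = O-zero
O-sum {n = suc n} o = O-+ (o zero) (O-sum (o ∘ suc))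

pw : ℕ → ℕ → ℤ
pw d x = + (x ℕ.^ d)

pw-suc : ∀ d x → pw (suc d) x ≡ + x * pw d x
pw-suc d x = ℤP.pos-* x (x ℕ.^ d)

O-pw : ∀ d → O d (pw d)
O-pw d = bounded 1 λ x → ℕP.≤-reflexive (sym (ℕP.*-identityˡ _))

-- Evaluation at one more than the implied constant `K` gives `∣ c ∣ * suc K ≤ K`.
O-lead : ∀ {d} c → O d (λ x → c * pw (suc d) x) → c ≡ + 0
O-lead {d} c (bounded K b) = ℤP.∣i∣≡0⇒i≡0 (small ∣ c ∣ (ℕP.*-cancelʳ-≤ (∣ c ∣ ℕ.* suc K) K (suc K ℕ.^ d) {{ℕP.m^n≢0 (suc K) d}} le))
  where
  le : ∣ c ∣ ℕ.* suc K ℕ.* suc K ℕ.^ d ℕ.≤ K ℕ.* suc K ℕ.^ d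
  le = subst (ℕ._≤ K ℕ.* suc K ℕ.^ d)
    (trans (ℤP.abs-* c (pw (suc d) (suc K))) (sym (ℕP.*-assoc ∣ c ∣ (suc K) (suc K ℕ.^ d)))) (b K)
  small : ∀ a → a ℕ.* suc K ℕ.≤ K → a ≡ 0
  small zero _ = refl
  small (suc a) l = ⊥-elim (ℕP.<-irrefl refl (ℕP.≤-trans (ℕP.m≤m+n (suc K) (a ℕ.* suc K)) l))

det-O : ∀ {n} (A : ℕ → Mat n) → (∀ r c → O 1 (λ x → A x r c)) → O n (λ x → det (A x))
det-O {zero} A o = O-const (+ 1)
det-O {suc n} A o = O-sum λ i → O-scale (sgn (toℕ i))
  (O-* (o zero i) (det-O (λ x → minor i (A x)) (λ r c → o (suc r) (punchIn i c))))

-- Every product in the full expansion takes exactly one entry from the constant column, so one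
-- power is saved against `det-O`.
det-O-constCol : ∀ {n} (j : Fin (suc n)) (A : ℕ → Mat (suc n)) → (∀ r c → O 1 (λ x → A x r c)) →
                 (∀ r → O 0 (λ x → A x r j)) → O n (λ x → det (A x))
det-O-constCol {zero} zero A o oj = O-+ (O-scale (+ 1) (O-* (oj zero) (O-const (+ 1)))) O-zero
det-O-constCol {suc n} j A o oj = O-sum λ i → O-scale (sgn (toℕ i)) (term i)
  where
  minorO : ∀ i → ∀ r c → O 1 (λ x → minor i (A x) r c)
  minorO i r c = o (suc r) (punchIn i c)
  term : ∀ i → O (suc n) (λ x → A x zero i * det (minor i (A x)))
  term i with i ≟ j
  ... | yes refl = O-* (oj zero) (det-O (λ x → minor i (A x)) (minorO i))
  ... | no i≢j = O-* (o zero i) (det-O-constCol (punchOut i≢j) (λ x → minor i (A x)) (minorO i)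
          (λ r → subst (λ z → O 0 (λ x → A x (suc r) z)) (sym (punchIn-punchOut i≢j)) (oj (suc r))))

-- The characteristic polynomial of a bordered matrix

charMat : ∀ {n} → Mat n → ℤ → Mat n
charMat M x i j = (if δ i j then x else + 0) - M i j

charPoly : ∀ {n} → Mat n → ℤ → ℤ
charPoly M x = det (charMat M x)

charMat-ind : ∀ {n} (M : Mat n) x i j → charMat M x i j ≡ x * ind i j - M i j
charMat-ind M x i j with δ i j
... | true = cong (_- M i j) (sym (ℤP.*-identityʳ x))
... | false = cong (_- M i j) (sym (ℤP.*-zeroʳ x))

O-charMat : ∀ {n} (M : Mat n) r c → O 1 (λ x → charMat M (+ x) r c)
O-charMat M r c with δ r c
... | true = O-+ O-id (O-weaken z≤n (O-const (- M r c)))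
... | false = O-weaken z≤n (O-const (+ 0 - M r c))

sub : ∀ {n} → Mat (suc n) → Mat n
sub M r c = M (suc r) (suc c)

charMat-sub : ∀ {n} (M : Mat (suc n)) x r c → charMat M x (suc r) (suc c) ≡ charMat (sub M) x r c
charMat-sub M x r c with r ≟ c
... | yes _ = refl
... | no _ = refl

-- The `j`-th coordinate of the adjugate of `x I - M` applied to `v`.
replaced : ∀ {n} → Mat n → ℤ → Fin n → (Fin n → ℤ) → ℤ
replaced M x j v = det (setCol (charMat M x) j v)

border-term : ∀ {n} (M : Mat (suc n)) x (j : Fin n) →
              sgn (suc (toℕ j)) * ((+ 0 - M zero (suc j)) * det (minor (suc j) (charMat M x)))
              ≡ - (M zero (suc j) * replaced (sub M) x j (λ i → M (suc i) zero))
border-term {suc n} M x j =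
  trans (cong₂ (λ s d → s * ((+ 0 - r) * d)) (sgn-suc (toℕ j)) B≡)
  (trans (alg (sgn (toℕ j)) r (replaced (sub M) x j c))
         (trans (cong (λ z → - (z * (r * replaced (sub M) x j c))) (sgn-sq (toℕ j))) (cong -_ (ℤP.*-identityˡ _))))
  where
  r = M zero (suc j)
  c : Fin (suc n) → ℤ
  c i = M (suc i) zero
  B : Mat (suc n)
  B = minor (suc j) (charMat M x)
  negc : Fin (suc n) → ℤ
  negc i = + 0 - c i
  A : Mat (suc n)
  A = setCol (charMat (sub M) x) j negc
  A≡ : det A ≡ - replaced (sub M) x j c
  A≡ = trans (setCol-cong (charMat (sub M) x) j {negc} {λ i → (- (+ 1)) * c i} (λ i → neg (c i)))
       (trans (setCol-* (charMat (sub M) x) j (- (+ 1)) c) (neg′ (replaced (sub M) x j c)))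
    where
    neg : ∀ z → + 0 - z ≡ (- (+ 1)) * z
    neg = solve-∀
    neg′ : ∀ z → (- (+ 1)) * z ≡ - z
    neg′ = solve-∀
  mf : det A ≡ sgn (toℕ j) * det B
  mf = det-moveFront j {A} {B} (λ r → setCol-at (charMat (sub M) x) j negc r)
         (λ r c → trans (setCol-off (charMat (sub M) x) j negc r (punchInᵢ≢i j c)) (sym (charMat-sub M x r (punchIn j c))))
  s = sgn (toℕ j)
  B≡ : det B ≡ s * (- replaced (sub M) x j c)
  B≡ = trans (sym (ℤP.*-identityˡ (det B))) (trans (cong (_* det B) (sym (sgn-sq (toℕ j))))
       (trans (ℤP.*-assoc s s (det B)) (cong (s *_) (trans (sym mf) A≡))))
  alg : ∀ s r d → (- s) * ((+ 0 - r) * (s * (- d))) ≡ - ((s * s) * (r * d))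
  alg = solve-∀

-- The bordered determinant formula: the sum is row zero times the adjugate of `x I - sub M` times
-- column zero.
border : ∀ {n} (M : Mat (suc n)) x →
         charPoly M x ≡ (x - M zero zero) * charPoly (sub M) x
                        - sumFin (λ j → M zero (suc j) * replaced (sub M) x j (λ i → M (suc i) zero))
border M x = cong₂ _+_
  (trans (ℤP.*-identityˡ _) (cong ((x - M zero zero) *_) (det-cong (charMat-sub M x))))
  (trans (sum-cong (border-term M x)) (sum-neg (λ j → M zero (suc j) * replaced (sub M) x j (λ i → M (suc i) zero))))

apply-charMat : ∀ {n} (M : Mat n) x v r → apply (charMat M x) v r ≡ x * v r - apply M v r
apply-charMat M x v r =
  trans (sum-cong (λ c → trans (cong (_* v c) (charMat-ind M x r c)) (alg x (ind r c) (M r c) (v c))))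
  (trans (sum-minus (λ c → ind r c * (x * v c)) (λ c → M r c * v c))
         (cong (_- apply M v r) (trans (sum-cong (λ c → cong (_* (x * v c)) (ind-sym r c))) (sum-ind r (λ c → x * v c)))))
  where
  alg : ∀ x i m v → (x * i - m) * v ≡ i * (x * v) - m * v
  alg = solve-∀

-- From `x v = (x I - M) v + M v`, with Cramer's rule for the first summand. Iteration expands the
-- adjugate in powers of `M`, each at the price of one factor `x`.
replaced-step : ∀ {n} (M : Mat n) x j v →
                x * replaced M x j v ≡ v j * charPoly M x + replaced M x j (apply M v)
replaced-step M x j v =
  trans (sym (setCol-* (charMat M x) j x v))
  (trans (setCol-cong (charMat M x) j (λ r → trans (alg (x * v r) (apply M v r))
            (cong (λ z → + 1 * z + + 1 * apply M v r) (sym (apply-charMat M x v r)))))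
  (trans (setCol-linear (charMat M x) j (+ 1) (+ 1) (apply (charMat M x) v) (apply M v))
  (cong₂ _+_ (trans (ℤP.*-identityˡ _) (det-cramer (charMat M x) j v)) (ℤP.*-identityˡ _))))
  where
  alg : ∀ a b → a ≡ + 1 * (a - b) + + 1 * b
  alg = solve-∀

dot : ∀ {n} → (Fin n → ℤ) → (Fin n → ℤ) → ℤ
dot u v = sumFin λ i → u i * v i

-- The quotient of the characteristic polynomials of `M` and `M′` begins x - a - b/x - c/x². Two
-- rounds of `replaced-step` produce these terms, and `err` is what remains after them.
module Border {n} (M : Mat (suc n)) where
  M′ = sub M
  a b c : ℤ
  row col : Fin n → ℤ
  row j = M zero (suc j)
  col i = M (suc i) zero
  a = M zero zero
  b = dot row col
  c = dot row (apply M′ col)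
  err : ℤ → ℤ
  err x = sumFin λ j → row j * replaced M′ x j (apply M′ (apply M′ col))

  border² : ∀ x → x * (x * charPoly M x) ≡ charPoly M′ x * (x * (x * x) - a * (x * x) - b * x - c) - err x
  border² x = trans (cong (λ z → x * (x * z)) (border M x))
    (trans (alg₁ x a p′ (sumFin λ j → row j * replaced M′ x j col))
    (trans (cong (λ z → x * (x * ((x - a) * p′)) - z) Σ≡)
           (alg₂ x a b c p′ (err x))))
    where
    p′ = charPoly M′ x
    alg₁ : ∀ x a p s → x * (x * ((x - a) * p - s)) ≡ x * (x * ((x - a) * p)) - x * (x * s)
    alg₁ = solve-∀
    alg₂ : ∀ x a b c p e → x * (x * ((x - a) * p)) - (b * (x * p) + (c * p + e)) ≡ p * (x * (x * x) - a * (x * x) - b * x - c) - e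
    alg₂ = solve-∀
    alg₃ : ∀ x r d → x * (x * (r * d)) ≡ r * (x * (x * d))
    alg₃ = solve-∀
    alg₄ : ∀ r x c p m e → r * (x * (c * p) + (m * p + e)) ≡ (r * c) * (x * p) + ((r * m) * p + r * e)
    alg₄ = solve-∀
    term : ∀ j → x * (x * (row j * replaced M′ x j col)) ≡
                 (row j * col j) * (x * p′) + ((row j * apply M′ col j) * p′ + row j * replaced M′ x j (apply M′ (apply M′ col)))
    term j = trans (alg₃ x (row j) (replaced M′ x j col))
      (trans (cong (row j *_) (trans (cong (x *_) (replaced-step M′ x j col))
               (trans (ℤP.*-distribˡ-+ x (col j * p′) (replaced M′ x j (apply M′ col)))
                      (cong (_+_ (x * (col j * p′))) (replaced-step M′ x j (apply M′ col))))))
             (alg₄ (row j) x (col j) p′ (apply M′ col j) _))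
    Σ≡ : x * (x * sumFin (λ j → row j * replaced M′ x j col)) ≡ b * (x * p′) + (c * p′ + err x)
    Σ≡ = trans (cong (x *_) (sym (sum-*ˡ x (λ j → row j * replaced M′ x j col))))
      (trans (sym (sum-*ˡ x (λ j → x * (row j * replaced M′ x j col))))
      (trans (sum-cong term)
      (trans (sum-+ (λ j → (row j * col j) * (x * p′)) (λ j → (row j * apply M′ col j) * p′ + row j * replaced M′ x j (apply M′ (apply M′ col))))
      (cong₂ _+_ (sum-*ʳ (x * p′) (λ j → row j * col j))
        (trans (sum-+ (λ j → (row j * apply M′ col j) * p′) (λ j → row j * replaced M′ x j (apply M′ (apply M′ col))))
               (cong (_+ err x) (sum-*ʳ p′ (λ j → row j * apply M′ col j))))))))

O-setCol : ∀ {m n} (A : ℕ → Fin m → Fin n → ℤ) j v → (∀ r c → O 1 (λ x → A x r c)) → ∀ r c → O 1 (λ x → setCol (A x) j v r c)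
O-setCol A j v o r c with δ c j
... | true = O-weaken z≤n (O-const (v r))
... | false = o r c

O-replaced : ∀ {n} (M : Mat n) j v → O n (λ x → + x * replaced M (+ x) j v)
O-replaced {suc n} M j v = O-*x (det-O-constCol j (λ x → setCol (charMat M (+ x)) j v)
  (O-setCol (λ x → charMat M (+ x)) j v (O-charMat M))
  (λ r → O-cong (λ x → sym (setCol-at (charMat M (+ x)) j v r)) (O-const (v r))))

O-err : ∀ {n} (M : Mat (suc n)) → O n (λ x → + x * Border.err M (+ x))
O-err {n} M = O-cong (λ x → trans (sum-cong (λ j → alg (row j) (+ x) _)) (sum-*ˡ (+ x) (λ j → row j * replaced M′ (+ x) j (apply M′ (apply M′ col)))))
  (O-sum λ j → O-scale (row j) (O-replaced M′ j (apply M′ (apply M′ col))))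
  where
  open Border M
  alg : ∀ r x d → r * (x * d) ≡ x * (r * d)
  alg = solve-∀

-- Traces of powers from the leading coefficients

tr¹ tr² tr³ : ∀ {n} → Mat n → ℤ
tr¹ M = sumFin λ i → M i i
tr² M = sumFin λ i → sumFin λ j → M i j * M j i
tr³ M = sumFin λ i → sumFin λ j → sumFin λ k → M i j * (M j k * M k i)

module _ {n} (M : Mat (suc n)) where
  open Border M

  tr²-border : tr² M ≡ a * a + + 2 * b + tr² M′
  tr²-border = trans (cong (_+_ (a * a + b))
      (trans (sum-+ (λ i → col i * row i) (λ i → sumFin λ j → M′ i j * M′ j i))
             (cong (_+ tr² M′) (sum-cong (λ i → ℤP.*-comm (col i) (row i))))))
    (alg (a * a) b (tr² M′))
    where
    alg : ∀ a b t → (a + b) + (b + t) ≡ a + + 2 * b + t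
    alg = solve-∀

  -- The summands are closed walks of length three. Those visiting index zero three times give `a³`;
  -- two visits give `a b` and one visit gives `c`, each with three rotations.
  tr³-border : tr³ M ≡ a * (a * a) + + 3 * (a * b) + + 3 * c + tr³ M′
  tr³-border = trans (cong₂ _+_ first rest) (alg (a * (a * a)) (a * b) c (tr³ M′))
    where
    alg : ∀ a b c t → ((a + b) + (b + c)) + ((b + c) + (c + t)) ≡ a + + 3 * b + + 3 * c + t
    alg = solve-∀
    flip₁ : ∀ r c a → r * (c * a) ≡ a * (r * c)
    flip₁ = solve-∀
    flip₂ : ∀ r c a → c * (a * r) ≡ a * (r * c)
    flip₂ = solve-∀
    flip₃ : ∀ x y z → x * (y * z) ≡ y * (z * x)
    flip₃ = solve-∀
    flip₄ : ∀ x y z → x * (y * z) ≡ z * (x * y)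
    flip₄ = solve-∀
    first : (a * (a * a) + sumFin (λ k → a * (row k * col k))) +
            sumFin (λ j → row j * (col j * a) + sumFin (λ k → row j * (M′ j k * col k)))
            ≡ (a * (a * a) + a * b) + (a * b + c)
    first = cong₂ _+_ (cong (_+_ (a * (a * a))) (sum-*ˡ a (λ k → row k * col k)))
      (trans (sum-+ (λ j → row j * (col j * a)) (λ j → sumFin (λ k → row j * (M′ j k * col k))))
        (cong₂ _+_ (trans (sum-cong (λ j → flip₁ (row j) (col j) a)) (sum-*ˡ a (λ k → row k * col k)))
                   (sum-cong (λ j → sum-*ˡ (row j) (λ k → M′ j k * col k)))))
    T₁ T₂ T₃ T₄ : Fin n → ℤ
    T₁ i = col i * (a * row i)
    T₂ i = sumFin (λ k → col i * (row k * M′ k i))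
    T₃ i = sumFin (λ j → M′ i j * (col j * row i))
    T₄ i = sumFin (λ j → sumFin (λ k → M′ i j * (M′ j k * M′ k i)))
    rest : sumFin (λ i → (T₁ i + T₂ i) + sumFin (λ j → M′ i j * (col j * row i) + sumFin (λ k → M′ i j * (M′ j k * M′ k i))))
           ≡ (a * b + c) + (c + tr³ M′)
    rest = trans (sum-cong (λ i → cong (_+_ (T₁ i + T₂ i)) (sum-+ (λ j → M′ i j * (col j * row i)) (λ j → sumFin (λ k → M′ i j * (M′ j k * M′ k i))))))
      (trans (sum-+ (λ i → T₁ i + T₂ i) (λ i → T₃ i + T₄ i))
      (cong₂ _+_
        (trans (sum-+ T₁ T₂) (cong₂ _+_
          (trans (sum-cong (λ i → flip₂ (row i) (col i) a)) (sum-*ˡ a (λ k → row k * col k)))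
          (trans (sum-swap (λ i k → col i * (row k * M′ k i)))
            (sum-cong (λ k → trans (sum-cong (λ i → flip₃ (col i) (row k) (M′ k i))) (sum-*ˡ (row k) (λ i → M′ k i * col i)))))))
        (trans (sum-+ T₃ T₄) (cong (_+ tr³ M′)
          (sum-cong (λ i → trans (sum-cong (λ j → flip₄ (M′ i j) (col j) (row i))) (sum-*ˡ (row i) (λ j → M′ i j * col j))))))))

-- By Newton's identities, 6 charPoly M agrees to relative order x⁻³ with xⁿ⁻³ times this cubic.
newton : ℤ → ℤ → ℤ → ℤ → ℤ
newton s₁ s₂ s₃ x = + 6 * (x * (x * x)) - + 6 * (s₁ * (x * x)) + + 3 * ((s₁ * s₁ - s₂) * x)
                    - (s₁ * (s₁ * s₁) - + 3 * (s₁ * s₂) + + 2 * s₃)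

-- The factor `x⁴` turns an error of order n-4 into one of order n, so that no exponent is negative
-- for small matrices.
discrepancy : ∀ {n} → Mat n → ℕ → ℤ
discrepancy {n} M x = + 6 * pw 4 x * charPoly M (+ x) - pw (suc n) x * newton (tr¹ M) (tr² M) (tr³ M) (+ x)

-- Multiplying by the border cubic updates the power sums exactly as bordering updates the traces:
-- the terms in x⁶ down to x³ cancel and a quadratic remainder is left.
newton-step : ∀ s₁ s₂ s₃ a b c x →
  newton s₁ s₂ s₃ x * (x * (x * x) - a * (x * x) - b * x - c)
  - x * (x * x) * newton (a + s₁) (a * a + + 2 * b + s₂) (a * (a * a) + + 3 * (a * b) + + 3 * c + s₃) x
  ≡ (a * (s₁ * (s₁ * s₁) - + 3 * (s₁ * s₂) + + 2 * s₃) - b * (+ 3 * (s₁ * s₁ - s₂)) + + 6 * (c * s₁)) * (x * x)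
    + (b * (s₁ * (s₁ * s₁) - + 3 * (s₁ * s₂) + + 2 * s₃) - c * (+ 3 * (s₁ * s₁ - s₂))) * x
    + c * (s₁ * (s₁ * s₁) - + 3 * (s₁ * s₂) + + 2 * s₃)
newton-step = expanded
  where
  expanded : ∀ s₁ s₂ s₃ a b c x →
    (+ 6 * (x * (x * x)) - + 6 * (s₁ * (x * x)) + + 3 * ((s₁ * s₁ - s₂) * x) - (s₁ * (s₁ * s₁) - + 3 * (s₁ * s₂) + + 2 * s₃))
      * (x * (x * x) - a * (x * x) - b * x - c)
    - x * (x * x) * (+ 6 * (x * (x * x)) - + 6 * ((a + s₁) * (x * x)) + + 3 * (((a + s₁) * (a + s₁) - (a * a + + 2 * b + s₂)) * x)
        - ((a + s₁) * ((a + s₁) * (a + s₁)) - + 3 * ((a + s₁) * (a * a + + 2 * b + s₂)) + + 2 * (a * (a * a) + + 3 * (a * b) + + 3 * c + s₃)))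
    ≡ (a * (s₁ * (s₁ * s₁) - + 3 * (s₁ * s₂) + + 2 * s₃) - b * (+ 3 * (s₁ * s₁ - s₂)) + + 6 * (c * s₁)) * (x * x)
      + (b * (s₁ * (s₁ * s₁) - + 3 * (s₁ * s₂) + + 2 * s₃) - c * (+ 3 * (s₁ * s₁ - s₂))) * x
      + c * (s₁ * (s₁ * s₁) - + 3 * (s₁ * s₂) + + 2 * s₃)
  expanded = solve-∀

pw4 : ∀ x → pw 4 x ≡ + x * (+ x * (+ x * + x))
pw4 x = trans (pw-suc 3 x) (cong (+ x *_) (trans (pw-suc 2 x) (cong (+ x *_) (trans (pw-suc 1 x) (cong (+ x *_) (cong +_ (ℕP.*-identityʳ x)))))))

discrepancy-zero : (M : Mat 0) → ∀ x → + 0 ≡ discrepancy M x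
discrepancy-zero M x = sym (trans (cong₂ (λ u v → + 6 * u * + 1 - v * newton (+ 0) (+ 0) (+ 0) (+ x)) (pw4 x) (cong +_ (ℕP.*-identityʳ x))) (alg (+ x)))
  where
  alg : ∀ x → + 6 * (x * (x * (x * x))) * + 1 - x * (+ 6 * (x * (x * x)) - + 6 * (+ 0 * (x * x)) + + 3 * ((+ 0 * + 0 - + 0) * x)
                    - (+ 0 * (+ 0 * + 0) - + 3 * (+ 0 * + 0) + + 2 * + 0)) ≡ + 0
  alg = solve-∀

O-quadratic : ∀ u v w → O 2 (λ x → u * (+ x * + x) + v * + x + w)
O-quadratic u v w = O-+ (O-+ (O-scale u (O-*x O-id)) (O-weaken (s≤s z≤n) (O-scale v O-id))) (O-weaken z≤n (O-const w))

O-cubic : ∀ a b c → O 3 (λ x → + x * (+ x * + x) - a * (+ x * + x) - b * + x - c)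
O-cubic a b c = O-+ (O-+ (O-+ (O-*x (O-*x O-id)) (O-weaken (ℕP.n≤1+n 2) (O-neg (O-scale a (O-*x O-id)))))
  (O-weaken (s≤s z≤n) (O-neg (O-scale b O-id)))) (O-weaken z≤n (O-const (- c)))

-- Induction by bordering: `x²` times the discrepancy of `M` is that of `M′` times the border cubic,
-- plus the contributions of `err` and of the remainder in `newton-step`. All three have order n+3
-- for a matrix of size n+1.
O-discrepancy : ∀ {n} (M : Mat n) → O n (discrepancy M)
O-discrepancy {zero} M = O-cong (discrepancy-zero M) O-zero
O-discrepancy {suc n} M = O-*x⁻¹ (O-*x⁻¹ (O-cong (λ x → sym (key x)) big))
  where
  open Border M
  s₁ = tr¹ M′
  s₂ = tr² M′
  s₃ = tr³ M′
  q : ℤ → ℤ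
  q x = x * (x * x) - a * (x * x) - b * x - c
  u v w : ℤ
  u = a * (s₁ * (s₁ * s₁) - + 3 * (s₁ * s₂) + + 2 * s₃) - b * (+ 3 * (s₁ * s₁ - s₂)) + + 6 * (c * s₁)
  v = b * (s₁ * (s₁ * s₁) - + 3 * (s₁ * s₂) + + 2 * s₃) - c * (+ 3 * (s₁ * s₁ - s₂))
  w = c * (s₁ * (s₁ * s₁) - + 3 * (s₁ * s₂) + + 2 * s₃)
  rem : ℤ → ℤ
  rem x = u * (x * x) + v * x + w
  N N′ : ℤ → ℤ
  N = newton (tr¹ M) (tr² M) (tr³ M)
  N′ = newton s₁ s₂ s₃
  N-step : ∀ x → N′ x * q x - x * (x * x) * N x ≡ rem x
  N-step x = trans (cong₂ (λ α β → N′ x * q x - x * (x * x) * newton (tr¹ M) α β x) tr²-border′ tr³-border′) (newton-step s₁ s₂ s₃ a b c x)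
    where
    tr²-border′ = tr²-border M
    tr³-border′ = tr³-border M
  big : O (suc (suc (suc n))) (λ x → discrepancy M′ x * q (+ x)
          + (- (+ 6 * (+ x * (+ x * (+ x * (+ x * err (+ x)))))) + pw (suc n) x * rem (+ x)))
  big = O-+ (O-weaken (ℕP.≤-reflexive (ℕP.+-comm n 3)) (O-* (O-discrepancy M′) (O-cubic a b c)))
        (O-+ (O-neg (O-scale (+ 6) (O-*x (O-*x (O-*x (O-err M))))))
             (O-weaken (ℕP.≤-reflexive (ℕP.+-comm (suc n) 2)) (O-* (O-pw (suc n)) (O-quadratic u v w))))
  key : ∀ x → + x * (+ x * discrepancy M x) ≡ discrepancy M′ x * q (+ x)
          + (- (+ 6 * (+ x * (+ x * (+ x * (+ x * err (+ x)))))) + pw (suc n) x * rem (+ x))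
  key x = trans (cong (λ z → X * (X * (+ 6 * pw 4 x * charPoly M X - z * N X))) (pw-suc (suc n) x))
    (trans (alg₁ X (pw 4 x) (charPoly M X) P (N X))
    (trans (cong (λ z → + 6 * pw 4 x * z - P * (X * (X * X) * N X)) (border² X))
    (trans (alg₂ (pw 4 x) (charPoly M′ X) (q X) (err X) P (X * (X * X) * N X) (N′ X))
           (cong₂ (λ α β → discrepancy M′ x * q X + (- (+ 6 * α) + P * β))
             (trans (cong (_* err X) (pw4 x)) (alg₃ X (err X))) (N-step X)))))
    where
    X = + x
    P = pw (suc n) x
    alg₁ : ∀ x w p P N → x * (x * (+ 6 * w * p - x * P * N)) ≡ + 6 * w * (x * (x * p)) - P * (x * (x * x) * N)
    alg₁ = solve-∀
    alg₂ : ∀ w p q e P N N′ → + 6 * w * (p * q - e) - P * N ≡ (+ 6 * w * p - P * N′) * q + (- (+ 6 * (w * e)) + P * (N′ * q - N))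
    alg₂ = solve-∀
    alg₃ : ∀ x e → (x * (x * (x * x))) * e ≡ x * (x * (x * (x * e)))
    alg₃ = solve-∀

O-charPoly : ∀ {n} (M : Mat n) → O n (λ x → charPoly M (+ x))
O-charPoly M = det-O (λ x → charMat M (+ x)) (O-charMat M)

Isospectral : ∀ {m n} → Mat m → Mat n → Set
Isospectral A B = ∀ x → charPoly A x ≡ charPoly B x

-- A larger matrix would make its leading term 6 xⁿ⁺⁴ of order at most n + 3.
isospectral-≤ : ∀ {m n} (A : Mat m) (B : Mat n) → Isospectral A B → n ℕ.≤ m
isospectral-≤ {m} {n} A B iso with n ℕP.≤? m
... | yes n≤m = n≤m
... | no n≰m = ⊥-elim (6≢0 (O-lead {n ℕ.+ 3} (+ 6) (O-cong main
      (O-+ (O-+ (O-weaken (ℕP.≤-trans (ℕP.≤-reflexive (ℕP.+-comm 4 m)) (ℕP.≤-trans (ℕP.≤-reflexive (ℕP.+-suc m 3)) (ℕP.+-monoˡ-≤ 3 (ℕP.≰⇒> n≰m))))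
                    (O-* (O-scale (+ 6) (O-pw 4)) (O-charPoly A)))
                 (O-weaken (ℕP.m≤m+n n 3) (O-neg (O-discrepancy B))))
            (O-weaken (ℕP.≤-reflexive (sym (ℕP.+-suc n 2))) (O-* (O-pw (suc n)) (O-quadratic α β γ)))))))
  where
  6≢0 : + 6 ≢ + 0
  6≢0 ()
  s₁ = tr¹ B
  s₂ = tr² B
  s₃ = tr³ B
  α β γ : ℤ
  α = + 6 * s₁
  β = - (+ 3 * (s₁ * s₁ - s₂))
  γ = s₁ * (s₁ * s₁) - + 3 * (s₁ * s₂) + + 2 * s₃
  alg : ∀ x w p P s₁ s₂ s₃ → + 6 * w * p + - (+ 6 * w * p - P * (+ 6 * (x * (x * x)) - + 6 * (s₁ * (x * x)) + + 3 * ((s₁ * s₁ - s₂) * x)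
                    - (s₁ * (s₁ * s₁) - + 3 * (s₁ * s₂) + + 2 * s₃)))
         + P * (+ 6 * s₁ * (x * x) + (- (+ 3 * (s₁ * s₁ - s₂))) * x + (s₁ * (s₁ * s₁) - + 3 * (s₁ * s₂) + + 2 * s₃))
         ≡ + 6 * (x * (x * (x * P)))
  alg = solve-∀
  main : ∀ x → + 6 * pw 4 x * charPoly A (+ x) + - discrepancy B x + pw (suc n) x * (α * (+ x * + x) + β * + x + γ)
         ≡ + 6 * pw (suc (n ℕ.+ 3)) x
  main x = trans (cong (λ z → + 6 * pw 4 x * z + - discrepancy B x + pw (suc n) x * (α * (+ x * + x) + β * + x + γ)) (iso (+ x)))
    (trans (alg (+ x) (pw 4 x) (charPoly B (+ x)) (pw (suc n) x) s₁ s₂ s₃)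
      (cong (+ 6 *_) (trans (cong (λ z → + x * (+ x * z)) (sym (pw-suc (suc n) x)))
        (trans (cong (+ x *_) (sym (pw-suc (suc (suc n)) x))) (trans (sym (pw-suc (suc (suc (suc n))) x)) (cong (λ z → pw (suc z) x) (ℕP.+-comm 3 n)))))))

quadratic-zero : ∀ n u v w → O n (λ x → pw (suc n) x * (u * (+ x * + x) + v * + x + w)) → u ≡ + 0 × v ≡ + 0 × w ≡ + 0
quadratic-zero n u v w o = u≡0 , v≡0 , w≡0
  where
  X : ℕ → ℤ
  X x = + x
  P : ℕ → ℤ
  P = pw (suc n)
  p2 : ∀ x → pw (suc (suc (suc n))) x ≡ X x * (X x * P x)
  p2 x = trans (pw-suc (suc (suc n)) x) (cong (X x *_) (pw-suc (suc n) x))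
  alg₁ : ∀ x P u v w → P * (u * (x * x) + v * x + w) + - (P * (v * x + w)) ≡ u * (x * (x * P))
  alg₁ = solve-∀
  u≡0 : u ≡ + 0
  u≡0 = O-lead {suc (suc n)} u (O-cong (λ x → trans (alg₁ (X x) (P x) u v w) (cong (u *_) (sym (p2 x))))
    (O-+ (O-weaken (ℕP.m≤n+m n 2) o) (O-neg (O-weaken (ℕP.≤-reflexive (ℕP.+-comm (suc n) 1))
      (O-* (O-pw (suc n)) (O-+ (O-scale v O-id) (O-weaken z≤n (O-const w))))))))
  alg₂ : ∀ x P v w → P * (+ 0 * (x * x) + v * x + w) + - (P * w) ≡ v * (x * P)
  alg₂ = solve-∀
  v≡0 : v ≡ + 0
  v≡0 = O-lead {suc n} v (O-cong (λ x → trans (cong (λ z → P x * (z * (X x * X x) + v * X x + w) + - (P x * w)) u≡0)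
           (trans (alg₂ (X x) (P x) v w) (cong (v *_) (sym (pw-suc (suc n) x)))))
    (O-+ (O-weaken (ℕP.n≤1+n n) o) (O-neg (O-weaken (ℕP.≤-reflexive (ℕP.+-identityʳ (suc n))) (O-* (O-pw (suc n)) (O-const w))))))
  alg₃ : ∀ x P w → P * (+ 0 * (x * x) + + 0 * x + w) ≡ w * P
  alg₃ = solve-∀
  w≡0 : w ≡ + 0
  w≡0 = O-lead {n} w (O-cong (λ x → trans (cong₂ (λ z z′ → P x * (z * (X x * X x) + z′ * X x + w)) u≡0 v≡0) (alg₃ (X x) (P x) w)) o)

-- Subtracting the two discrepancies cancels the characteristic polynomials. What is left is `xⁿ⁺¹`
-- times a quadratic in the differences of the elementary symmetric functions, yet of order `n`, so
-- its coefficients vanish from the top down.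
isospectral-traces : ∀ {n} (A B : Mat n) → Isospectral A B → tr¹ A ≡ tr¹ B × tr² A ≡ tr² B × tr³ A ≡ tr³ B
isospectral-traces {n} A B iso = e₁ , e₂ , e₃
  where
  s₁ = tr¹ A ; s₂ = tr² A ; s₃ = tr³ A
  t₁ = tr¹ B ; t₂ = tr² B ; t₃ = tr³ B
  γ : ℤ → ℤ → ℤ → ℤ
  γ s₁ s₂ s₃ = s₁ * (s₁ * s₁) - + 3 * (s₁ * s₂) + + 2 * s₃
  u v w : ℤ
  u = + 6 * (s₁ - t₁)
  v = + 3 * ((t₁ * t₁ - t₂) - (s₁ * s₁ - s₂))
  w = γ s₁ s₂ s₃ - γ t₁ t₂ t₃
  alg : ∀ x w p P s₁ s₂ s₃ t₁ t₂ t₃ →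
     (+ 6 * w * p - P * (+ 6 * (x * (x * x)) - + 6 * (s₁ * (x * x)) + + 3 * ((s₁ * s₁ - s₂) * x) - (s₁ * (s₁ * s₁) - + 3 * (s₁ * s₂) + + 2 * s₃)))
     + - (+ 6 * w * p - P * (+ 6 * (x * (x * x)) - + 6 * (t₁ * (x * x)) + + 3 * ((t₁ * t₁ - t₂) * x) - (t₁ * (t₁ * t₁) - + 3 * (t₁ * t₂) + + 2 * t₃)))
     ≡ P * (+ 6 * (s₁ - t₁) * (x * x) + + 3 * ((t₁ * t₁ - t₂) - (s₁ * s₁ - s₂)) * x + ((s₁ * (s₁ * s₁) - + 3 * (s₁ * s₂) + + 2 * s₃) - (t₁ * (t₁ * t₁) - + 3 * (t₁ * t₂) + + 2 * t₃)))
  alg = solve-∀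
  zeros : u ≡ + 0 × v ≡ + 0 × w ≡ + 0
  zeros = quadratic-zero n u v w (O-cong (λ x →
      trans (cong (λ z → (+ 6 * pw 4 x * z - pw (suc n) x * newton s₁ s₂ s₃ (+ x)) + - discrepancy B x) (iso (+ x)))
            (alg (+ x) (pw 4 x) (charPoly B (+ x)) (pw (suc n) x) s₁ s₂ s₃ t₁ t₂ t₃))
    (O-+ (O-discrepancy A) (O-neg (O-discrepancy B))))
  e₁ : s₁ ≡ t₁
  e₁ = ℤP.i-j≡0⇒i≡j s₁ t₁ (nz-* (+ 6) (s₁ - t₁) (λ ()) (proj₁ zeros))
  alg₂ : ∀ s a b → (s - b) - (s - a) ≡ a - b
  alg₂ = solve-∀
  e₂ : s₂ ≡ t₂
  e₂ = ℤP.i-j≡0⇒i≡j s₂ t₂ (trans (sym (alg₂ (t₁ * t₁) s₂ t₂))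
    (nz-* (+ 3) _ (λ ()) (trans (cong (λ z → + 3 * ((t₁ * t₁ - t₂) - (z * z - s₂))) (sym e₁)) (proj₁ (proj₂ zeros)))))
  alg₃ : ∀ a b s t → (a - b + + 2 * s) - (a - b + + 2 * t) ≡ + 2 * (s - t)
  alg₃ = solve-∀
  e₃ : s₃ ≡ t₃
  e₃ = ℤP.i-j≡0⇒i≡j s₃ t₃ (nz-* (+ 2) (s₃ - t₃) (λ ()) (trans (sym (alg₃ (t₁ * (t₁ * t₁)) (+ 3 * (t₁ * t₂)) s₃ t₃))
    (trans (cong₂ (λ z z′ → (z * (z * z) - + 3 * (z * z′) + + 2 * s₃) - γ t₁ t₂ t₃) (sym e₁) (sym e₂)) (proj₂ (proj₂ zeros)))))

-- Laplacian matrices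

b2z-idem : ∀ b → b2z b * b2z b ≡ b2z b
b2z-idem true = refl
b2z-idem false = refl

b2z-injective : ∀ a b → b2z a ≡ b2z b → a ≡ b
b2z-injective true true _ = refl
b2z-injective false false _ = refl

sum-const : ∀ {n} c → sumFin {n} (λ _ → c) ≡ + n * c
sum-const {zero} c = refl
sum-const {suc n} c = trans (cong (_+_ c) (sum-const {n} c)) (sym (ℤP.suc-* (+ n) c))

module Lap {n} (G : Graph n) where
  A L : Mat n
  A i j = b2z (adj G i j)
  L = laplacian G
  d : Fin n → ℤ
  d = degree G

  A-sym : ∀ i j → A i j ≡ A j i
  A-sym i j = cong b2z (adj-sym G i j)

  A-diag : ∀ i → A i i ≡ + 0
  A-diag i = cong b2z (adj-irrefl G i)

  L-ind : ∀ i j → L i j ≡ ind i j * d i - A i j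
  L-ind i j with δ i j
  ... | true = cong (_- A i j) (sym (ℤP.*-identityˡ (d i)))
  ... | false = refl

  L-diag : ∀ i → L i i ≡ d i
  L-diag i = trans (L-ind i i) (trans (cong₂ (λ u v → u * d i - v) (ind-refl i) (A-diag i)) (alg (d i)))
    where
    alg : ∀ x → + 1 * x - + 0 ≡ x
    alg = solve-∀

  L-apply : ∀ f i → apply L f i ≡ d i * f i - sumFin (λ j → A i j * f j)
  L-apply f i = trans (sum-cong (λ j → trans (cong (_* f j) (L-ind i j)) (alg (ind i j) (d i) (A i j) (f j))))
    (trans (sum-minus (λ j → ind i j * (d i * f j)) (λ j → A i j * f j))
      (cong (_- sumFin (λ j → A i j * f j)) (trans (sum-cong (λ j → cong (_* (d i * f j)) (ind-sym i j))) (sum-ind i (λ j → d i * f j)))))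
    where
    alg : ∀ x d a f → (x * d - a) * f ≡ x * (d * f) - a * f
    alg = solve-∀

  L-apply-diff : ∀ f i → apply L f i ≡ sumFin (λ j → A i j * (f i - f j))
  L-apply-diff f i = trans (L-apply f i) (sym (trans (sum-cong (λ j → alg (A i j) (f i) (f j)))
    (trans (sum-minus (λ j → A i j * f i) (λ j → A i j * f j)) (cong (_- sumFin (λ j → A i j * f j)) (sum-*ʳ (f i) (A i))))))
    where
    alg : ∀ a x y → a * (x - y) ≡ a * x - a * y
    alg = solve-∀

  AL : ∀ i j → A i j * L j i ≡ - A i j
  AL i j with i ≟ j
  ... | yes refl = trans (cong (_* L i i) (A-diag i)) (cong -_ (sym (A-diag i)))
  ... | no i≢j = trans (cong (A i j *_) (trans (L-ind j i) (cong₂ (λ u v → u * d j - v) (ind-≢ (i≢j ∘ sym)) (A-sym j i))))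
        (trans (alg (A i j) (d j)) (cong -_ (b2z-idem (adj G i j))))
    where
    alg : ∀ a d → a * (+ 0 * d - a) ≡ - (a * a)
    alg = solve-∀

  Σd Σd² Σd³ triangles : ℤ
  Σd = sumFin d
  Σd² = sumFin λ i → d i * d i
  Σd³ = sumFin λ i → d i * (d i * d i)
  -- The trace of the cube of `A`, which is six times the number of triangles.
  triangles = sumFin λ i → sumFin λ j → A i j * sumFin λ k → A j k * A k i

  tr¹-L : tr¹ L ≡ Σd
  tr¹-L = sum-cong L-diag

  L²-diag : ∀ i → sumFin (λ j → L i j * L j i) ≡ d i * d i + d i
  L²-diag i = trans (L-apply (λ j → L j i) i)
    (trans (cong₂ _-_ (cong (d i *_) (L-diag i)) (trans (sum-cong (AL i)) (sum-neg (A i)))) (cong (_+_ (d i * d i)) (ℤP.neg-involutive (d i))))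

  tr²-L : tr² L ≡ Σd² + Σd
  tr²-L = trans (sum-cong L²-diag) (sum-+ (λ i → d i * d i) d)

  ALA : ∀ i j → sumFin (λ k → A j k * L k i) ≡ A j i * d i - sumFin (λ k → A j k * A k i)
  ALA i j = trans (sum-cong (λ k → trans (cong (A j k *_) (L-ind k i)) (alg (A j k) (ind k i) (d k) (A k i))))
    (trans (sum-minus (λ k → ind k i * (A j k * d k)) (λ k → A j k * A k i))
      (cong (_- sumFin (λ k → A j k * A k i)) (sum-ind i (λ k → A j k * d k))))
    where
    alg : ∀ a x d b → a * (x * d - b) ≡ x * (a * d) - a * b
    alg = solve-∀

  L³-diag : ∀ i → sumFin (λ j → sumFin λ k → L i j * (L j k * L k i)) ≡
            d i * (d i * d i) + + 2 * (d i * d i) + sumFin (λ j → A i j * d j) - sumFin (λ j → A i j * sumFin λ k → A j k * A k i)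
  L³-diag i = trans (sum-cong (λ j → sum-*ˡ (L i j) (λ k → L j k * L k i)))
    (trans (L-apply Q i)
    (trans (cong₂ (λ u v → d i * u - v) (L²-diag i) ΣAQ)
           (alg₂ (d i) (sumFin (λ j → A i j * d j)) (sumFin walks))))
    where
    Q walks : Fin n → ℤ
    Q j = sumFin λ k → L j k * L k i
    walks j = A i j * sumFin λ k → A j k * A k i
    alg₁ : ∀ a d l s → a * (d * l - s) ≡ d * (a * l) - a * s
    alg₁ = solve-∀
    alg₃ : ∀ d a a′ e t → d * (- a) - a * (a′ * e - t) ≡ (- (a * d) - (a * a′) * e) + a * t
    alg₃ = solve-∀
    AQ : ∀ j → A i j * Q j ≡ (- (A i j * d j) - A i j * d i) + walks j
    AQ j = trans (cong (A i j *_) (L-apply (λ k → L k i) j))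
      (trans (alg₁ (A i j) (d j) (L j i) (sumFin (λ k → A j k * L k i)))
      (trans (cong₂ (λ u v → d j * u - A i j * v) (AL i j) (ALA i j))
      (trans (alg₃ (d j) (A i j) (A j i) (d i) (sumFin λ k → A j k * A k i))
        (cong (λ z → (- (A i j * d j) - z * d i) + walks j) (trans (cong (A i j *_) (A-sym j i)) (b2z-idem (adj G i j)))))))
    ΣAQ : sumFin (λ j → A i j * Q j) ≡ (- sumFin (λ j → A i j * d j) - d i * d i) + sumFin walks
    ΣAQ = trans (sum-cong AQ) (trans (sum-+ (λ j → - (A i j * d j) - A i j * d i) walks) (cong (_+ sumFin walks)
      (trans (sum-minus (λ j → - (A i j * d j)) (λ j → A i j * d i)) (cong₂ _-_ (sum-neg (λ j → A i j * d j)) (sum-*ʳ (d i) (A i))))))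
    alg₂ : ∀ d s t → d * (d * d + d) - ((- s - d * d) + t) ≡ d * (d * d) + + 2 * (d * d) + s - t
    alg₂ = solve-∀

  ΣAd : sumFin (λ i → sumFin (λ j → A i j * d j)) ≡ Σd²
  ΣAd = trans (sum-swap (λ i j → A i j * d j)) (sum-cong (λ j → trans (sum-*ʳ (d j) (λ i → A i j)) (cong (_* d j) (sum-cong (λ i → A-sym i j)))))

  tr³-L : tr³ L ≡ Σd³ + + 3 * Σd² - triangles
  tr³-L = trans (sum-cong L³-diag)
    (trans (sum-minus (λ i → d i * (d i * d i) + + 2 * (d i * d i) + sumFin (λ j → A i j * d j)) (λ i → sumFin (λ j → A i j * sumFin λ k → A j k * A k i)))
    (trans (cong (_- triangles) (trans (sum-+ (λ i → d i * (d i * d i) + + 2 * (d i * d i)) (λ i → sumFin (λ j → A i j * d j)))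
        (cong₂ _+_ (trans (sum-+ (λ i → d i * (d i * d i)) (λ i → + 2 * (d i * d i))) (cong (_+_ Σd³) (sum-*ˡ (+ 2) (λ i → d i * d i)))) ΣAd)))
      (alg Σd³ Σd² triangles)))
    where
    alg : ∀ a b t → a + + 2 * b + b - t ≡ a + + 3 * b - t
    alg = solve-∀

  L-sym : ∀ i j → L i j ≡ L j i
  L-sym i j = by (i ≟ j)
    where
    by : Dec (i ≡ j) → L i j ≡ L j i
    by (yes refl) = refl
    by (no i≢j) = trans (L-ind i j) (trans (cong₂ (λ u v → u * d i - v) (ind-≢ i≢j) (A-sym i j))
                  (sym (trans (L-ind j i) (cong (λ u → u * d j - A j i) (ind-≢ (i≢j ∘ sym))))))

  L-ones : ∀ r → apply L (λ _ → + 1) r ≡ + 0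
  L-ones r = trans (L-apply-diff (λ _ → + 1) r) (sum-zero (λ j → ℤP.*-zeroʳ (A r j)))

  ΣL-apply : ∀ f → sumFin (apply L f) ≡ + 0
  ΣL-apply f = trans (sum-swap (λ r c → L r c * f c)) (sum-zero λ c → trans (sum-*ʳ (f c) (λ r → L r c))
    (cong (_* f c) (trans (sum-cong (λ r → trans (L-sym r c) (sym (ℤP.*-identityʳ (L c r))))) (L-ones c))))

-- Values at zero through congruences; connectedness from the linear coefficient

cong-common : ∀ {x a b a′ b′} → a ≡ a′ → Cong x a b → Cong x a′ b′ → Cong x b b′
cong-common {x} {a} {b} {a′} {b′} e (p , ep) (q , eq) = (q - p) , trans (h₁ b x p) (trans (cong (_- x * p) (trans (sym ep) (trans e eq))) (h₂ b′ x p q))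
  where
  h₁ : ∀ a x p → a ≡ (a + x * p) - x * p
  h₁ = solve-∀
  h₂ : ∀ b x p q → (b + x * q) - x * p ≡ b + x * (q - p)
  h₂ = solve-∀

-- The single modulus `∣ a - b ∣ + 1` already decides. All moduli are assumed because the two
-- integers are known only as common limits of congruences in `x`.
cong-all⇒≡ : ∀ {a b} → (∀ x → Cong (+ suc x) a b) → a ≡ b
cong-all⇒≡ {a} {b} c with c ∣ a - b ∣
... | (q , e) = ℤP.i-j≡0⇒i≡j a b (trans (diff a b (+ suc t * q) e) (trans (cong (+ suc t *_) q≡0) (ℤP.*-zeroʳ (+ suc t))))
  where
  t = ∣ a - b ∣
  diff : ∀ a b z → a ≡ b + z → a - b ≡ z
  diff _ b z refl = alg b z
    where
    alg : ∀ b z → b + z - b ≡ z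
    alg = solve-∀
  small : ∀ k → t ≡ suc t ℕ.* k → k ≡ 0
  small zero _ = refl
  small (suc k) e′ = ⊥-elim (ℕP.<-irrefl e′ (ℕP.m≤m*n (suc t) (suc k)))
  q≡0 : q ≡ + 0
  q≡0 = ℤP.∣i∣≡0⇒i≡0 (small ∣ q ∣ (trans (cong ∣_∣ (diff a b (+ suc t * q) e)) (ℤP.abs-* (+ suc t) q)))

charMat-cong : ∀ {n} (M : Mat n) a x r c → Cong x (charMat M (a + x) r c) (charMat M a r c)
charMat-cong M a x r c = ind r c , trans (charMat-ind M (a + x) r c) (trans (alg a x (ind r c) (M r c)) (cong (_+ x * ind r c) (sym (charMat-ind M a r c))))
  where
  alg : ∀ a x i m → (a + x) * i - m ≡ (a * i - m) + x * i
  alg = solve-∀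

setCol-Cong : ∀ {n x} {A B : Mat n} j v → (∀ r c → Cong x (A r c) (B r c)) → ∀ r c → Cong x (setCol A j v r c) (setCol B j v r c)
setCol-Cong j v e r c with δ c j
... | true = cong-refl
... | false = e r c

-- A colouring constant along edges is constant. In this form connectedness speaks of kernel vectors
-- of the Laplacian with values 0 and 1, without any mention of walks.
Connected : ∀ {n} → Graph n → Set
Connected {n} G = ∀ (S : Fin n → Bool) → (∀ i j → adj G i j ≡ true → S i ≡ S j) → ∀ i j → S i ≡ S j

Harmonic⇒Constant : ∀ {n} → Graph n → Set
Harmonic⇒Constant {n} G = ∀ (f : Fin n → ℤ) → (∀ i → apply (laplacian G) f i ≡ + 0) → ∀ i j → f i ≡ f j

module Reduced {n} (G : Graph (suc n)) where
  open Lap G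

  N : ℤ → Mat (suc n)
  N = charMat L

  -- The all-ones vector has eigenvalue 0, so Cramer's rule splits a factor `x` off the
  -- characteristic polynomial and leaves this determinant. At zero it is the linear coefficient: up
  -- to sign, the number of vertices times the number of spanning trees.
  reduced : ℤ → Mat (suc n)
  reduced x = setCol (N x) zero (λ _ → + 1)

  lapCharPoly-reduced : ∀ x → lapCharPoly G x ≡ x * det (reduced x)
  lapCharPoly-reduced x = trans (sym (ℤP.*-identityˡ (charPoly L x))) (trans (sym (det-cramer (N x) zero (λ _ → + 1)))
    (trans (setCol-cong (N x) zero (λ r → trans (apply-charMat L x (λ _ → + 1) r) (cong (λ z → x * + 1 - z) (L-ones r))))
    (trans (setCol-cong (N x) zero (λ r → ℤP.+-identityʳ (x * + 1))) (setCol-* (N x) zero x (λ _ → + 1)))))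

  reduced-Cong : ∀ x → Cong x (det (reduced x)) (det (reduced (+ 0)))
  reduced-Cong x = subst (λ z → Cong x (det (reduced z)) (det (reduced (+ 0)))) (ℤP.+-identityˡ x)
    (cong-det (setCol-Cong zero (λ _ → + 1) (charMat-cong L (+ 0) x)))

  clear₀ : (Fin (suc n) → ℤ) → Fin (suc n) → ℤ
  clear₀ w zero = + 0
  clear₀ w (suc i) = w (suc i)

  apply-reduced : ∀ w r → apply (reduced (+ 0)) w r ≡ w zero - apply L (clear₀ w) r
  apply-reduced w r = trans (cong₂ _+_ (ℤP.*-identityˡ (w zero)) tail) (cong (_+_ (w zero)) (trans (apply-charMat L (+ 0) (clear₀ w) r) (ℤP.+-identityˡ _)))
    where
    tail : sumFin (λ c → N (+ 0) r (suc c) * w (suc c)) ≡ apply (N (+ 0)) (clear₀ w) r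
    tail = sym (trans (cong (_+ sumFin (λ c → N (+ 0) r (suc c) * w (suc c))) (ℤP.*-zeroʳ (N (+ 0) r zero))) (ℤP.+-identityˡ _))

  -- For a kernel vector, the Laplacian maps `clear₀ w` to the constant `w zero`. Images of the
  -- Laplacian sum to zero, so that constant vanishes; then `clear₀ w` is harmonic, hence constant,
  -- and it is 0 at `zero`.
  reduced-inj : Harmonic⇒Constant G → Inj (reduced (+ 0))
  reduced-inj hc w ker = λ where
      zero → w₀≡0
      (suc i) → const (suc i) zero
    where
    eqn : ∀ r → w zero - apply L (clear₀ w) r ≡ + 0
    eqn r = trans (sym (apply-reduced w r)) (ker r)
    w₀≡0 : w zero ≡ + 0
    w₀≡0 = nz-* (+ suc n) (w zero) (λ ()) (trans (sym (ℤP.+-identityʳ _)) (trans (cong₂ _-_ (sym (sum-const {suc n} (w zero))) (sym (ΣL-apply (clear₀ w))))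
      (trans (sym (sum-minus (λ _ → w zero) (apply L (clear₀ w)))) (sum-zero eqn))))
    const : ∀ i j → clear₀ w i ≡ clear₀ w j
    const = hc (clear₀ w) (λ r → trans (sym (ℤP.i-j≡0⇒i≡j (w zero) _ (eqn r))) w₀≡0)

  -- A colouring constant along edges, minus its value at `zero`, is a harmonic function vanishing
  -- at `zero` and thus a kernel vector.
  inj⇒connected : Inj (reduced (+ 0)) → Connected G
  inj⇒connected inj S closed i j = trans (to₀ i) (sym (to₀ j))
    where
    w : Fin (suc n) → ℤ
    w i = b2z (S i) - b2z (S zero)
    w₀ : w zero ≡ + 0
    w₀ = ℤP.+-inverseʳ (b2z (S zero))
    clear-w : ∀ c → clear₀ w c ≡ w c
    clear-w zero = sym w₀
    clear-w (suc c) = refl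
    edgeTerm : ∀ r c → A r c * (w r - w c) ≡ + 0
    edgeTerm r c with adj G r c in e
    ... | false = refl
    ... | true = trans (cong (λ z → + 1 * ((b2z z - b2z (S zero)) - w c)) (closed r c e)) (alg (w c))
      where
      alg : ∀ z → + 1 * (z - z) ≡ + 0
      alg = solve-∀
    ker : ∀ r → apply (reduced (+ 0)) w r ≡ + 0
    ker r = trans (apply-reduced w r) (cong₂ _-_ w₀ (trans (sum-cong (λ c → cong (L r c *_) (clear-w c))) (trans (L-apply-diff w r) (sum-zero (edgeTerm r)))))
    to₀ : ∀ i → S i ≡ S zero
    to₀ i = b2z-injective (S i) (S zero) (ℤP.i-j≡0⇒i≡j _ _ (inj w ker i))

cospectral-connected-suc : ∀ {n} (G H : Graph (suc n)) → (∀ x → lapCharPoly G x ≡ lapCharPoly H x) →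
                       Harmonic⇒Constant H → Connected G
cospectral-connected-suc G H iso hc = RG.inj⇒connected (det≢0⇒inj (RG.reduced (+ 0)) λ g≡0 →
    inj⇒det≢0 (RH.reduced (+ 0)) (RH.reduced-inj hc) (trans (sym same) g≡0))
  where
  module RG = Reduced G
  module RH = Reduced H
  same : det (RG.reduced (+ 0)) ≡ det (RH.reduced (+ 0))
  same = cong-all⇒≡ λ x → cong-common (eq x) (RG.reduced-Cong (+ suc x)) (RH.reduced-Cong (+ suc x))
    where
    eq : ∀ x → det (RG.reduced (+ suc x)) ≡ det (RH.reduced (+ suc x))
    eq x = ℤP.*-cancelˡ-≡ (+ suc x) _ _ (trans (sym (RG.lapCharPoly-reduced (+ suc x))) (trans (iso (+ suc x)) (RH.lapCharPoly-reduced (+ suc x))))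

-- Twin leaves and the eigenvalue 1

record TwinLeaves {n} (G : Graph n) (u u′ : Fin n) : Set where
  field
    distinct : u ≢ u′
    leaf     : degree G u ≡ + 1
    same     : ∀ r → adj G u r ≡ adj G u′ r

module Twins {n} (G : Graph n) where
  open Lap G

  -- Shifted so that the eigenvalue 1 sits at `y = 0`, where congruences modulo `y` apply.
  N : ℤ → Mat n
  N y = charMat L (+ 1 + y)

  difference : Fin n → Fin n → Fin n → ℤ
  difference u u′ r = ind r u - ind r u′

  module _ {u u′} (t : TwinLeaves G u u′) where
    open TwinLeaves t

    leaf′ : degree G u′ ≡ + 1
    leaf′ = trans (sum-cong (λ r → cong b2z (sym (same r)))) leaf

    N-leaf : ∀ y v → degree G v ≡ + 1 → ∀ r → N y r v ≡ y * ind r v + A v r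
    N-leaf y v dv r = trans (charMat-ind L (+ 1 + y) r v)
      (trans (cong (λ z → (+ 1 + y) * ind r v - z) (trans (L-sym r v) (trans (L-ind v r) (cong₂ (λ i e → i * e - A v r) (ind-sym v r) dv))))
             (alg y (ind r v) (A v r)))
      where
      alg : ∀ y i a → (+ 1 + y) * i - (i * + 1 - a) ≡ y * i + a
      alg = solve-∀

    -- The difference of the unit vectors at twin leaves is an eigenvector for 1, so `N y`
    -- multiplies it by `y`. Only the two columns of `M` are prescribed, which allows repetition
    -- after other columns have been replaced.
    twin-step : ∀ y (M : Mat n) → (∀ r → M r u ≡ N y r u) → (∀ r → M r u′ ≡ N y r u′) →
                det M ≡ y * det (setCol M u (difference u u′))
    twin-step y M eu eu′ = trans (sym (trans (cong (_* det M) w-u) (ℤP.*-identityˡ (det M))))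
      (trans (sym (det-cramer M u w)) (trans (setCol-cong M u col) (setCol-* M u y (difference u u′))))
      where
      w : Fin n → ℤ
      w = difference u u′
      w-u : w u ≡ + 1
      w-u = cong₂ _-_ (ind-refl u) (ind-≢ distinct)
      alg₁ : ∀ m a b → m * (a - b) ≡ a * m - b * m
      alg₁ = solve-∀
      alg₂ : ∀ y i j a → (y * i + a) - (y * j + a) ≡ y * (i - j)
      alg₂ = solve-∀
      col : ∀ r → apply M w r ≡ y * difference u u′ r
      col r = trans (sum-cong (λ c → alg₁ (M r c) (ind c u) (ind c u′)))
        (trans (sum-minus (λ c → ind c u * M r c) (λ c → ind c u′ * M r c))
        (trans (cong₂ _-_ (trans (sum-ind u (M r)) (trans (eu r) (N-leaf y u leaf r)))
                          (trans (sum-ind u′ (M r)) (trans (eu′ r) (trans (N-leaf y u′ leaf′ r) (cong (λ z → y * ind r u′ + b2z z) (sym (same r)))))))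
               (alg₂ y (ind r u) (ind r u′) (A u r))))

  once : Fin n → Fin n → ℤ → Mat n
  once u u′ y = setCol (N y) u (difference u u′)

  twice : Fin n → Fin n → Fin n → Fin n → ℤ → Mat n
  twice u u′ v v′ y = setCol (once u u′ y) v (difference v v′)

  twice-factor : ∀ {u u′ v v′} → TwinLeaves G u u′ → TwinLeaves G v v′ → v ≢ u → v′ ≢ u →
                 ∀ y → lapCharPoly G (+ 1 + y) ≡ y * (y * det (twice u u′ v v′ y))
  twice-factor {u} {u′} {v} {v′} t s v≢u v′≢u y = trans (twin-step t y (N y) (λ _ → refl) (λ _ → refl))
    (cong (y *_) (twin-step s y (once u u′ y) (λ r → setCol-off (N y) u (difference u u′) r v≢u) (λ r → setCol-off (N y) u (difference u u′) r v′≢u)))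

  thrice-factor : ∀ {u u′ v v′ w w′} → TwinLeaves G u u′ → TwinLeaves G v v′ → TwinLeaves G w w′ →
                  v ≢ u → v′ ≢ u → w ≢ u → w′ ≢ u → w ≢ v → w′ ≢ v →
                  ∀ y → ∃ λ z → lapCharPoly G (+ 1 + y) ≡ y * (y * (y * z))
  thrice-factor {u} {u′} {v} {v′} {w} {w′} t s p v≢u v′≢u w≢u w′≢u w≢v w′≢v y = _ ,
    trans (twice-factor t s v≢u v′≢u y) (cong (λ z → y * (y * z)) (twin-step p y (twice u u′ v v′ y)
      (λ r → trans (setCol-off (once u u′ y) v (difference v v′) r w≢v) (setCol-off (N y) u (difference u u′) r w≢u))
      (λ r → trans (setCol-off (once u u′ y) v (difference v v′) r w′≢v) (setCol-off (N y) u (difference u u′) r w′≢u))))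

  twice-Cong : ∀ u u′ v v′ y → Cong y (det (twice u u′ v v′ y)) (det (twice u u′ v v′ (+ 0)))
  twice-Cong u u′ v v′ y = cong-det {A = twice u u′ v v′ y} {twice u u′ v v′ (+ 0)}
    (setCol-Cong v (difference v v′) (setCol-Cong u (difference u u′) (charMat-cong L (+ 1) y)))

-- After cancelling `y²`, the determinant left for `H` equals `y` times an integer supplied by `G`.
-- Modulo `y` it is also its value at 0, which is therefore 0. The inequalities concern the unprimed
-- leaves, whose columns are the ones replaced; two pairs may share a primed leaf.
no-third-twins : ∀ {n} (G H : Graph n) → (∀ x → lapCharPoly G x ≡ lapCharPoly H x) →
  ∀ {a a′ b b′} → TwinLeaves H a a′ → TwinLeaves H b b′ → b ≢ a → b′ ≢ a → det (Twins.twice H a a′ b b′ (+ 0)) ≢ + 0 →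
  ∀ {u u′ v v′ w w′} → TwinLeaves G u u′ → TwinLeaves G v v′ → TwinLeaves G w w′ →
  v ≢ u → v′ ≢ u → w ≢ u → w′ ≢ u → w ≢ v → w′ ≢ v → ⊥
no-third-twins G H iso {a} {a′} {b} {b′} ta tb b≢a b′≢a nz t s p v≢u v′≢u w≢u w′≢u w≢v w′≢v =
  nz (sym (cong-all⇒≡ λ x → zero-Cong x (third (+ suc x))))
  where
  Q = Twins.twice H a a′ b b′
  third = Twins.thrice-factor G t s p v≢u v′≢u w≢u w′≢u w≢v w′≢v
  zero-Cong : ∀ x → (∃ λ z → lapCharPoly G (+ 1 + + suc x) ≡ + suc x * (+ suc x * (+ suc x * z))) →
              Cong (+ suc x) (+ 0) (det (Q (+ 0)))
  zero-Cong x (z , e) = cong-common refl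
    (z , trans (ℤP.*-cancelˡ-≡ (+ suc x) _ _ (ℤP.*-cancelˡ-≡ (+ suc x) _ _ (trans (sym (Twins.twice-factor H ta tb b≢a b′≢a (+ suc x))) (trans (sym (iso (+ 1 + + suc x))) e)))) (sym (ℤP.+-identityˡ _)))
    (Twins.twice-Cong H a a′ b b′ (+ suc x))

-- Sums over neighbours and ranked forests

module Neighbours {n} (G : Graph n) where
  open Lap G

  A-true : ∀ {v w} → adj G v w ≡ true → A v w ≡ + 1
  A-true = cong b2z

  A-false : ∀ {v w} → ¬ (adj G v w ≡ true) → A v w ≡ + 0
  A-false {v} {w} ¬e with adj G v w
  ... | true = ⊥-elim (¬e refl)
  ... | false = refl

  adj-flip : ∀ {v w} → adj G v w ≡ true → adj G w v ≡ true
  adj-flip {v} {w} e = trans (adj-sym G w v) e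

  adj-≢ : ∀ {v w} → adj G v w ≡ true → v ≢ w
  adj-≢ {v} e refl with trans (sym e) (adj-irrefl G v)
  ... | ()

  nbrSum₁ : ∀ {v b} → adj G v b ≡ true → (∀ w → adj G v w ≡ true → w ≡ b) → (g : Fin n → ℤ) → sumFin (λ w → A v w * g w) ≡ g b
  nbrSum₁ {v} {b} e only g = trans (sum-single b (λ w → A v w * g w) (λ w w≢b → cong (_* g w) (A-false (w≢b ∘ only w))))
    (trans (cong (_* g b) (A-true e)) (ℤP.*-identityˡ (g b)))

  nbrSum₃ : ∀ {v a b c} → adj G v a ≡ true → adj G v b ≡ true → adj G v c ≡ true → a ≢ b → a ≢ c → b ≢ c →
            (∀ w → adj G v w ≡ true → w ≡ a ⊎ w ≡ b ⊎ w ≡ c) → (g : Fin n → ℤ) → sumFin (λ w → A v w * g w) ≡ g a + g b + g c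
  nbrSum₃ {v} {a} {b} {c} ea eb ec a≢b a≢c b≢c only g =
    trans (sum-cong (λ w → trans (cong (_* g w) (split w)) (alg (ind w a) (ind w b) (ind w c) (g w))))
    (trans (sum-+ (λ w → ind w a * g w + ind w b * g w) (λ w → ind w c * g w))
      (cong₂ _+_ (trans (sum-+ (λ w → ind w a * g w) (λ w → ind w b * g w)) (cong₂ _+_ (sum-ind a g) (sum-ind b g))) (sum-ind c g)))
    where
    alg : ∀ a b c g → (a + b + c) * g ≡ a * g + b * g + c * g
    alg = solve-∀
    three : ∀ {x y z x′ y′ z′ : ℤ} → x ≡ x′ → y ≡ y′ → z ≡ z′ → x′ + y′ + z′ ≡ x + y + z
    three refl refl refl = refl
    split : ∀ w → A v w ≡ ind w a + ind w b + ind w c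
    split w = by (w ≟ a) (w ≟ b) (w ≟ c)
      where
      by : Dec (w ≡ a) → Dec (w ≡ b) → Dec (w ≡ c) → A v w ≡ ind w a + ind w b + ind w c
      by (yes refl) _ _ = trans (A-true ea) (three (ind-refl w) (ind-≢ a≢b) (ind-≢ a≢c))
      by (no w≢a) (yes refl) _ = trans (A-true eb) (three (ind-≢ w≢a) (ind-refl w) (ind-≢ b≢c))
      by (no w≢a) (no w≢b) (yes refl) = trans (A-true ec) (three (ind-≢ w≢a) (ind-≢ w≢b) (ind-refl w))
      by (no w≢a) (no w≢b) (no w≢c) = trans (A-false none) (three (ind-≢ w≢a) (ind-≢ w≢b) (ind-≢ w≢c))
        where
        none : ¬ (adj G v w ≡ true)
        none e with only w e
        ... | inj₁ p = w≢a p
        ... | inj₂ (inj₁ p) = w≢b p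
        ... | inj₂ (inj₂ p) = w≢c p

  degree-sum : ∀ v → d v ≡ sumFin (λ w → A v w * + 1)
  degree-sum v = sum-cong (λ w → sym (ℤP.*-identityʳ (A v w)))

-- A local certificate of acyclicity: the vertex of largest rank on a cycle would have two different
-- lower neighbours.
record Ranked {n} (G : Graph n) (r : Fin n → ℕ) : Set where
  field
    levels  : ∀ {a b} → adj G a b ≡ true → r a ≢ r b
    parent! : ∀ {a a′ b} → adj G a b ≡ true → r a ℕ.< r b → adj G a′ b ≡ true → r a′ ℕ.< r b → a ≡ a′

module _ {n} {G : Graph n} {r : Fin n → ℕ} (rk : Ranked G r) where
  open Ranked rk
  open Lap G
  open Neighbours G

  private
    top : ∀ {a b c} → adj G a b ≡ true → adj G b c ≡ true → adj G c a ≡ true → r a ℕ.< r c → r b ℕ.< r c → ⊥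
    top ab bc ca a<c b<c = adj-≢ ab (parent! (adj-flip ca) a<c bc b<c)

  triangle-free : ∀ {a b c} → adj G a b ≡ true → adj G b c ≡ true → adj G c a ≡ true → ⊥
  triangle-free {a} {b} {c} ab bc ca with ℕP.<-cmp (r a) (r b) | ℕP.<-cmp (r b) (r c) | ℕP.<-cmp (r c) (r a)
  ... | tri≈ _ e _ | _ | _ = levels ab e
  ... | tri< _ _ _ | tri≈ _ e _ | _ = levels bc e
  ... | tri> _ _ _ | tri≈ _ e _ | _ = levels bc e
  ... | tri< _ _ _ | tri< _ _ _ | tri≈ _ e _ = levels ca e
  ... | tri< _ _ _ | tri> _ _ _ | tri≈ _ e _ = levels ca e
  ... | tri> _ _ _ | tri< _ _ _ | tri≈ _ e _ = levels ca e
  ... | tri> _ _ _ | tri> _ _ _ | tri≈ _ e _ = levels ca e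
  ... | tri< a<b _ _ | tri< b<c _ _ | _ = top ab bc ca (ℕP.<-trans a<b b<c) b<c
  ... | tri< a<b _ _ | tri> _ _ c<b | _ = top ca ab bc c<b a<b
  ... | tri> _ _ b<a | tri< b<c _ _ | tri< c<a _ _ = top bc ca ab b<a c<a
  ... | tri> _ _ b<a | tri< b<c _ _ | tri> _ _ a<c = top ab bc ca a<c b<c
  ... | tri> _ _ b<a | tri> _ _ c<b | _ = top bc ca ab b<a (ℕP.<-trans c<b b<a)

  triangles≡0 : triangles ≡ + 0
  triangles≡0 = sum-zero λ i → sum-zero λ j → trans (sym (sum-*ˡ (A i j) (λ k → A j k * A k i))) (sum-zero λ k → term i j k)
    where
    term : ∀ i j k → A i j * (A j k * A k i) ≡ + 0
    term i j k with adj G i j in e₁ | adj G j k in e₂ | adj G k i in e₃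
    ... | false | _ | _ = refl
    ... | true | false | _ = refl
    ... | true | true | false = refl
    ... | true | true | true = ⊥-elim (triangle-free e₁ e₂ e₃)

-- The centipede

∧-true : ∀ {x y} → x ∧ y ≡ true → x ≡ true × y ≡ true
∧-true {true} {true} _ = refl , refl

∨-true : ∀ {x y} → x ∨ y ≡ true → x ≡ true ⊎ y ≡ true
∨-true {true} _ = inj₁ refl
∨-true {false} e = inj₂ e

dec-true : ∀ {P : Set} (p? : Dec P) → P → ⌊ p? ⌋ ≡ true
dec-true (yes _) _ = refl
dec-true (no ¬p) p = ⊥-elim (¬p p)

true-dec : ∀ {P : Set} (p? : Dec P) → ⌊ p? ⌋ ≡ true → P
true-dec (yes p) _ = p

T⇒≡ : ∀ {b} → T b → b ≡ true
T⇒≡ {true} _ = refl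

≡⇒T : ∀ {b} → b ≡ true → T b
≡⇒T refl = _

bool-ext : ∀ {a b} → (a ≡ true → b ≡ true) → (b ≡ true → a ≡ true) → a ≡ b
bool-ext {true}  {true}  _ _ = refl
bool-ext {true}  {false} f _ = sym (f refl)
bool-ext {false} {true}  _ g = g refl
bool-ext {false} {false} _ _ = refl

sum-split : ∀ a b (f : ℕ → ℤ) → sumFin {a ℕ.+ b} (f ∘ toℕ) ≡ sumFin {a} (f ∘ toℕ) + sumFin {b} (λ i → f (a ℕ.+ toℕ i))
sum-split zero b f = sym (ℤP.+-identityˡ _)
sum-split (suc a) b f = trans (cong (_+_ (f 0)) (sum-split a b (f ∘ suc))) (sym (ℤP.+-assoc (f 0) _ _))

sum-size : ∀ {m n} (f : ℕ → ℤ) → m ≡ n → sumFin {m} (f ∘ toℕ) ≡ sumFin {n} (f ∘ toℕ)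
sum-size f refl = refl

module DegreeSums {n} (G : Graph n) where
  open Lap G

  quadratic cubic : Fin n → ℤ
  quadratic i = (d i - + 1) * (d i - + 3)
  cubic i = (d i - + 1) * ((d i - + 2) * (d i - + 3))

  Σquadratic : sumFin quadratic ≡ Σd² + - (+ 4) * Σd + + n * + 3
  Σquadratic = trans (sum-cong (λ i → alg (d i)))
    (trans (sum-+ (λ i → d i * d i + - (+ 4) * d i) (λ _ → + 3))
      (cong₂ _+_ (trans (sum-+ (λ i → d i * d i) (λ i → - (+ 4) * d i)) (cong (_+_ Σd²) (sum-*ˡ (- (+ 4)) d))) (sum-const {n} (+ 3))))
    where
    alg : ∀ d → (d - + 1) * (d - + 3) ≡ d * d + - (+ 4) * d + + 3
    alg = solve-∀

  Σcubic : sumFin cubic ≡ Σd³ + - (+ 6) * Σd² + + 11 * Σd + + n * - (+ 6)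
  Σcubic = trans (sum-cong (λ i → alg (d i)))
    (trans (sum-+ (λ i → d i * (d i * d i) + - (+ 6) * (d i * d i) + + 11 * d i) (λ _ → - (+ 6)))
      (cong₂ _+_ (trans (sum-+ (λ i → d i * (d i * d i) + - (+ 6) * (d i * d i)) (λ i → + 11 * d i))
        (cong₂ _+_ (trans (sum-+ (λ i → d i * (d i * d i)) (λ i → - (+ 6) * (d i * d i))) (cong (_+_ Σd³) (sum-*ˡ (- (+ 6)) (λ i → d i * d i)))) (sum-*ˡ (+ 11) d)))
        (sum-const {n} (- (+ 6)))))
    where
    alg : ∀ d → (d - + 1) * ((d - + 2) * (d - + 3)) ≡ d * (d * d) + - (+ 6) * (d * d) + + 11 * d + - (+ 6)
    alg = solve-∀

-- Replacing column u of M by e only changes how w u enters the product M w.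
clear : ∀ {n} → Fin n → (Fin n → ℤ) → Fin n → ℤ
clear u w c = if δ c u then + 0 else w c

clear-at : ∀ {n} (u : Fin n) w → clear u w u ≡ + 0
clear-at u w rewrite δ-refl u = refl

clear-off : ∀ {n} {u : Fin n} w {c} → c ≢ u → clear u w c ≡ w c
clear-off w c≢u rewrite δ-≢ c≢u = refl

apply-setCol : ∀ {n} (M : Mat n) u e w r → apply (setCol M u e) w r ≡ e r * w u + apply M (clear u w) r
apply-setCol M u e w r = trans (sum-cong split)
    (trans (sum-+ (λ c → ind c u * (e r * w c)) (λ c → M r c * clear u w c)) (cong (_+ apply M (clear u w) r) (sum-ind u (λ c → e r * w c))))
  where
  alg₁ : ∀ x m → x ≡ + 1 * x + m * + 0
  alg₁ = solve-∀
  alg₂ : ∀ x m → m ≡ + 0 * x + m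
  alg₂ = solve-∀
  split : ∀ c → setCol M u e r c * w c ≡ ind c u * (e r * w c) + M r c * clear u w c
  split c with δ c u
  ... | true = alg₁ (e r * w c) (M r c)
  ... | false = alg₂ (e r * w c) (M r c * w c)

module Centipede (j : ℕ) where

  data Edge (a b : ℕ) : Set where
    step : b ≡ suc a → b ℕ.< suc (suc j) → Edge a b
    hang : 1 ℕ.≤ a → a ℕ.≤ j → b ≡ suc j ℕ.+ a → Edge a b

  edge-sound : ∀ a b → edge (suc (suc j)) a b ≡ true → Edge a b
  edge-sound a b e with ∨-true e
  ... | inj₁ p = step (true-dec (b ℕ.≟ suc a) (proj₁ (∧-true p))) (ℕP.<ᵇ⇒< b (suc (suc j)) (≡⇒T (proj₂ (∧-true {⌊ b ℕ.≟ suc a ⌋} p))))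
  ... | inj₂ p with ∧-true {1 ℕ.≤ᵇ a} p
  ... | 1≤a , p′ with ∧-true {suc a ℕ.<ᵇ suc (suc j)} p′
  ... | a<k , b≡ = hang (ℕP.≤ᵇ⇒≤ 1 a (≡⇒T 1≤a)) (ℕP.≤-pred (ℕP.≤-pred (ℕP.<ᵇ⇒< (suc a) (suc (suc j)) (≡⇒T a<k))))
                        (true-dec (b ℕ.≟ suc (j ℕ.+ a)) b≡)

  edge-complete : ∀ a b → Edge a b → edge (suc (suc j)) a b ≡ true
  edge-complete a b (step b≡ b<k) rewrite dec-true (b ℕ.≟ suc a) b≡ | T⇒≡ (ℕP.<⇒<ᵇ b<k) = refl
  edge-complete a b (hang 1≤a a≤j b≡)
    rewrite T⇒≡ (ℕP.≤⇒≤ᵇ 1≤a) | T⇒≡ (ℕP.<⇒<ᵇ (s≤s (s≤s a≤j))) | dec-true (b ℕ.≟ suc (j ℕ.+ a)) b≡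
    = ∨-zeroʳ _

  edge-< : ∀ {a b} → Edge a b → a ℕ.< b
  edge-< (step refl _) = ℕP.n<1+n _
  edge-< {a} (hang _ _ refl) = s≤s (ℕP.m≤n+m a j)

  edge-parent! : ∀ {a a′ b} → Edge a b → Edge a′ b → a ≡ a′
  edge-parent! (step e _) (step e′ _) = ℕP.suc-injective (trans (sym e) e′)
  edge-parent! (step _ b<k) (hang 1≤a _ refl) = ⊥-elim (ℕP.<⇒≱ b<k (s≤s (ℕP.≤-trans (ℕP.≤-reflexive (ℕP.+-comm 1 j)) (ℕP.+-monoʳ-≤ j 1≤a))))
  edge-parent! (hang 1≤a _ refl) (step _ b<k) = ⊥-elim (ℕP.<⇒≱ b<k (s≤s (ℕP.≤-trans (ℕP.≤-reflexive (ℕP.+-comm 1 j)) (ℕP.+-monoʳ-≤ j 1≤a))))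
  edge-parent! (hang _ _ e) (hang _ _ e′) = ℕP.+-cancelˡ-≡ (suc j) _ _ (trans (sym e) e′)

  k n : ℕ
  k = suc (suc j)
  n = 2 ℕ.* k ℕ.∸ 2

  C : Graph n
  C = centipede k

  n≡ : n ≡ suc j ℕ.+ suc j
  n≡ = trans (cong (λ z → j ℕ.+ suc (suc z)) (ℕP.+-identityʳ j)) (ℕP.+-suc j (suc j))

  adj-sound : ∀ {a b} → adj C a b ≡ true → Edge (toℕ a) (toℕ b) ⊎ Edge (toℕ b) (toℕ a)
  adj-sound {a} {b} e with ∨-true (proj₂ (∧-true {not (δ a b)} e))
  ... | inj₁ p = inj₁ (edge-sound (toℕ a) (toℕ b) p)
  ... | inj₂ p = inj₂ (edge-sound (toℕ b) (toℕ a) p)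

  adj-complete : ∀ {a b} → Edge (toℕ a) (toℕ b) → adj C a b ≡ true
  adj-complete {a} {b} e rewrite δ-≢ {i = a} {b} (λ a≡b → ℕP.<-irrefl (cong toℕ a≡b) (edge-< e))
                               | edge-complete (toℕ a) (toℕ b) e = refl

  open Neighbours C
  open Lap C

  -- Both kinds of edge increase the label, and each label is the upper end of at most one of them,
  -- so the labels themselves serve as ranks.
  ranked : Ranked C toℕ
  ranked = record
    { levels = λ {a} {b} e a≡b → adj-≢ {a} {b} e (toℕ-injective a≡b)
    ; parent! = λ {a} {a′} {b} e a<b e′ a′<b → toℕ-injective (edge-parent! (up {a} {b} e a<b) (up {a′} {b} e′ a′<b))
    }
    where
    up : ∀ {a b} → adj C a b ≡ true → toℕ a ℕ.< toℕ b → Edge (toℕ a) (toℕ b)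
    up {a} {b} e a<b with adj-sound {a} {b} e
    ... | inj₁ p = p
    ... | inj₂ p = ⊥-elim (ℕP.<-asym a<b (edge-< p))

  path< : ∀ {i} → i ℕ.≤ suc j → i ℕ.< n
  path< {i} i≤ = subst (i ℕ.<_) (sym n≡) (s≤s (ℕP.≤-trans i≤ (ℕP.m≤n+m (suc j) j)))

  pend< : ∀ {u} → u ℕ.< j → suc j ℕ.+ suc u ℕ.< n
  pend< {u} u<j = subst (suc j ℕ.+ suc u ℕ.<_) (sym n≡) (ℕP.+-monoʳ-< (suc j) (s≤s u<j))

  -- The bound is irrelevant, so vertices reached with different proofs of it are definitionally
  -- equal.
  pathV : ∀ i → .(i ℕ.≤ suc j) → Fin n
  pathV i i≤ = fromℕ< {i} (path< i≤)

  pendV : ∀ u → .(u ℕ.< j) → Fin n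
  pendV u u<j = fromℕ< {suc j ℕ.+ suc u} (pend< u<j)

  toℕ-path : ∀ i .(i≤ : i ℕ.≤ suc j) → toℕ (pathV i i≤) ≡ i
  toℕ-path i i≤ = toℕ-fromℕ< (path< i≤)

  toℕ-pend : ∀ u .(u<j : u ℕ.< j) → toℕ (pendV u u<j) ≡ suc j ℕ.+ suc u
  toℕ-pend u u<j = toℕ-fromℕ< (pend< u<j)

  -- The internal path vertices are numbered suc u with u < j; pendV u hangs from pathV (suc u).
  data Kind (a : Fin n) : Set where
    first : a ≡ pathV 0 z≤n → Kind a
    inner : ∀ u (u<j : u ℕ.< j) → a ≡ pathV (suc u) (s≤s (ℕP.<⇒≤ u<j)) → Kind a
    last  : a ≡ pathV (suc j) ℕP.≤-refl → Kind a
    pend  : ∀ u (u<j : u ℕ.< j) → a ≡ pendV u u<j → Kind a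

  kind : ∀ a → Kind a
  kind a with toℕ a in e
  ... | zero = first (toℕ-injective (trans e (sym (toℕ-path 0 z≤n))))
  ... | suc u with ℕP.<-cmp u j
  ... | tri< u<j _ _ = inner u u<j (toℕ-injective (trans e (sym (toℕ-path (suc u) (s≤s (ℕP.<⇒≤ u<j))))))
  ... | tri≈ _ refl _ = last (toℕ-injective (trans e (sym (toℕ-path (suc u) ℕP.≤-refl))))
  ... | tri> _ _ j<u = pend u′ u′<j (toℕ-injective (trans e (trans (cong suc u≡) (sym (toℕ-pend u′ u′<j)))))
    where
    u′ = u ℕ.∸ suc j
    u≡ : u ≡ j ℕ.+ suc u′
    u≡ = trans (sym (ℕP.m+[n∸m]≡n j<u)) (sym (ℕP.+-suc j u′))
    u′<j : u′ ℕ.< j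
    u′<j = ℕP.≤-pred (ℕP.+-cancelˡ-< (suc j) (suc u′) (suc j) (subst₂ ℕ._<_ (trans e (cong suc u≡)) n≡ (toℕ<n a)))

  Edge± : ℕ → ℕ → Set
  Edge± a b = Edge a b ⊎ Edge b a

  private
    ≤-absurd : ∀ {a b} → suc a ℕ.+ b ℕ.≤ a → ⊥
    ≤-absurd {a} {b} = ℕP.m+n≮m a b

    pend≮k : ∀ {u} → suc j ℕ.+ suc u ℕ.< suc (suc j) → ⊥
    pend≮k {u} p = ℕP.m+1+n≰m j (ℕP.≤-pred (ℕP.≤-pred p))

  nb-first : ∀ {b} → Edge± 0 b → b ≡ 1
  nb-first (inj₁ (step e _)) = e
  nb-first (inj₁ (hang () _ _))
  nb-first (inj₂ (step () _))
  nb-first (inj₂ (hang _ _ ()))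

  nb-last : ∀ {b} → Edge± (suc j) b → b ≡ j
  nb-last (inj₁ (step refl lt)) = ⊥-elim (ℕP.<-irrefl refl lt)
  nb-last (inj₁ (hang _ le _)) = ⊥-elim (ℕP.<-irrefl refl le)
  nb-last (inj₂ (step e _)) = sym (ℕP.suc-injective e)
  nb-last {suc b} (inj₂ (hang _ _ e)) = ⊥-elim (ℕP.m≢1+m+n j (trans (ℕP.suc-injective e) (ℕP.+-suc j b)))

  nb-inner : ∀ {u b} → u ℕ.< j → Edge± (suc u) b → b ≡ u ⊎ b ≡ suc (suc u) ⊎ b ≡ suc j ℕ.+ suc u
  nb-inner u<j (inj₁ (step e _)) = inj₂ (inj₁ e)
  nb-inner u<j (inj₁ (hang _ _ e)) = inj₂ (inj₂ e)
  nb-inner u<j (inj₂ (step e _)) = inj₁ (sym (ℕP.suc-injective e))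
  nb-inner {u} {b} u<j (inj₂ (hang _ _ e)) = ⊥-elim (ℕP.<⇒≱ u<j (subst (j ℕ.≤_) (sym (ℕP.suc-injective e)) (ℕP.m≤m+n j b)))

  nb-pend : ∀ {u b} → Edge± (suc j ℕ.+ suc u) b → b ≡ suc u
  nb-pend {u} (inj₁ (step refl lt)) = ⊥-elim (pend≮k (ℕP.<-trans (ℕP.n<1+n (suc j ℕ.+ suc u)) lt))
  nb-pend (inj₁ (hang _ le _)) = ⊥-elim (≤-absurd le)
  nb-pend (inj₂ (step e lt)) = ⊥-elim (pend≮k lt)
  nb-pend (inj₂ (hang _ _ e)) = sym (ℕP.+-cancelˡ-≡ (suc j) _ _ e)

  private
    at : ∀ {a b a′ b′} → toℕ {n} a ≡ a′ → toℕ {n} b ≡ b′ → Edge a′ b′ → adj C a b ≡ true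
    at {a} {b} refl refl e = adj-complete {a} {b} e

    from : ∀ {a w : Fin n} {a′} → toℕ a ≡ a′ → adj C a w ≡ true → Edge± a′ (toℕ w)
    from {a} {w} refl e = adj-sound {a} {w} e

    ≡V : ∀ {w : Fin n} {i} {v : Fin n} → toℕ v ≡ i → toℕ w ≡ i → w ≡ v
    ≡V e e′ = toℕ-injective (trans e′ (sym e))

  adj-first : adj C (pathV 0 z≤n) (pathV 1 (s≤s z≤n)) ≡ true
  adj-first = at (toℕ-path 0 z≤n) (toℕ-path 1 (s≤s z≤n)) (step refl (s≤s (s≤s z≤n)))

  only-first : ∀ w → adj C (pathV 0 z≤n) w ≡ true → w ≡ pathV 1 (s≤s z≤n)
  only-first w e = ≡V (toℕ-path 1 (s≤s z≤n)) (nb-first (from {pathV 0 z≤n} {w} (toℕ-path 0 z≤n) e))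

  adj-last : adj C (pathV (suc j) ℕP.≤-refl) (pathV j (ℕP.n≤1+n j)) ≡ true
  adj-last = adj-flip {pathV j (ℕP.n≤1+n j)} {pathV (suc j) ℕP.≤-refl} (at (toℕ-path j (ℕP.n≤1+n j)) (toℕ-path (suc j) ℕP.≤-refl) (step refl ℕP.≤-refl))

  only-last : ∀ w → adj C (pathV (suc j) ℕP.≤-refl) w ≡ true → w ≡ pathV j (ℕP.n≤1+n j)
  only-last w e = ≡V (toℕ-path j (ℕP.n≤1+n j)) (nb-last (from {pathV (suc j) ℕP.≤-refl} {w} (toℕ-path (suc j) ℕP.≤-refl) e))

  module _ (u : ℕ) (u<j : u ℕ.< j) where
    base prev next hung : Fin n
    base = pathV (suc u) (s≤s (ℕP.<⇒≤ u<j))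
    prev = pathV u (ℕP.≤-trans (ℕP.<⇒≤ u<j) (ℕP.n≤1+n j))
    next = pathV (suc (suc u)) (s≤s u<j)
    hung = pendV u u<j

    private
      t-here : toℕ base ≡ suc u
      t-here = toℕ-path (suc u) (s≤s (ℕP.<⇒≤ u<j))
      t-prev : toℕ prev ≡ u
      t-prev = toℕ-path u (ℕP.≤-trans (ℕP.<⇒≤ u<j) (ℕP.n≤1+n j))
      t-next : toℕ next ≡ suc (suc u)
      t-next = toℕ-path (suc (suc u)) (s≤s u<j)
      t-hung : toℕ hung ≡ suc j ℕ.+ suc u
      t-hung = toℕ-pend u u<j

      apart : ∀ {a b a′ b′} → toℕ {n} a ≡ a′ → toℕ {n} b ≡ b′ → a′ ≢ b′ → a ≢ b
      apart ea eb ne a≡b = ne (trans (sym ea) (trans (cong toℕ a≡b) eb))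

    adj-pend : adj C hung base ≡ true
    adj-pend = adj-flip {base} {hung} (at t-here t-hung (hang (s≤s z≤n) u<j refl))

    only-pend : ∀ w → adj C hung w ≡ true → w ≡ base
    only-pend w e = ≡V t-here (nb-pend (from {hung} {w} t-hung e))

    nbrSum-inner : ∀ g → sumFin (λ w → A base w * g w) ≡ g prev + g next + g hung
    nbrSum-inner = nbrSum₃ {base} {prev} {next} {hung} (adj-flip {prev} {base} (at t-prev t-here (step refl (s≤s (ℕP.≤-trans u<j (ℕP.n≤1+n j))))))
      (at t-here t-next (step refl (s≤s (s≤s u<j))))
      (adj-flip {hung} {base} adj-pend)
      (apart t-prev t-next (λ e → ℕP.<-irrefl e (ℕP.≤-trans (ℕP.n<1+n u) (ℕP.n≤1+n (suc u)))))
      (apart t-prev t-hung (λ e → ℕP.<-irrefl e (ℕP.≤-trans (ℕP.n<1+n u) (ℕP.m≤n+m (suc u) (suc j)))))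
      (apart t-next t-hung (λ e → ℕP.<-irrefl e (ℕP.≤-trans (s≤s (s≤s u<j)) (ℕP.≤-trans (ℕP.≤-reflexive (cong suc (ℕP.+-comm 1 j))) (s≤s (ℕP.+-monoʳ-≤ j (s≤s z≤n)))))))
      λ w e → case w (nb-inner u<j (from {base} {w} t-here e))
      where
      case : ∀ w → toℕ w ≡ u ⊎ toℕ w ≡ suc (suc u) ⊎ toℕ w ≡ suc j ℕ.+ suc u → w ≡ prev ⊎ w ≡ next ⊎ w ≡ hung
      case w (inj₁ p) = inj₁ (≡V t-prev p)
      case w (inj₂ (inj₁ p)) = inj₂ (inj₁ (≡V t-next p))
      case w (inj₂ (inj₂ p)) = inj₂ (inj₂ (≡V t-hung p))

    nbrSum-pend : ∀ g → sumFin (λ w → A hung w * g w) ≡ g base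
    nbrSum-pend = nbrSum₁ {hung} {base} adj-pend only-pend

    degree-inner : d base ≡ + 3
    degree-inner = trans (degree-sum base) (nbrSum-inner (λ _ → + 1))

    degree-pend : d hung ≡ + 1
    degree-pend = trans (degree-sum hung) (nbrSum-pend (λ _ → + 1))

  nbrSum-first : ∀ g → sumFin (λ w → A (pathV 0 z≤n) w * g w) ≡ g (pathV 1 (s≤s z≤n))
  nbrSum-first = nbrSum₁ {pathV 0 z≤n} {pathV 1 (s≤s z≤n)} adj-first only-first

  nbrSum-last : ∀ g → sumFin (λ w → A (pathV (suc j) ℕP.≤-refl) w * g w) ≡ g (pathV j (ℕP.n≤1+n j))
  nbrSum-last = nbrSum₁ {pathV (suc j) ℕP.≤-refl} {pathV j (ℕP.n≤1+n j)} adj-last only-last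

  degree-first : d (pathV 0 z≤n) ≡ + 1
  degree-first = trans (degree-sum (pathV 0 z≤n)) (nbrSum-first (λ _ → + 1))

  degree-last : d (pathV (suc j) ℕP.≤-refl) ≡ + 1
  degree-last = trans (degree-sum (pathV (suc j) ℕP.≤-refl)) (nbrSum-last (λ _ → + 1))

  degree-1-3 : ∀ a → d a ≡ + 1 ⊎ d a ≡ + 3
  degree-1-3 a with kind a
  ... | first refl = inj₁ degree-first
  ... | inner u u<j refl = inj₂ (degree-inner u u<j)
  ... | last refl = inj₁ degree-last
  ... | pend u u<j refl = inj₁ (degree-pend u u<j)

  open DegreeSums C

  Σquadratic≡0 : sumFin quadratic ≡ + 0
  Σquadratic≡0 = sum-zero λ a → term (degree-1-3 a)
    where
    term : ∀ {x} → x ≡ + 1 ⊎ x ≡ + 3 → (x - + 1) * (x - + 3) ≡ + 0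
    term (inj₁ refl) = refl
    term (inj₂ refl) = refl

  Σcubic≡0 : sumFin cubic ≡ + 0
  Σcubic≡0 = sum-zero λ a → term (degree-1-3 a)
    where
    term : ∀ {x} → x ≡ + 1 ⊎ x ≡ + 3 → (x - + 1) * ((x - + 2) * (x - + 3)) ≡ + 0
    term (inj₁ refl) = refl
    term (inj₂ refl) = refl

  -- Each degree is 1 plus twice the indicator of an internal path vertex. There are `j` of these
  -- and `n` is 2j+2, so both sides are 4j+2.
  Σd≡ : Σd ≡ + 2 * (+ n - + 1)
  Σd≡ = trans (sum-cong formula)
    (trans (sum-+ {n} (λ _ → + 1) (λ a → + 2 * internal (toℕ a)))
    (trans (cong₂ _+_ (trans (sum-const {n} (+ 1)) (ℤP.*-identityʳ (+ n))) (trans (sum-*ˡ {n} (+ 2) (internal ∘ toℕ)) (cong (+ 2 *_) count)))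
      (trans (cong (λ z → + z + + 2 * + j) n≡) (trans (alg (+ j)) (cong (λ z → + 2 * (+ z - + 1)) (sym n≡))))))
    where
    internal : ℕ → ℤ
    internal zero = + 0
    internal (suc u) = b2z (u ℕ.<ᵇ j)
    <ᵇ-true : ∀ {u} → u ℕ.< j → (u ℕ.<ᵇ j) ≡ true
    <ᵇ-true lt = T⇒≡ (ℕP.<⇒<ᵇ lt)
    <ᵇ-false : ∀ {u} → ¬ (u ℕ.< j) → (u ℕ.<ᵇ j) ≡ false
    <ᵇ-false {u} nlt with u ℕ.<ᵇ j in e
    ... | true = ⊥-elim (nlt (ℕP.<ᵇ⇒< u j (≡⇒T e)))
    ... | false = refl
    one : ∀ {z} → z ≡ + 0 → + 1 ≡ + 1 + + 2 * z
    one refl = refl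
    three : ∀ {z} → z ≡ + 1 → + 3 ≡ + 1 + + 2 * z
    three refl = refl
    formula : ∀ a → d a ≡ + 1 + + 2 * internal (toℕ a)
    formula a with kind a
    ... | first refl = trans degree-first (one (cong internal (toℕ-path 0 z≤n)))
    ... | inner u u<j refl = trans (degree-inner u u<j) (three (trans (cong internal (toℕ-path (suc u) (s≤s (ℕP.<⇒≤ u<j)))) (cong b2z (<ᵇ-true u<j))))
    ... | last refl = trans degree-last (one (trans (cong internal (toℕ-path (suc j) ℕP.≤-refl)) (cong b2z (<ᵇ-false (ℕP.<-irrefl refl)))))
    ... | pend u u<j refl = trans (degree-pend u u<j) (one (trans (cong internal (toℕ-pend u u<j)) (cong b2z (<ᵇ-false (ℕP.m+n≮m j (suc u))))))
    count : sumFin {n} (internal ∘ toℕ) ≡ + j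
    count = trans (sum-size internal n≡) (trans (sum-split (suc j) (suc j) internal)
      (trans (cong₂ _+_ (trans (ℤP.+-identityˡ (sumFin {j} (λ i → internal (suc (toℕ i)))))
                               (trans (sum-cong {j} (λ i → cong b2z (<ᵇ-true (toℕ<n i)))) (trans (sum-const {j} (+ 1)) (ℤP.*-identityʳ (+ j)))))
                        (sum-zero {suc j} (λ i → cong b2z (<ᵇ-false (ℕP.m+n≮m j (toℕ i))))))
             (ℤP.+-identityʳ (+ j))))
    alg : ∀ x → (+ 1 + x + (+ 1 + x)) + + 2 * x ≡ + 2 * ((+ 1 + x + (+ 1 + x)) - + 1)
    alg = solve-∀

  -- At a leaf the value equals that of its neighbour. At an internal vertex with value `x` the
  -- pendant therefore also has `x`, and if the previous path vertex has it too, the equation forces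
  -- it on the next one.
  harmonic⇒constant : Harmonic⇒Constant C
  harmonic⇒constant f harm a b = trans (all a) (sym (all b))
    where
    leaf : ∀ {v z} → d v ≡ + 1 → sumFin (λ w → A v w * f w) ≡ f z → f v ≡ f z
    leaf {v} dv e = ℤP.i-j≡0⇒i≡j _ _ (trans (sym (trans (L-apply f v) (cong₂ _-_ (trans (cong (_* f v) dv) (ℤP.*-identityˡ (f v))) e))) (harm v))
    f₀ = f (pathV 0 z≤n)
    solveNext : ∀ x p q → + 3 * x - (p + q + x) ≡ + 0 → p ≡ x → q ≡ x
    solveNext x .x q e refl = sym (ℤP.i-j≡0⇒i≡j x q (trans (alg x q) e))
      where
      alg : ∀ x q → x - q ≡ + 3 * x - (x + q + x)
      alg = solve-∀
    path : ∀ i (i≤ : i ℕ.≤ suc j) → f (pathV i i≤) ≡ f₀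
    path zero _ = refl
    path (suc zero) _ = sym (leaf {pathV 0 z≤n} {pathV 1 (s≤s z≤n)} degree-first (nbrSum-first f))
    path (suc (suc u)) (s≤s u<j) = trans (solveNext (f (base u u<j)) (f (prev u u<j)) (f (next u u<j)) eqn
                                            (trans (path u (ℕP.≤-trans (ℕP.<⇒≤ u<j) (ℕP.n≤1+n j))) (sym (path (suc u) (s≤s (ℕP.<⇒≤ u<j))))))
                                         (path (suc u) (s≤s (ℕP.<⇒≤ u<j)))
      where
      eqn : + 3 * f (base u u<j) - (f (prev u u<j) + f (next u u<j) + f (base u u<j)) ≡ + 0
      eqn = trans (cong (λ z → + 3 * f (base u u<j) - (f (prev u u<j) + f (next u u<j) + z))
                        (sym (leaf {hung u u<j} {base u u<j} (degree-pend u u<j) (nbrSum-pend u u<j f))))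
            (trans (sym (trans (L-apply f (base u u<j)) (cong₂ (λ x y → x * f (base u u<j) - y) (degree-inner u u<j) (nbrSum-inner u u<j f))))
                   (harm (base u u<j)))
    all : ∀ a → f a ≡ f₀
    all a with kind a
    ... | first refl = refl
    ... | inner u u<j refl = path (suc u) (s≤s (ℕP.<⇒≤ u<j))
    ... | last refl = path (suc j) ℕP.≤-refl
    ... | pend u u<j refl = trans (leaf {hung u u<j} {base u u<j} (degree-pend u u<j) (nbrSum-pend u u<j f)) (path (suc u) (s≤s (ℕP.<⇒≤ u<j)))

twinLeaves : ∀ {n} {G : Graph n} {u u′ b} → u ≢ u′ → degree G u ≡ + 1 →
             adj G u b ≡ true → (∀ w → adj G u w ≡ true → w ≡ b) →
             adj G u′ b ≡ true → (∀ w → adj G u′ w ≡ true → w ≡ b) → TwinLeaves G u u′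
twinLeaves {G = G} {u} {u′} {b} u≢u′ du e o e′ o′ = record
  { distinct = u≢u′
  ; leaf = du
  ; same = λ r → bool-ext {adj G u r} {adj G u′ r} (λ p → subst (λ z → adj G u′ z ≡ true) (sym (o r p)) e′)
                          (λ p → subst (λ z → adj G u z ≡ true) (sym (o′ r p)) e)
  }

-- The root 1 of the centipede is at most double

module CentipedeTwins (i : ℕ) where
  j = suc i
  open Centipede j
  open Lap C
  open Twins C

  -- For `i ≡ 0` the centipede is a star with three leaves and `q₀` coincides with `qₗ`; the
  -- replaced columns `p₀` and `pₗ` are still different.
  p₀ q₀ pₗ qₗ : Fin n
  p₀ = pathV 0 z≤n
  q₀ = pendV 0 (s≤s z≤n)
  pₗ = pathV (suc j) ℕP.≤-refl
  qₗ = pendV i ℕP.≤-refl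

  apart : ∀ {a b : Fin n} {a′ b′} → toℕ a ≡ a′ → toℕ b ≡ b′ → a′ ≢ b′ → a ≢ b
  apart ea eb ne a≡b = ne (trans (sym ea) (trans (cong toℕ a≡b) eb))

  path≢pend : ∀ v (v≤ : v ℕ.≤ suc j) u (u<j : u ℕ.< j) → pathV v v≤ ≢ pendV u u<j
  path≢pend v v≤ u u<j = apart (toℕ-path v v≤) (toℕ-pend u u<j)
    (λ e → ℕP.<-irrefl e (s≤s (ℕP.≤-trans v≤ (ℕP.≤-trans (ℕP.≤-reflexive (ℕP.+-comm 1 j)) (ℕP.+-monoʳ-≤ j (s≤s z≤n))))))

  path≢path : ∀ v (v≤ : v ℕ.≤ suc j) u (u≤ : u ℕ.≤ suc j) → v ≢ u → pathV v v≤ ≢ pathV u u≤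
  path≢path v v≤ u u≤ = apart (toℕ-path v v≤) (toℕ-path u u≤)

  pend≢pend : ∀ v (v<j : v ℕ.< j) u (u<j : u ℕ.< j) → v ≢ u → pendV v v<j ≢ pendV u u<j
  pend≢pend v v<j u u<j ne = apart (toℕ-pend v v<j) (toℕ-pend u u<j) (λ e → ne (ℕP.suc-injective (ℕP.+-cancelˡ-≡ (suc j) _ _ e)))

  firstTwins : TwinLeaves C p₀ q₀
  firstTwins = twinLeaves {G = C} {p₀} {q₀} {pathV 1 (s≤s z≤n)} (path≢pend 0 z≤n 0 (s≤s z≤n)) degree-first adj-first only-first (adj-pend 0 (s≤s z≤n)) (only-pend 0 (s≤s z≤n))

  lastTwins : TwinLeaves C pₗ qₗ
  lastTwins = twinLeaves {G = C} {pₗ} {qₗ} {pathV j (ℕP.n≤1+n j)} (path≢pend (suc j) ℕP.≤-refl i ℕP.≤-refl) degree-last adj-last only-last (adj-pend i ℕP.≤-refl) (only-pend i ℕP.≤-refl)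

  pₗ≢p₀ : pₗ ≢ p₀
  pₗ≢p₀ = path≢path (suc j) ℕP.≤-refl 0 z≤n (λ ())

  qₗ≢p₀ : qₗ ≢ p₀
  qₗ≢p₀ e = path≢pend 0 z≤n i ℕP.≤-refl (sym e)

  residual : Mat n
  residual = twice p₀ q₀ pₗ qₗ (+ 0)

  module _ (1≤i : 1 ℕ.≤ i) where

    -- The equation reads: `β` and `α` times the two twin differences plus `(I - L) x` is zero, with
    -- `x` vanishing at `p₀` and `pₗ`. In the row of a leaf, `(I - L) x` is the value of `x` at its
    -- neighbour. Twin rows thus differ only in the sign of `α` or `β`, killing both it and the
    -- neighbour's value; as `1 ≤ i` keeps `q₀` and `qₗ` apart, the two pairs do not interfere. The
    -- other pendant rows kill the remaining internal values.
    residual-inj : Inj residual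
    residual-inj w ker = conclude
      where
      x : Fin n → ℤ
      x = clear p₀ (clear pₗ w)
      α β : ℤ
      α = w p₀
      β = w pₗ
      rowEq : ∀ r → difference pₗ qₗ r * β + (difference p₀ q₀ r * α + (x r - (d r * x r - sumFin (λ c → A r c * x c)))) ≡ + 0
      rowEq r = trans (sym (trans (apply-setCol (once p₀ q₀ (+ 0)) pₗ (difference pₗ qₗ) w r)
          (cong (_+_ (difference pₗ qₗ r * β)) (trans (apply-setCol (N (+ 0)) p₀ (difference p₀ q₀) (clear pₗ w) r)
            (cong₂ (λ y z → difference p₀ q₀ r * y + z) (clear-off w (pₗ≢p₀ ∘ sym))
              (trans (apply-charMat L (+ 1 + + 0) x r) (cong₂ _-_ (ℤP.*-identityˡ (x r)) (L-apply x r))))))))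
        (ker r)
      diff : ∀ {r u u′ a b} → ind r u ≡ a → ind r u′ ≡ b → difference u u′ r ≡ a - b
      diff ea eb = cong₂ _-_ ea eb
      simplify : ∀ {D E δ ε r s} → D ≡ δ → E ≡ ε → d r ≡ + 1 → sumFin (λ c → A r c * x c) ≡ s →
                 D * β + (E * α + (x r - (d r * x r - sumFin (λ c → A r c * x c)))) ≡ + 0 →
                 δ * β + (ε * α + s) ≡ + 0
      simplify {δ = δ} {ε} {r} {s} refl refl dr refl e = trans (alg δ ε α β (x r) s) (trans (cong (λ z → δ * β + (ε * α + (x r - (z * x r - s)))) (sym dr)) e)
        where
        alg : ∀ δ ε α β x s → δ * β + (ε * α + s) ≡ δ * β + (ε * α + (x - (+ 1 * x - s)))
        alg = solve-∀
      i≢0 : i ≢ 0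
      i≢0 e = ℕP.<-irrefl (sym e) 1≤i
      eq-p₀ : + 0 * β + (+ 1 * α + x (pathV 1 (s≤s z≤n))) ≡ + 0
      eq-p₀ = simplify {r = p₀} (diff {p₀} {pₗ} {qₗ} (ind-≢ (pₗ≢p₀ ∘ sym)) (ind-≢ (qₗ≢p₀ ∘ sym)))
                (diff {p₀} {p₀} {q₀} (ind-refl p₀) (ind-≢ (path≢pend 0 z≤n 0 (s≤s z≤n)))) degree-first (nbrSum-first x) (rowEq p₀)
      eq-q₀ : + 0 * β + (- (+ 1) * α + x (pathV 1 (s≤s z≤n))) ≡ + 0
      eq-q₀ = simplify {r = q₀} (diff {q₀} {pₗ} {qₗ} (ind-≢ (path≢pend (suc j) ℕP.≤-refl 0 (s≤s z≤n) ∘ sym)) (ind-≢ (pend≢pend 0 (s≤s z≤n) i ℕP.≤-refl (i≢0 ∘ sym))))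
                (diff {q₀} {p₀} {q₀} (ind-≢ (path≢pend 0 z≤n 0 (s≤s z≤n) ∘ sym)) (ind-refl q₀)) (degree-pend 0 (s≤s z≤n)) (nbrSum-pend 0 (s≤s z≤n) x) (rowEq q₀)
      eq-pₗ : + 1 * β + (+ 0 * α + x (pathV j (ℕP.n≤1+n j))) ≡ + 0
      eq-pₗ = simplify {r = pₗ} (diff {pₗ} {pₗ} {qₗ} (ind-refl pₗ) (ind-≢ (path≢pend (suc j) ℕP.≤-refl i ℕP.≤-refl)))
                (diff {pₗ} {p₀} {q₀} (ind-≢ pₗ≢p₀) (ind-≢ (path≢pend (suc j) ℕP.≤-refl 0 (s≤s z≤n)))) degree-last (nbrSum-last x) (rowEq pₗ)
      eq-qₗ : - (+ 1) * β + (+ 0 * α + x (pathV j (ℕP.n≤1+n j))) ≡ + 0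
      eq-qₗ = simplify {r = qₗ} (diff {qₗ} {pₗ} {qₗ} (ind-≢ (path≢pend (suc j) ℕP.≤-refl i ℕP.≤-refl ∘ sym)) (ind-refl qₗ))
                (diff {qₗ} {p₀} {q₀} (ind-≢ qₗ≢p₀) (ind-≢ (pend≢pend i ℕP.≤-refl 0 (s≤s z≤n) i≢0))) (degree-pend i ℕP.≤-refl) (nbrSum-pend i ℕP.≤-refl x) (rowEq qₗ)
      both : ∀ {β γ z} → + 1 * γ + (+ 0 * β + z) ≡ + 0 → - (+ 1) * γ + (+ 0 * β + z) ≡ + 0 → γ ≡ + 0 × z ≡ + 0
      both {β} {γ} {z} e e′ = γ≡0 , trans (alg₂ β γ z) (trans (cong₂ _-_ e γ≡0) refl)
        where
        alg : ∀ β γ z → + 2 * γ ≡ (+ 1 * γ + (+ 0 * β + z)) - (- (+ 1) * γ + (+ 0 * β + z))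
        alg = solve-∀
        alg₂ : ∀ β γ z → z ≡ (+ 1 * γ + (+ 0 * β + z)) - γ
        alg₂ = solve-∀
        γ≡0 : γ ≡ + 0
        γ≡0 = nz-* (+ 2) γ (λ ()) (trans (alg β γ z) (cong₂ _-_ e e′))
      swap : ∀ {a b c t} → a + (b + c) ≡ t → b + (a + c) ≡ t
      swap {a} {b} {c} e = trans (alg a b c) e
        where
        alg : ∀ a b c → b + (a + c) ≡ a + (b + c)
        alg = solve-∀
      firsts : α ≡ + 0 × x (pathV 1 (s≤s z≤n)) ≡ + 0
      firsts = both {β} {α} {x (pathV 1 (s≤s z≤n))} (swap {+ 0 * β} {+ 1 * α} eq-p₀) (swap {+ 0 * β} {(- (+ 1)) * α} eq-q₀)
      lasts : β ≡ + 0 × x (pathV j (ℕP.n≤1+n j)) ≡ + 0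
      lasts = both {α} {β} {x (pathV j (ℕP.n≤1+n j))} eq-pₗ eq-qₗ
      xinner : ∀ u (u<j : u ℕ.< j) → x (base u u<j) ≡ + 0
      xinner zero _ = proj₂ firsts
      xinner (suc u) u<j with suc u ℕ.≟ i
      ... | yes refl = proj₂ lasts
      ... | no u≢i = trans (alg α β (x (base (suc u) u<j))) (simplify {r = r} (diff {r} {pₗ} {qₗ} (ind-≢ (path≢pend (suc j) ℕP.≤-refl (suc u) u<j ∘ sym)) (ind-≢ (pend≢pend (suc u) u<j i ℕP.≤-refl u≢i)))
            (diff {r} {p₀} {q₀} (ind-≢ (path≢pend 0 z≤n (suc u) u<j ∘ sym)) (ind-≢ (pend≢pend (suc u) u<j 0 (s≤s z≤n) (λ ()))))
            (degree-pend (suc u) u<j) (nbrSum-pend (suc u) u<j x) (rowEq r))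
        where
        r = hung (suc u) u<j
        alg : ∀ α β z → z ≡ + 0 * β + (+ 0 * α + z)
        alg = solve-∀
      xp₀ : x p₀ ≡ + 0
      xp₀ = clear-at p₀ (clear pₗ w)
      xpₗ : x pₗ ≡ + 0
      xpₗ = trans (clear-off (clear pₗ w) pₗ≢p₀) (clear-at pₗ w)
      xpath : ∀ v (v≤ : v ℕ.≤ suc j) → x (pathV v v≤) ≡ + 0
      xpath zero _ = xp₀
      xpath (suc v) (s≤s v≤j) with ℕP.m≤n⇒m<n∨m≡n v≤j
      ... | inj₁ v<j = xinner v v<j
      ... | inj₂ refl = xpₗ
      -- With all path values zero, the row of an internal vertex retains only the value at its
      -- pendant.
      xpend : ∀ u (u<j : u ℕ.< j) → x (hung u u<j) ≡ + 0
      xpend u u<j = trans (alg α β (x (hung u u<j))) (trans (sym eqn) (rowEq r))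
        where
        r = base u u<j
        u≤ = ℕP.<⇒≤ u<j
        alg : ∀ α β z → z ≡ (+ 0 - + 0) * β + ((+ 0 - + 0) * α + (+ 0 - (+ 3 * + 0 - (+ 0 + + 0 + z))))
        alg = solve-∀
        Dₗ : difference pₗ qₗ r ≡ + 0 - + 0
        Dₗ = cong₂ _-_ (ind-≢ (path≢path (suc u) (s≤s u≤) (suc j) ℕP.≤-refl (λ e → ℕP.<-irrefl (ℕP.suc-injective e) u<j))) (ind-≢ (path≢pend (suc u) (s≤s u≤) i ℕP.≤-refl))
        D₀ : difference p₀ q₀ r ≡ + 0 - + 0
        D₀ = cong₂ _-_ (ind-≢ (path≢path (suc u) (s≤s u≤) 0 z≤n (λ ()))) (ind-≢ (path≢pend (suc u) (s≤s u≤) 0 (s≤s z≤n)))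
        rhs : ∀ {D E X δ S D′ E′ X′ δ′ S′} → D ≡ D′ → E ≡ E′ → X ≡ X′ → δ ≡ δ′ → S ≡ S′ →
              D * β + (E * α + (X - (δ * X - S))) ≡ D′ * β + (E′ * α + (X′ - (δ′ * X′ - S′)))
        rhs refl refl refl refl refl = refl
        eqn : difference pₗ qₗ r * β + (difference p₀ q₀ r * α + (x r - (d r * x r - sumFin (λ c → A r c * x c))))
              ≡ (+ 0 - + 0) * β + ((+ 0 - + 0) * α + (+ 0 - (+ 3 * + 0 - (+ 0 + + 0 + x (hung u u<j)))))
        eqn = rhs Dₗ D₀ (xinner u u<j) (degree-inner u u<j) (trans (nbrSum-inner u u<j x)
          (cong₂ (λ a b → a + b + x (hung u u<j)) (xpath u (ℕP.≤-trans u≤ (ℕP.n≤1+n j))) (xpath (suc (suc u)) (s≤s u<j))))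
      conclude : ∀ c → w c ≡ + 0
      conclude c = by (c ≟ p₀) (c ≟ pₗ) (kind c)
        where
        off : c ≢ p₀ → c ≢ pₗ → x c ≡ w c
        off c≢p₀ c≢pₗ = trans (clear-off (clear pₗ w) c≢p₀) (clear-off w c≢pₗ)
        by : Dec (c ≡ p₀) → Dec (c ≡ pₗ) → Kind c → w c ≡ + 0
        by (yes e) _ _ = trans (cong w e) (proj₁ firsts)
        by (no _) (yes e) _ = trans (cong w e) (proj₁ lasts)
        by (no a) (no b) (first e) = ⊥-elim (a e)
        by (no a) (no b) (last e) = ⊥-elim (b e)
        by (no a) (no b) (inner u u<j refl) = trans (sym (off a b)) (xinner u u<j)
        by (no a) (no b) (pend u u<j refl) = trans (sym (off a b)) (xpend u u<j)

residual-nonsingular : ∀ i → det (CentipedeTwins.residual i) ≢ + 0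
-- For the star the twin pairs share a leaf and their rows do not separate; the determinant of this
-- four by four matrix evaluates to a nonzero integer.
residual-nonsingular zero = λ ()
residual-nonsingular (suc i) = inj⇒det≢0 (CentipedeTwins.residual (suc i)) (CentipedeTwins.residual-inj (suc i) (s≤s z≤n))

-- Trees from connectedness

nonneg-+ : ∀ {a b} → + 0 ℤ.≤ a → + 0 ℤ.≤ b → + 0 ℤ.≤ a + b
nonneg-+ = ℤP.+-mono-≤

sum-nonneg : ∀ {n} {f : Fin n → ℤ} → (∀ i → + 0 ℤ.≤ f i) → + 0 ℤ.≤ sumFin f
sum-nonneg {zero} nn = ℤP.≤-refl
sum-nonneg {suc n} nn = nonneg-+ (nn zero) (sum-nonneg (nn ∘ suc))

nonneg-+≡0 : ∀ {a b} → + 0 ℤ.≤ a → + 0 ℤ.≤ b → a + b ≡ + 0 → a ≡ + 0 × b ≡ + 0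
nonneg-+≡0 {+ zero} {+ zero} _ _ _ = refl , refl
nonneg-+≡0 {+ zero} {+ suc _} _ _ ()
nonneg-+≡0 {+ suc _} {+ _} _ _ ()

sum-nonneg≡0 : ∀ {n} {f : Fin n → ℤ} → (∀ i → + 0 ℤ.≤ f i) → sumFin f ≡ + 0 → ∀ i → f i ≡ + 0
sum-nonneg≡0 {suc n} nn e zero = proj₁ (nonneg-+≡0 (nn zero) (sum-nonneg (nn ∘ suc)) e)
sum-nonneg≡0 {suc n} nn e (suc i) = sum-nonneg≡0 (nn ∘ suc) (proj₂ (nonneg-+≡0 (nn zero) (sum-nonneg (nn ∘ suc)) e)) i

sum-pos : ∀ {n} {f : Fin n → ℤ} → + 0 ℤ.< sumFin f → ∃ λ i → + 0 ℤ.< f i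
sum-pos {zero} (ℤ.+<+ ())
sum-pos {suc n} {f} p with + 0 ℤ.<? f zero
... | yes q = zero , q
... | no ¬q with sum-pos {n} {f ∘ suc} (ℤP.<-≤-trans p (ℤP.≤-trans (ℤP.+-monoˡ-≤ (sumFin (f ∘ suc)) (ℤP.≮⇒≥ ¬q)) (ℤP.≤-reflexive (ℤP.+-identityˡ _))))
... | i , q = suc i , q

b2z-nonneg : ∀ b → + 0 ℤ.≤ b2z b
b2z-nonneg true = ℤ.+≤+ z≤n
b2z-nonneg false = ℤ.+≤+ z≤n

true≢false : true ≢ false
true≢false ()

record Descent {n} (G : Graph n) (ρ : Fin n) : Set where
  field
    rank   : Fin n → ℕ
    height : ℕ
    rank<  : ∀ v → rank v ℕ.< height
    lower  : ∀ v → v ≢ ρ → ∃ λ w → adj G w v ≡ true × rank w ℕ.< rank v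

module Grow {n} (G : Graph n) (conn : Connected G) (ρ : Fin n) where

  -- A partial search tree: `S` is the set of vertices found so far, and the rank of each is the
  -- time of its discovery, not its distance from `ρ`; `t` is the next free rank.
  record State (t : ℕ) : Set where
    field
      S : Fin n → Bool
      r : Fin n → ℕ
      Sρ : S ρ ≡ true
      r< : ∀ v → S v ≡ true → r v ℕ.< t
      lower : ∀ v → S v ≡ true → v ≢ ρ → ∃ λ w → S w ≡ true × adj G w v ≡ true × r w ℕ.< r v

  missing : (Fin n → Bool) → ℤ
  missing S = sumFin λ v → b2z (not (S v))

  initial : State 1
  initial = record
    { S = λ v → δ v ρ
    ; r = λ _ → 0
    ; Sρ = δ-refl ρ
    ; r< = λ _ _ → s≤s z≤n
    ; lower = λ v e v≢ρ → ⊥-elim (v≢ρ (δ-true e))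
    }

  module _ {t} (st : State t) where
    open State st

    finish : (∀ v → S v ≡ true) → Descent G ρ
    finish all = record
      { rank = r
      ; height = t
      ; rank< = λ v → r< v (all v)
      ; lower = λ v v≢ρ → let (w , _ , e , lt) = lower v (all v) v≢ρ in w , e , lt
      }

    module _ (v w : Fin n) (Sw : S w ≡ true) (Sv : S v ≡ false) (e : adj G w v ≡ true) where

      S⁺ : Fin n → Bool
      S⁺ x = δ x v ∨ S x

      r⁺ : Fin n → ℕ
      r⁺ x = if δ x v then t else r x

      old : ∀ {x} → S x ≡ true → δ x v ≡ false
      old Sx = δ-≢ λ x≡v → true≢false (trans (sym Sx) (trans (cong S x≡v) Sv))

      r⁺-old : ∀ {x} → S x ≡ true → r⁺ x ≡ r x
      r⁺-old Sx rewrite old Sx = refl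

      S⁺-old : ∀ {x} → S x ≡ true → S⁺ x ≡ true
      S⁺-old Sx rewrite old Sx = Sx

      r⁺-new : r⁺ v ≡ t
      r⁺-new rewrite δ-refl v = refl

      extend : State (suc t)
      extend = record
        { S = S⁺
        ; r = r⁺
        ; Sρ = S⁺-old Sρ
        ; r< = λ x Sx → bound x (∨-true {δ x v} Sx)
        ; lower = λ x Sx x≢ρ → below x (∨-true {δ x v} Sx) x≢ρ
        }
        where
        bound : ∀ x → δ x v ≡ true ⊎ S x ≡ true → r⁺ x ℕ.< suc t
        bound x (inj₁ p) rewrite p = ℕP.≤-refl
        bound x (inj₂ Sx) = ℕP.m<n⇒m<1+n (subst (ℕ._< t) (sym (r⁺-old Sx)) (r< x Sx))
        below : ∀ x → δ x v ≡ true ⊎ S x ≡ true → x ≢ ρ → ∃ λ w → S⁺ w ≡ true × adj G w x ≡ true × r⁺ w ℕ.< r⁺ x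
        below x (inj₁ p) _ with δ-true {i = x} {v} p
        ... | refl = w , S⁺-old Sw , e , subst₂ ℕ._<_ (sym (r⁺-old Sw)) (sym r⁺-new) (r< w Sw)
        below x (inj₂ Sx) x≢ρ with lower x Sx x≢ρ
        ... | y , Sy , e′ , lt = y , S⁺-old Sy , e′ , subst₂ ℕ._<_ (sym (r⁺-old Sy)) (sym (r⁺-old Sx)) lt

      missing⁺ : missing S ≡ + 1 + missing S⁺
      missing⁺ = trans (sum-cong pt) (trans (sum-+ (λ x → ind x v) (λ x → b2z (not (S⁺ x)))) (cong (_+ missing S⁺) (sum-ind1 v)))
        where
        pt : ∀ x → b2z (not (S x)) ≡ ind x v + b2z (not (S⁺ x))
        pt x with x ≟ v
        ... | yes refl rewrite Sv = refl
        ... | no _ = sym (ℤP.+-identityˡ _)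

  suc-injℤ : ∀ {x m} → + 1 + x ≡ + suc m → x ≡ + m
  suc-injℤ {x} {m} e = trans (alg x) (cong (_+_ (- (+ 1))) e)
    where
    alg : ∀ x → x ≡ - (+ 1) + (+ 1 + x)
    alg = solve-∀

  -- The recursion is on the exact number of vertices not yet found. If no edge leaves the found
  -- set, connectedness shows that it is everything.
  build : ∀ m {t} (st : State t) → missing (State.S st) ≡ + m → Descent G ρ
  build zero st e = finish st λ v → present (State.S st v) (sum-nonneg≡0 (λ v → b2z-nonneg (not (State.S st v))) e v)
    where
    present : ∀ b → b2z (not b) ≡ + 0 → b ≡ true
    present true _ = refl
  build (suc m) st e with any? (λ v → any? (λ w → (State.S st w 𝔹≟ true) ×-dec (State.S st v 𝔹≟ false) ×-dec (adj G w v 𝔹≟ true)))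
  ... | yes (v , w , Sw , Sv , a) = build m (extend st v w Sw Sv a)
          (suc-injℤ (trans (sym (missing⁺ st v w Sw Sv a)) e))
  ... | no none = finish st λ v → trans (conn S closed v ρ) (State.Sρ st)
    where
    S = State.S st
    closed : ∀ i j → adj G i j ≡ true → S i ≡ S j
    closed i j a with S i in ei | S j in ej
    ... | true | true = refl
    ... | false | false = refl
    ... | true | false = ⊥-elim (none (j , i , ei , ej , a))
    ... | false | true = ⊥-elim (none (i , j , ej , ei , trans (adj-sym G j i) a))

  descent : Descent G ρ
  descent with sum-nat (λ v → not (State.S initial v))
    where
    sum-nat : ∀ {n} (f : Fin n → Bool) → ∃ λ m → sumFin (λ i → b2z (f i)) ≡ + m
    sum-nat f with sumFin (λ i → b2z (f i)) | sum-nonneg (λ i → b2z-nonneg (f i))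
    ... | + m | _ = m , refl
  ... | m , e = build m initial e

b2z-∧ : ∀ {a b} → a ≡ true → b ≡ true → b2z (a ∧ b) ≡ + 1
b2z-∧ refl refl = refl

drop-nonneg : ∀ {n} {f : Fin n → ℤ} → (∀ i → + 0 ℤ.≤ f i) → ∀ {a} → f a ≡ + 1 → ∀ i → + 0 ℤ.≤ f i - ind i a
drop-nonneg {f = f} nn {a} fa i = by (i ≟ a)
  where
  by : Dec (i ≡ a) → + 0 ℤ.≤ f i - ind i a
  by (yes refl) = ℤP.≤-reflexive (sym (cong₂ _-_ fa (ind-refl i)))
  by (no i≢a) = subst (+ 0 ℤ.≤_) (sym (trans (cong (_-_ (f i)) (ind-≢ i≢a)) (ℤP.+-identityʳ (f i)))) (nn i)

drop-Σ : ∀ {n} (f : Fin n → ℤ) x → sumFin (λ y → f y - ind y x) ≡ sumFin f - + 1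
drop-Σ f x = trans (sum-minus f (λ y → ind y x)) (cong (_-_ (sumFin f)) (sum-ind1 x))

sum≥₁ : ∀ {n} {f : Fin n → ℤ} → (∀ i → + 0 ℤ.≤ f i) → ∀ {a} → f a ≡ + 1 → + 0 ℤ.≤ sumFin f - + 1
sum≥₁ {f = f} nn {a} fa = subst (+ 0 ℤ.≤_) (drop-Σ f a) (sum-nonneg (drop-nonneg nn fa))

sum≥₂ : ∀ {n} {f : Fin n → ℤ} → (∀ i → + 0 ℤ.≤ f i) → ∀ {a b} → a ≢ b → f a ≡ + 1 → f b ≡ + 1 → + 0 ℤ.≤ sumFin f - + 1 - + 1
sum≥₂ {f = f} nn {a} {b} a≢b fa fb = subst (λ z → + 0 ℤ.≤ z - + 1) (drop-Σ f a)
  (sum≥₁ {f = λ i → f i - ind i a} (drop-nonneg nn fa) {b} (cong₂ _-_ fb (ind-≢ (a≢b ∘ sym))))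

-- With n - 1 edges, the n - 1 edges to the chosen lower neighbours are all the edges there are.
module Tree {n} (G : Graph n) {ρ : Fin n} (D : Descent G ρ) (edges : Lap.Σd G ≡ + 2 * (+ n - + 1)) where
  open Descent D
  open Lap G
  open Neighbours G

  private
    r = rank

    low : Fin n → Fin n → ℤ
    low v w = b2z (adj G v w ∧ (r w ℕ.<ᵇ r v))

    #low : Fin n → ℤ
    #low v = sumFin (low v)

    low-true : ∀ {v w} → adj G w v ≡ true → r w ℕ.< r v → low v w ≡ + 1
    low-true e lt = b2z-∧ (adj-flip e) (T⇒≡ (ℕP.<⇒<ᵇ lt))

    -- `X` detects edges between equal ranks, and `Y` counts lower neighbours beyond the one
    -- guaranteed, with none guaranteed at the root. Both are nonnegative, and the edge count makes
    -- the total of `X` plus twice the total of `Y` zero.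
    X : Fin n → Fin n → ℤ
    X v w = A v w - low v w - low w v

    Y : Fin n → ℤ
    Y v = #low v - (+ 1 - ind v ρ)

    X-nonneg : ∀ v w → + 0 ℤ.≤ X v w
    X-nonneg v w rewrite adj-sym G w v with adj G v w
    ... | false = ℤP.≤-refl
    ... | true with r w ℕ.<ᵇ r v in e₁ | r v ℕ.<ᵇ r w in e₂
    ... | false | false = ℤ.+≤+ z≤n
    ... | false | true = ℤP.≤-refl
    ... | true | false = ℤP.≤-refl
    ... | true | true = ⊥-elim (ℕP.<-asym (ℕP.<ᵇ⇒< (r w) (r v) (≡⇒T e₁)) (ℕP.<ᵇ⇒< (r v) (r w) (≡⇒T e₂)))

    low-nonneg : ∀ v w → + 0 ℤ.≤ low v w
    low-nonneg v w = b2z-nonneg (adj G v w ∧ (r w ℕ.<ᵇ r v))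

    Y-nonneg : ∀ v → + 0 ℤ.≤ Y v
    Y-nonneg v = by (v ≟ ρ)
      where
      by : Dec (v ≡ ρ) → + 0 ℤ.≤ Y v
      by (yes refl) = subst (+ 0 ℤ.≤_) (sym (trans (cong (λ z → #low v - (+ 1 - z)) (ind-refl v)) (ℤP.+-identityʳ (#low v)))) (sum-nonneg (low-nonneg v))
      by (no v≢ρ) with lower v v≢ρ
      ... | w , e , lt = subst (+ 0 ℤ.≤_) (cong (λ z → #low v - (+ 1 - z)) (sym (ind-≢ v≢ρ))) (sum≥₁ (low-nonneg v) {w} (low-true e lt))

    Z : Fin n → ℤ
    Z v = sumFin (X v) + (Y v + Y v)

    Z-nonneg : ∀ v → + 0 ℤ.≤ Z v
    Z-nonneg v = nonneg-+ (sum-nonneg (X-nonneg v)) (nonneg-+ (Y-nonneg v) (Y-nonneg v))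

    ΣX : sumFin (λ v → sumFin (X v)) ≡ Σd - sumFin #low - sumFin #low
    ΣX = trans (sum-cong (λ v → trans (sum-minus (λ w → A v w - low v w) (λ w → low w v)) (cong (_- sumFin (λ w → low w v)) (sum-minus (A v) (low v)))))
      (trans (sum-minus (λ v → d v - #low v) (λ v → sumFin (λ w → low w v))) (cong₂ _-_ (sum-minus d #low) (sum-swap (λ v w → low w v))))

    ΣY : sumFin Y ≡ sumFin #low - (+ n - + 1)
    ΣY = trans (sum-minus #low (λ v → + 1 - ind v ρ)) (cong (_-_ (sumFin #low))
      (trans (sum-minus (λ _ → + 1) (λ v → ind v ρ)) (cong₂ _-_ (trans (sum-const {n} (+ 1)) (ℤP.*-identityʳ (+ n))) (sum-ind1 ρ))))

    ΣZ : sumFin Z ≡ + 0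
    ΣZ = trans (sum-+ (λ v → sumFin (X v)) (λ v → Y v + Y v))
      (trans (cong₂ _+_ ΣX (trans (sum-+ Y Y) (cong₂ _+_ ΣY ΣY)))
      (trans (cong (λ z → (z - sumFin #low - sumFin #low) + ((sumFin #low - (+ n - + 1)) + (sumFin #low - (+ n - + 1)))) edges) (alg (+ n - + 1) (sumFin #low))))
      where
      alg : ∀ m s → (+ 2 * m - s - s) + ((s - m) + (s - m)) ≡ + 0
      alg = solve-∀

    Z≡0 : ∀ v → Z v ≡ + 0
    Z≡0 = sum-nonneg≡0 Z-nonneg ΣZ

    X≡0 : ∀ v w → X v w ≡ + 0
    X≡0 v = sum-nonneg≡0 (X-nonneg v) (proj₁ (nonneg-+≡0 (sum-nonneg (X-nonneg v)) (nonneg-+ (Y-nonneg v) (Y-nonneg v)) (Z≡0 v)))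

    Y≡0 : ∀ v → Y v ≡ + 0
    Y≡0 v = proj₁ (nonneg-+≡0 (Y-nonneg v) (Y-nonneg v) (proj₂ (nonneg-+≡0 (sum-nonneg (X-nonneg v)) (nonneg-+ (Y-nonneg v) (Y-nonneg v)) (Z≡0 v))))

    #low≡ : ∀ v → #low v ≡ + 1 - ind v ρ
    #low≡ v = ℤP.i-j≡0⇒i≡j (#low v) (+ 1 - ind v ρ) (Y≡0 v)

  ranked : Ranked G rank
  ranked = record { levels = lev ; parent! = par }
    where
    lev : ∀ {a b} → adj G a b ≡ true → r a ≢ r b
    lev {a} {b} e ra≡rb = one≢0 (trans (sym X≡1) (X≡0 a b))
      where
      one≢0 : + 1 ≢ + 0
      one≢0 ()
      <ᵇ-irrefl : ∀ m → (m ℕ.<ᵇ m) ≡ false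
      <ᵇ-irrefl zero = refl
      <ᵇ-irrefl (suc m) = <ᵇ-irrefl m
      X≡1 : X a b ≡ + 1
      X≡1 rewrite adj-sym G b a | e | ra≡rb | <ᵇ-irrefl (r b) = refl
    par : ∀ {a a′ b} → adj G a b ≡ true → r a ℕ.< r b → adj G a′ b ≡ true → r a′ ℕ.< r b → a ≡ a′
    par {a} {a′} {b} e lt e′ lt′ = by (a ≟ a′)
      where
      absurd : + 0 ℤ.≤ + 1 - ind b ρ - + 1 - + 1 → a ≡ a′
      absurd le with δ b ρ | le
      ... | true  | ()
      ... | false | ()
      by : Dec (a ≡ a′) → a ≡ a′
      by (yes p) = p
      by (no a≢a′) = absurd (subst (λ z → + 0 ℤ.≤ z - + 1 - + 1) (#low≡ b) (sum≥₂ (low-nonneg b) a≢a′ (low-true e lt) (low-true e′ lt′)))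

  root-lowest : ∀ {w} → adj G w ρ ≡ true → ¬ (r w ℕ.< r ρ)
  root-lowest {w} e lt = one≢0 (trans (sym (low-true e lt)) (sum-nonneg≡0 (low-nonneg ρ) (trans (#low≡ ρ) (cong (_-_ (+ 1)) (ind-refl ρ))) w))
    where
    one≢0 : + 1 ≢ + 0
    one≢0 ()

cospectral-connected : ∀ {n} (G H : Graph n) → (∀ x → lapCharPoly G x ≡ lapCharPoly H x) →
                        Harmonic⇒Constant H → Connected G
cospectral-connected {zero} G H iso hc S closed ()
cospectral-connected {suc n} G H iso hc = cospectral-connected-suc G H iso hc

-- Degrees and leaves of a cospectral graph

connected-neighbour : ∀ {n} (G : Graph n) → Connected G → ∀ v u → u ≢ v → ∃ λ w → adj G v w ≡ true
connected-neighbour G conn v u u≢v with any? (λ w → adj G v w 𝔹≟ true)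
... | yes p = p
... | no none = ⊥-elim (u≢v (δ-true (trans (conn (λ x → δ x v) closed u v) (δ-refl v))))
  where
  isolated : ∀ {a b} → adj G a b ≡ true → δ a v ≡ true → ⊥
  isolated {a} {b} e p with δ-true {i = a} p
  ... | refl = none (b , e)
  closed : ∀ i j → adj G i j ≡ true → δ i v ≡ δ j v
  closed i j e = bool-ext {δ i v} {δ j v} (λ p → ⊥-elim (isolated e p)) (λ p → ⊥-elim (isolated (trans (adj-sym G j i) e) p))

Positive Small : ℤ → Set
Positive z = ∃ λ m → z ≡ + suc m
Small z = ∃ λ m → z ≡ + suc m × m ℕ.< 3

cubic-nonneg : ∀ {z} → Positive z → + 0 ℤ.≤ (z - + 1) * ((z - + 2) * (z - + 3))
cubic-nonneg (0 , refl) = ℤP.≤-refl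
cubic-nonneg (1 , refl) = ℤP.≤-refl
cubic-nonneg (2 , refl) = ℤP.≤-refl
cubic-nonneg (suc (suc (suc m)) , refl) = ℤ.+≤+ z≤n

cubic-root : ∀ {z} → Positive z → (z - + 1) * ((z - + 2) * (z - + 3)) ≡ + 0 → Small z
cubic-root (0 , refl) _ = 0 , refl , s≤s z≤n
cubic-root (1 , refl) _ = 1 , refl , s≤s (s≤s z≤n)
cubic-root (2 , refl) _ = 2 , refl , s≤s (s≤s (s≤s z≤n))
cubic-root (suc (suc (suc m)) , refl) ()

quadratic-nonpos : ∀ {z} → Small z → + 0 ℤ.≤ - ((z - + 1) * (z - + 3))
quadratic-nonpos (0 , refl , _) = ℤP.≤-refl
quadratic-nonpos (1 , refl , _) = ℤ.+≤+ z≤n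
quadratic-nonpos (2 , refl , _) = ℤP.≤-refl
quadratic-nonpos (suc (suc (suc _)) , _ , s≤s (s≤s (s≤s ())))

quadratic-root : ∀ {z} → Small z → - ((z - + 1) * (z - + 3)) ≡ + 0 → z ≡ + 1 ⊎ z ≡ + 3
quadratic-root (0 , refl , _) _ = inj₁ refl
quadratic-root (1 , refl , _) ()
quadratic-root (2 , refl , _) _ = inj₂ refl
quadratic-root (suc (suc (suc _)) , _ , s≤s (s≤s (s≤s ())))

nat : ∀ {z} → + 0 ℤ.≤ z → ∃ λ m → z ≡ + m
nat {+ m} _ = m , refl

-- Choosing distinct indices by sums: subtracting the indicator of an index already chosen makes its
-- value nonpositive, so a positive value found in the difference belongs to a new index.
discard : ∀ {n} {f : Fin n → ℤ} → (∀ x → f x ℤ.≤ + 1) → ∀ x y → + 0 ℤ.< f y - ind y x → y ≢ x × + 0 ℤ.< f y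
discard {f = f} f≤1 x y p = by (y ≟ x)
  where
  by : Dec (y ≡ x) → y ≢ x × + 0 ℤ.< f y
  by (yes refl) = ⊥-elim (ℤP.<⇒≱ p (subst (λ z → f y - z ℤ.≤ + 0) (sym (ind-refl y)) (ℤP.i≤j⇒i-j≤0 (f≤1 y))))
  by (no y≢x) = y≢x , subst (+ 0 ℤ.<_) (trans (cong (_-_ (f y)) (ind-≢ y≢x)) (ℤP.+-identityʳ (f y))) p

discard-≤ : ∀ {n} {f : Fin n → ℤ} → (∀ x → f x ℤ.≤ + 1) → ∀ x y → f y - ind y x ℤ.≤ + 1
discard-≤ {f = f} f≤1 x y with δ y x
... | true = ℤP.≤-trans (ℤP.i-j≤i (f y) (+ 1)) (f≤1 y)
... | false = subst (ℤ._≤ + 1) (sym (ℤP.+-identityʳ (f y))) (f≤1 y)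

module Cospectral {n} (2<n : 2 ℕ.< n) (G H : Graph n) (iso : ∀ x → lapCharPoly G x ≡ lapCharPoly H x)
                  (harmonic-H : Harmonic⇒Constant H) (edges-H : Lap.Σd H ≡ + 2 * (+ n - + 1)) (triangles-H : Lap.triangles H ≡ + 0)
                  (quadratic-H : sumFin (DegreeSums.quadratic H) ≡ + 0) (cubic-H : sumFin (DegreeSums.cubic H) ≡ + 0) where
  module LH = Lap H
  open Lap G
  open Neighbours G

  connected : Connected G
  connected = cospectral-connected G H iso harmonic-H

  private
    traces : tr¹ L ≡ tr¹ LH.L × tr² L ≡ tr² LH.L × tr³ L ≡ tr³ LH.L
    traces = isospectral-traces L LH.L iso

  Σd≡ : Σd ≡ LH.Σd
  Σd≡ = trans (sym tr¹-L) (trans (proj₁ traces) LH.tr¹-L)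

  edges : Σd ≡ + 2 * (+ n - + 1)
  edges = trans Σd≡ edges-H

  private
    cancel : ∀ a b s t → a + s ≡ b + t → s ≡ t → a ≡ b
    cancel a b s .s e refl = trans (alg a s) (trans (cong (_- s) e) (sym (alg b s)))
      where
      alg : ∀ a s → a ≡ a + s - s
      alg = solve-∀

  Σd²≡ : Σd² ≡ LH.Σd²
  Σd²≡ = cancel Σd² LH.Σd² Σd LH.Σd (trans (sym tr²-L) (trans (proj₁ (proj₂ traces)) LH.tr²-L)) Σd≡

  module TreeAt (ρ : Fin n) where
    D : Descent G ρ
    D = Grow.descent G connected ρ
    open Descent D public
    open Tree G D edges public

  private
    ρ₀ : Fin n
    ρ₀ = fromℕ< (ℕP.<-trans (s≤s z≤n) 2<n)

  triangles-G : triangles ≡ + 0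
  triangles-G = triangles≡0 (TreeAt.ranked ρ₀)

  Σd³≡ : Σd³ ≡ LH.Σd³
  Σd³≡ = cancel Σd³ LH.Σd³ (+ 3 * Σd² - triangles) (+ 3 * LH.Σd² - LH.triangles)
    (trans (alg Σd³ (+ 3 * Σd²) triangles) (trans (sym tr³-L) (trans (proj₂ (proj₂ traces)) (trans LH.tr³-L (sym (alg LH.Σd³ (+ 3 * LH.Σd²) LH.triangles))))))
    (cong₂ (λ x y → + 3 * x - y) Σd²≡ (trans triangles-G (sym triangles-H)))
    where
    alg : ∀ a b c → a + (b - c) ≡ a + b - c
    alg = solve-∀

  module DG = DegreeSums G
  module DH = DegreeSums H

  Σquadratic≡0 : sumFin DG.quadratic ≡ + 0
  Σquadratic≡0 = trans DG.Σquadratic (trans (cong₂ (λ x y → x + - (+ 4) * y + + n * + 3) Σd²≡ Σd≡) (trans (sym DH.Σquadratic) quadratic-H))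

  Σcubic≡0 : sumFin DG.cubic ≡ + 0
  Σcubic≡0 = trans DG.Σcubic (trans (cong₂ (λ x y → x + - (+ 6) * y + + 11 * Σd + + n * - (+ 6)) Σd³≡ Σd²≡)
    (trans (cong (λ y → LH.Σd³ + - (+ 6) * LH.Σd² + + 11 * y + + n * - (+ 6)) Σd≡) (trans (sym DH.Σcubic) cubic-H)))

  A-nonneg : ∀ v w → + 0 ℤ.≤ A v w
  A-nonneg v w = b2z-nonneg (adj G v w)

  private
    other : ∀ v → ∃ λ u → u ≢ v
    other v with v ≟ ρ₀
    ... | no v≢ = ρ₀ , (v≢ ∘ sym)
    ... | yes refl = fromℕ< 1<n , λ e → 1≢0 (trans (sym (toℕ-fromℕ< 1<n)) (trans (cong toℕ e) (toℕ-fromℕ< (ℕP.<-trans (s≤s z≤n) 2<n))))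
      where
      1≢0 : 1 ≢ 0
      1≢0 ()
      1<n : 1 ℕ.< n
      1<n = ℕP.<-trans (s≤s (s≤s z≤n)) 2<n

    degree-positive : ∀ v → Positive (d v)
    degree-positive v with nat (sum-nonneg (A-nonneg v))
    ... | suc m , e = m , e
    ... | zero , e with connected-neighbour G connected v (proj₁ (other v)) (proj₂ (other v))
    ... | w , a = ⊥-elim (0≢1 (trans (sym (sum-nonneg≡0 (A-nonneg v) e w)) (A-true a)))
      where
      0≢1 : + 0 ≢ + 1
      0≢1 ()

    degree-small : ∀ v → Small (d v)
    degree-small v = cubic-root (degree-positive v) (sum-nonneg≡0 (λ v → cubic-nonneg (degree-positive v)) Σcubic≡0 v)

  abstract
    degree-1-3 : ∀ v → d v ≡ + 1 ⊎ d v ≡ + 3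
    degree-1-3 v = quadratic-root (degree-small v)
      (sum-nonneg≡0 (λ v → quadratic-nonpos (degree-small v)) (trans (sum-neg DG.quadratic) (cong -_ Σquadratic≡0)) v)

  leaf-only : ∀ {u v w} → d u ≡ + 1 → adj G u v ≡ true → adj G u w ≡ true → w ≡ v
  leaf-only {u} {v} {w} du e e′ = by (w ≟ v)
    where
    absurd : + 0 ℤ.≤ + 1 - + 1 - + 1 → w ≡ v
    absurd ()
    by : Dec (w ≡ v) → w ≡ v
    by (yes p) = p
    by (no w≢v) = absurd (subst (λ z → + 0 ℤ.≤ z - + 1 - + 1) du (sum≥₂ (A-nonneg u) w≢v (A-true e′) (A-true e)))

  1≢3 : + 1 ≢ + 3
  1≢3 ()

  n≢2 : + n ≢ + 2
  n≢2 e = ℕP.<-irrefl (sym (ℤP.+-injective e)) 2<n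

  -- Two adjacent leaves form a component, so all degrees would be 1. The degree sum then gives
  -- 2(n-1) = n, excluded by `2<n`.
  leaves-apart : ∀ {u v} → d u ≡ + 1 → d v ≡ + 1 → adj G u v ≡ true → ⊥
  leaves-apart {u} {v} du dv e = n≢2 (2n-2≡n (trans (sym edges) (trans (sum-cong all-leaves) (trans (sum-const {n} (+ 1)) (ℤP.*-identityʳ (+ n))))))
    where
    2n-2≡n : ∀ {m} → + 2 * (m - + 1) ≡ m → m ≡ + 2
    2n-2≡n {m} e = trans (alg m) (trans (cong (λ z → z - m + + 2) e) (alg₂ m))
      where
      alg : ∀ m → m ≡ + 2 * (m - + 1) - m + + 2
      alg = solve-∀
      alg₂ : ∀ m → m - m + + 2 ≡ + 2
      alg₂ = solve-∀
    S : Fin n → Bool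
    S x = δ x u ∨ δ x v
    into : ∀ {a b} → adj G a b ≡ true → S a ≡ true → S b ≡ true
    into {a} {b} ab Sa with ∨-true {δ a u} Sa
    ... | inj₁ p with δ-true {i = a} p
    ... | refl = trans (cong (δ b u ∨_) (trans (cong (λ z → δ z v) (leaf-only du e ab)) (δ-refl v))) (∨-zeroʳ (δ b u))
    into {a} {b} ab Sa | inj₂ p with δ-true {i = a} p
    ... | refl = cong (_∨ δ b v) (trans (cong (λ z → δ z u) (leaf-only dv (adj-flip e) ab)) (δ-refl u))
    closed : ∀ a b → adj G a b ≡ true → S a ≡ S b
    closed a b ab = bool-ext {S a} {S b} (into ab) (into (adj-flip ab))
    all-leaves : ∀ x → d x ≡ + 1
    all-leaves x with ∨-true {δ x u} (trans (connected S closed x u) (cong (_∨ δ u v) (δ-refl u)))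
    ... | inj₁ p = trans (cong d (δ-true p)) du
    ... | inj₂ p = trans (cong d (δ-true p)) dv

  -- Counting leaf neighbours

  leafy : Fin n → Bool
  leafy v = ⌊ d v ℤ.≟ + 1 ⌋

  ℓ π excess : Fin n → ℤ
  ℓ v = b2z (leafy v)
  π v = sumFin λ w → A v w * ℓ w
  excess v = (+ 1 - ℓ v) * (π v - + 1)

  ℓ-leaf : ∀ {v} → d v ≡ + 1 → ℓ v ≡ + 1
  ℓ-leaf {v} dv = cong b2z (dec-true (d v ℤ.≟ + 1) dv)

  ℓ-inner : ∀ {v} → d v ≡ + 3 → ℓ v ≡ + 0
  ℓ-inner {v} dv with d v ℤ.≟ + 1
  ... | yes e = ⊥-elim (1≢3 (trans (sym e) dv))
  ... | no _ = refl

  -- Each leaf is counted once, by its neighbour, which is internal. The total is thus the number of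
  -- leaves minus the number of internal vertices, and degrees 1 and 3 with degree sum 2(n-1) make
  -- this 2.
  Σexcess : sumFin excess ≡ + 2
  Σexcess = trans (sum-cong (λ v → alg₁ (ℓ v) (π v)))
    (trans (sum-+ (λ v → π v - ℓ v * π v) (λ v → ℓ v - + 1))
    (trans (cong₂ _+_ (trans (sum-minus π (λ v → ℓ v * π v)) (cong₂ _-_ Σπ (sum-zero ℓπ)))
                      (trans (sum-minus ℓ (λ _ → + 1)) (cong (_-_ (sumFin ℓ)) (trans (sum-const {n} (+ 1)) (ℤP.*-identityʳ (+ n))))))
           (alg₂ (sumFin ℓ) (+ n) Σd≡ℓ)))
    where
    alg₁ : ∀ l p → (+ 1 - l) * (p - + 1) ≡ (p - l * p) + (l - + 1)
    alg₁ = solve-∀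
    alg₂ : ∀ s m → + 2 * (m - + 1) ≡ m * + 3 - + 2 * s → (s - + 0) + (s - m) ≡ + 2
    alg₂ s m e = trans (h₁ s m) (trans (cong (λ z → m * + 3 - z - m) (sym e)) (h₂ m))
      where
      h₁ : ∀ s m → (s - + 0) + (s - m) ≡ m * + 3 - (m * + 3 - + 2 * s) - m
      h₁ = solve-∀
      h₂ : ∀ m → m * + 3 - + 2 * (m - + 1) - m ≡ + 2
      h₂ = solve-∀
    dℓ : ∀ v → d v ≡ + 3 - + 2 * ℓ v
    dℓ v with degree-1-3 v
    ... | inj₁ p = trans p (cong (λ z → + 3 - + 2 * z) (sym (ℓ-leaf p)))
    ... | inj₂ p = trans p (cong (λ z → + 3 - + 2 * z) (sym (ℓ-inner p)))
    Σd≡ℓ : + 2 * (+ n - + 1) ≡ + n * + 3 - + 2 * sumFin ℓ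
    Σd≡ℓ = trans (sym edges) (trans (sum-cong dℓ) (trans (sum-minus (λ _ → + 3) (λ v → + 2 * ℓ v)) (cong₂ _-_ (sum-const {n} (+ 3)) (sum-*ˡ (+ 2) ℓ))))
    dℓ≡ℓ : ∀ v → d v * ℓ v ≡ ℓ v
    dℓ≡ℓ v with degree-1-3 v
    ... | inj₁ p = trans (cong (_* ℓ v) p) (ℤP.*-identityˡ (ℓ v))
    ... | inj₂ p = trans (cong (d v *_) (ℓ-inner p)) (trans (ℤP.*-zeroʳ (d v)) (sym (ℓ-inner p)))
    Σπ : sumFin π ≡ sumFin ℓ
    Σπ = trans (sum-swap (λ v w → A v w * ℓ w)) (sum-cong (λ w → trans (sum-*ʳ (ℓ w) (λ v → A v w)) (trans (cong (_* ℓ w) (sum-cong (λ v → A-sym v w))) (dℓ≡ℓ w))))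
    ℓπ : ∀ v → ℓ v * π v ≡ + 0
    ℓπ v with degree-1-3 v
    ... | inj₂ p = cong (_* π v) (ℓ-inner p)
    ... | inj₁ p = trans (cong (ℓ v *_) (sum-zero none)) (ℤP.*-zeroʳ (ℓ v))
      where
      none : ∀ w → A v w * ℓ w ≡ + 0
      none w with degree-1-3 w
      ... | inj₂ q = trans (cong (A v w *_) (ℓ-inner q)) (ℤP.*-zeroʳ (A v w))
      ... | inj₁ q = cong (_* ℓ w) (A-false (leaves-apart p q))

  record LeafPair (v : Fin n) : Set where
    field
      u u′ : Fin n
      u≢u′ : u ≢ u′
      du   : d u ≡ + 1
      du′  : d u′ ≡ + 1
      vu   : adj G v u ≡ true
      vu′  : adj G v u′ ≡ true

  private
    term-pos : ∀ {v w} → + 0 ℤ.< A v w * ℓ w → adj G v w ≡ true × d w ≡ + 1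
    term-pos {v} {w} p = by (adj G v w 𝔹≟ true) (degree-1-3 w)
      where
      zero≮ : ∀ {z} → z ≡ + 0 → + 0 ℤ.< z → ⊥
      zero≮ refl (ℤ.+<+ ())
      by : Dec (adj G v w ≡ true) → d w ≡ + 1 ⊎ d w ≡ + 3 → adj G v w ≡ true × d w ≡ + 1
      by (yes e) (inj₁ q) = e , q
      by (yes e) (inj₂ q) = ⊥-elim (zero≮ (trans (cong (A v w *_) (ℓ-inner q)) (ℤP.*-zeroʳ (A v w))) p)
      by (no ¬e) _ = ⊥-elim (zero≮ (cong (_* ℓ w) (A-false ¬e)) p)

    term≤1 : ∀ v w → A v w * ℓ w ℤ.≤ + 1
    term≤1 v w with adj G v w | leafy w
    ... | true | true = ℤP.≤-refl
    ... | true | false = ℤ.+≤+ z≤n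
    ... | false | _ = ℤ.+≤+ z≤n

    excess-leaf : ∀ {v} → d v ≡ + 1 → excess v ≡ + 0
    excess-leaf {v} dv = cong (λ z → (+ 1 - z) * (π v - + 1)) (ℓ-leaf dv)

    excess-inner : ∀ {v} → d v ≡ + 3 → excess v ≡ π v - + 1
    excess-inner {v} dv = trans (cong (λ z → (+ 1 - z) * (π v - + 1)) (ℓ-inner dv)) (ℤP.*-identityˡ (π v - + 1))

  leafPair : ∀ {v} → + 0 ℤ.< excess v → d v ≡ + 3 × LeafPair v
  leafPair {v} p = by (degree-1-3 v)
    where
    by : d v ≡ + 1 ⊎ d v ≡ + 3 → d v ≡ + 3 × LeafPair v
    by (inj₁ q) = ⊥-elim (ℤP.<-irrefl (sym (excess-leaf q)) p)
    by (inj₂ q) = q , record { u = u ; u′ = u′ ; u≢u′ = proj₁ s ∘ sym ; du = proj₂ t ; du′ = proj₂ t′ ; vu = proj₁ t ; vu′ = proj₁ t′ }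
      where
      f : Fin n → ℤ
      f w = A v w * ℓ w
      p′ : + 0 ℤ.< π v - + 1
      p′ = subst (+ 0 ℤ.<_) (excess-inner q) p
      one : ∃ λ w → + 0 ℤ.< f w
      one = sum-pos (ℤP.<-≤-trans p′ (ℤP.i-j≤i (π v) (+ 1)))
      u = proj₁ one
      t = term-pos {v} {u} (proj₂ one)
      two : ∃ λ w → + 0 ℤ.< f w - ind w u
      two = sum-pos (subst (+ 0 ℤ.<_) (sym (drop-Σ f u)) p′)
      u′ = proj₁ two
      s : u′ ≢ u × + 0 ℤ.< f u′
      s = discard (term≤1 v) u u′ (proj₂ two)
      t′ = term-pos {v} {u′} (proj₂ s)

  pairTwins : ∀ {v} (p : LeafPair v) → TwinLeaves G (LeafPair.u p) (LeafPair.u′ p)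
  pairTwins {v} p = twinLeaves {b = v} u≢u′ du (adj-flip vu) (λ w → leaf-only du (adj-flip vu)) (adj-flip vu′) (λ w → leaf-only du′ (adj-flip vu′))
    where open LeafPair p

  private
    leaf-base : ∀ {a b x y} → d x ≡ + 1 → adj G a x ≡ true → adj G b y ≡ true → a ≢ b → y ≢ x
    leaf-base dx ax by a≢b refl = a≢b (leaf-only dx (adj-flip by) (adj-flip ax))

  start : ∃ λ v → d v ≡ + 3 × LeafPair v
  start = let (v , p) = sum-pos {f = excess} (subst (+ 0 ℤ.<_) (sym Σexcess) (ℤ.+<+ (s≤s z≤n))) in v , leafPair p

  module _ (no-third : ∀ {u u′ v v′ w w′} → TwinLeaves G u u′ → TwinLeaves G v v′ → TwinLeaves G w w′ →
                       v ≢ u → v′ ≢ u → w ≢ u → w′ ≢ u → w ≢ v → w′ ≢ v → ⊥) where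

    module Leafless (v₀ : Fin n) (dv₀ : d v₀ ≡ + 3) (none : ∀ w → adj G v₀ w ≡ true → d w ≢ + 1) where

      π₀ : π v₀ ≡ + 0
      π₀ = sum-zero term
        where
        term : ∀ w → A v₀ w * ℓ w ≡ + 0
        term w = by (degree-1-3 w)
          where
          by : d w ≡ + 1 ⊎ d w ≡ + 3 → A v₀ w * ℓ w ≡ + 0
          by (inj₁ q) = cong (_* ℓ w) (A-false (λ e → none w e q))
          by (inj₂ q) = trans (cong (A v₀ w *_) (ℓ-inner q)) (ℤP.*-zeroʳ (A v₀ w))

      -- The vertex `x` and its leaves are closed under adjacency, so `v₀` would be among them. It
      -- is no leaf, and it is not `x` since it has a neighbour and none of its neighbours is a
      -- leaf.
      all-leaves-absurd : ∀ x → d x ≡ + 3 → (∀ w → adj G x w ≡ true → d w ≡ + 1) → ⊥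
      all-leaves-absurd x dx lv with ∨-true {δ v₀ x} (trans (connected S closed v₀ x) (cong (_∨ adj G x x) (δ-refl x)))
        where
        S : Fin n → Bool
        S y = δ y x ∨ adj G x y
        into : ∀ {a b} → adj G a b ≡ true → S a ≡ true → S b ≡ true
        into {a} {b} ab Sa with ∨-true {δ a x} Sa
        ... | inj₁ p = trans (cong (δ b x ∨_) (trans (cong (λ z → adj G z b) (sym (δ-true {i = a} p))) ab)) (∨-zeroʳ (δ b x))
        ... | inj₂ xa = cong (_∨ adj G x b) (trans (cong (λ z → δ z x) (leaf-only (lv a xa) (adj-flip xa) ab)) (δ-refl x))
        closed : ∀ a b → adj G a b ≡ true → S a ≡ S b
        closed a b ab = bool-ext {S a} {S b} (into ab) (into (adj-flip ab))
      ... | inj₂ xv₀ = 1≢3 (trans (sym (lv v₀ xv₀)) dv₀)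
      ... | inj₁ p with δ-true {i = v₀} p | connected-neighbour G connected v₀ (proj₁ (other v₀)) (proj₂ (other v₀))
      ... | refl | w , e = none w e (lv w e)

      excess≤1 : ∀ x → excess x ℤ.≤ + 1
      excess≤1 x = by (degree-1-3 x)
        where
        -- Indicator of the neighbours that are not leaves. Its sum `d x - π x` is nonzero by
        -- `all-leaves-absurd`, so at an internal vertex `π x` is at most 2.
        nl : Fin n → ℤ
        nl w = A x w * (+ 1 - ℓ w)
        nl-nonneg : ∀ w → + 0 ℤ.≤ nl w
        nl-nonneg w with adj G x w | leafy w
        ... | true | true = ℤP.≤-refl
        ... | true | false = ℤ.+≤+ z≤n
        ... | false | _ = ℤP.≤-refl
        Σnl : sumFin nl ≡ d x - π x
        Σnl = trans (sum-cong (λ w → alg (A x w) (ℓ w))) (sum-minus (A x) (λ w → A x w * ℓ w))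
          where
          alg : ∀ a l → a * (+ 1 - l) ≡ a - a * l
          alg = solve-∀
        leaf : (∀ w → nl w ≡ + 0) → ∀ w → adj G x w ≡ true → d w ≡ + 1
        leaf z w e = sel (degree-1-3 w)
          where
          1≢0 : + 1 ≢ + 0
          1≢0 ()
          sel : d w ≡ + 1 ⊎ d w ≡ + 3 → d w ≡ + 1
          sel (inj₁ q) = q
          sel (inj₂ q) = ⊥-elim (1≢0 (trans (sym (cong₂ (λ a l → a * (+ 1 - l)) (A-true e) (ℓ-inner q))) (z w)))
        bound : ∀ {s p m} → s ≡ + 3 - p → s ≡ + suc m → p - + 1 ℤ.≤ + 1
        bound {s} {p} {m} e e′ = subst (ℤ._≤ + 1) (sym (trans (alg p) (cong (_-_ (+ 2)) (trans (sym e) e′)))) (ℤP.≤-trans (ℤP.≤-reflexive (alg′ (+ m))) (ℤP.i-j≤i (+ 1) (+ m)))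
          where
          alg : ∀ p → p - + 1 ≡ + 2 - (+ 3 - p)
          alg = solve-∀
          alg′ : ∀ m → + 2 - (+ 1 + m) ≡ + 1 - m
          alg′ = solve-∀
        inner : d x ≡ + 3 → (∃ λ m → sumFin nl ≡ + m) → excess x ℤ.≤ + 1
        inner q (zero , e) = ⊥-elim (all-leaves-absurd x q (leaf (sum-nonneg≡0 nl-nonneg e)))
        inner q (suc m , e) = subst (ℤ._≤ + 1) (sym (excess-inner q)) (bound {sumFin nl} {π x} {m} (trans Σnl (cong (_- π x) q)) e)
        by : d x ≡ + 1 ⊎ d x ≡ + 3 → excess x ℤ.≤ + 1
        by (inj₁ q) = subst (ℤ._≤ + 1) (sym (excess-leaf q)) (ℤ.+≤+ z≤n)
        by (inj₂ q) = inner q (nat (sum-nonneg nl-nonneg))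

      f₁ f₂ f₃ : Fin n → ℤ

      -- The indicator cancels the contribution -1 of `v₀`. The sum becomes 3 while no value exceeds
      -- 1, so three distinct vertices with positive excess can be picked.
      f₁ x = excess x + ind x v₀

      f₁-v₀ : f₁ v₀ ≡ + 0
      f₁-v₀ = cong₂ _+_ (trans (excess-inner dv₀) (cong (_- + 1) π₀)) (ind-refl v₀)

      f₁-off : ∀ {x} → x ≢ v₀ → f₁ x ≡ excess x
      f₁-off {x} ne = trans (cong (_+_ (excess x)) (ind-≢ ne)) (ℤP.+-identityʳ (excess x))

      f₁≤1 : ∀ x → f₁ x ℤ.≤ + 1
      f₁≤1 x = by (x ≟ v₀)
        where
        by : Dec (x ≡ v₀) → f₁ x ℤ.≤ + 1
        by (yes refl) = subst (ℤ._≤ + 1) (sym f₁-v₀) (ℤ.+≤+ z≤n)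
        by (no ne) = subst (ℤ._≤ + 1) (sym (f₁-off ne)) (excess≤1 x)

      f₁-pos : ∀ {x} → + 0 ℤ.< f₁ x → + 0 ℤ.< excess x
      f₁-pos {x} p = by (x ≟ v₀)
        where
        by : Dec (x ≡ v₀) → + 0 ℤ.< excess x
        by (yes refl) = ⊥-elim (ℤP.<-irrefl (sym f₁-v₀) p)
        by (no ne) = subst (+ 0 ℤ.<_) (f₁-off ne) p

      Σf₁ : sumFin f₁ ≡ + 3
      Σf₁ = trans (sum-+ excess (λ x → ind x v₀)) (cong₂ _+_ Σexcess (sum-ind1 v₀))

      pick₁ : ∃ λ x → + 0 ℤ.< f₁ x
      pick₁ = sum-pos {f = f₁} (subst (+ 0 ℤ.<_) (sym Σf₁) (ℤ.+<+ (s≤s z≤n)))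

      f₂ x = f₁ x - ind x (proj₁ pick₁)

      Σf₂ : sumFin f₂ ≡ + 2
      Σf₂ = trans (drop-Σ f₁ (proj₁ pick₁)) (cong (_- + 1) Σf₁)

      pick₂ : ∃ λ x → + 0 ℤ.< f₂ x
      pick₂ = sum-pos {f = f₂} (subst (+ 0 ℤ.<_) (sym Σf₂) (ℤ.+<+ (s≤s z≤n)))

      f₂≤1 : ∀ x → f₂ x ℤ.≤ + 1
      f₂≤1 = discard-≤ f₁≤1 (proj₁ pick₁)

      f₃ x = f₂ x - ind x (proj₁ pick₂)

      pick₃ : ∃ λ x → + 0 ℤ.< f₃ x
      pick₃ = sum-pos {f = f₃} (subst (+ 0 ℤ.<_) (sym (trans (drop-Σ f₂ (proj₁ pick₂)) (cong (_- + 1) Σf₂))) (ℤ.+<+ (s≤s z≤n)))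

      absurd : ⊥
      absurd = conclude (proj₂ (leafPair (f₁-pos (proj₂ pick₁)))) (proj₂ (leafPair (f₁-pos (proj₂ two)))) (proj₂ (leafPair (f₁-pos (proj₂ three₁))))
                        (proj₁ two) (proj₁ three₁) (proj₁ three)
        where
        two : proj₁ pick₂ ≢ proj₁ pick₁ × + 0 ℤ.< f₁ (proj₁ pick₂)
        two = discard f₁≤1 (proj₁ pick₁) (proj₁ pick₂) (proj₂ pick₂)
        three : proj₁ pick₃ ≢ proj₁ pick₂ × + 0 ℤ.< f₂ (proj₁ pick₃)
        three = discard f₂≤1 (proj₁ pick₂) (proj₁ pick₃) (proj₂ pick₃)
        three₁ : proj₁ pick₃ ≢ proj₁ pick₁ × + 0 ℤ.< f₁ (proj₁ pick₃)
        three₁ = discard f₁≤1 (proj₁ pick₁) (proj₁ pick₃) (proj₂ three)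
        conclude : ∀ {a b c} → LeafPair a → LeafPair b → LeafPair c → b ≢ a → c ≢ a → c ≢ b → ⊥
        conclude p q r b≢a c≢a c≢b = no-third (pairTwins p) (pairTwins q) (pairTwins r)
            (leaf-base P.du P.vu Q.vu (b≢a ∘ sym)) (leaf-base P.du P.vu Q.vu′ (b≢a ∘ sym))
            (leaf-base P.du P.vu R.vu (c≢a ∘ sym)) (leaf-base P.du P.vu R.vu′ (c≢a ∘ sym))
            (leaf-base Q.du Q.vu R.vu (c≢b ∘ sym)) (leaf-base Q.du Q.vu R.vu′ (c≢b ∘ sym))
          where
          module P = LeafPair p
          module Q = LeafPair q
          module R = LeafPair r

    abstract
      has-leaf : ∀ v → d v ≡ + 3 → ∃ λ w → adj G v w ≡ true × d w ≡ + 1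
      has-leaf v dv with any? (λ w → (adj G v w 𝔹≟ true) ×-dec (d w ℤ.≟ + 1))
      ... | yes p = p
      ... | no none = ⊥-elim (Leafless.absurd v dv (λ w e q → none (w , e , q)))

-- Reconstructing the centipede

-- The tree is rooted at one leaf `ρ` of a vertex `v₁` with two leaves. The second leaf `u₁` lies
-- below `v₁`, so every internal vertex, `v₁` included, has a leaf among its children.
module Spine {n} (G : Graph n) {ρ v₁ u₁ : Fin n} (D : Descent G ρ) (ranked : Ranked G (Descent.rank D))
  (root-lowest : ∀ {w} → adj G w ρ ≡ true → ¬ (Descent.rank D w ℕ.< Descent.rank D ρ))
  (degree-1-3 : ∀ v → degree G v ≡ + 1 ⊎ degree G v ≡ + 3)
  (leaf-only : ∀ {u v w} → degree G u ≡ + 1 → adj G u v ≡ true → adj G u w ≡ true → w ≡ v)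
  (has-leaf : ∀ v → degree G v ≡ + 3 → ∃ λ w → adj G v w ≡ true × degree G w ≡ + 1)
  (dρ : degree G ρ ≡ + 1) (dv₁ : degree G v₁ ≡ + 3) (v₁ρ : adj G v₁ ρ ≡ true)
  (u₁≢ρ : u₁ ≢ ρ) (du₁ : degree G u₁ ≡ + 1) (v₁u₁ : adj G v₁ u₁ ≡ true)
  where
  open Descent D renaming (rank to r)
  open Ranked ranked
  open Lap G
  open Neighbours G

  Child : Fin n → Fin n → Set
  Child v w = adj G v w ≡ true × r v ℕ.< r w

  private
    1≢3 : + 1 ≢ + 3
    1≢3 ()

  inner≢root : ∀ {v} → d v ≡ + 3 → v ≢ ρ
  inner≢root dv refl = 1≢3 (trans (sym dρ) dv)

  up-or-down : ∀ {v w} → adj G v w ≡ true → Child v w ⊎ Child w v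
  up-or-down {v} {w} e with ℕP.<-cmp (r v) (r w)
  ... | tri< lt _ _ = inj₁ (e , lt)
  ... | tri≈ _ eq _ = ⊥-elim (levels e eq)
  ... | tri> _ _ gt = inj₂ (adj-flip e , gt)

  root-child : Child ρ v₁
  root-child with up-or-down (adj-flip v₁ρ)
  ... | inj₁ c = c
  ... | inj₂ (e , lt) = ⊥-elim (root-lowest e lt)

  -- At `v₁` the leaf given by `has-leaf` could be the root, hence `u₁` is taken. Elsewhere a leaf
  -- above `v` is either the root, forcing `v ≡ v₁`, or has a lower neighbour of its own besides the
  -- higher neighbour `v`.
  leaf-child : ∀ v → d v ≡ + 3 → ∃ λ x → Child v x × d x ≡ + 1
  leaf-child v dv with v ≟ v₁
  ... | yes refl with up-or-down v₁u₁
  ...   | inj₁ c = u₁ , c , du₁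
  ...   | inj₂ (e , lt) = ⊥-elim (u₁≢ρ (parent! e lt (proj₁ root-child) (proj₂ root-child)))
  leaf-child v dv | no v≢v₁ with has-leaf v dv
  ... | x , e , dx with up-or-down e
  ...   | inj₁ c = x , c , dx
  ...   | inj₂ (e′ , lt) with x ≟ ρ
  ...     | yes refl = ⊥-elim (v≢v₁ (leaf-only dρ (adj-flip v₁ρ) e′))
  ...     | no x≢ρ with lower x x≢ρ
  ...       | w , wx , w<x with leaf-only dx (adj-flip wx) e′
  ...         | refl = ⊥-elim (ℕP.<-asym lt w<x)

  record Children (v x y : Fin n) : Set where
    field
      child-x  : Child v x
      leaf-x   : d x ≡ + 1
      child-y  : Child v y
      x≢y      : x ≢ y
      complete : ∀ w → Child v w → w ≡ x ⊎ w ≡ y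

  module _ (v : Fin n) (dv : d v ≡ + 3) where
    private
      p = proj₁ (lower v (inner≢root dv))
      pv : Child p v
      pv = proj₂ (lower v (inner≢root dv))
      x = proj₁ (leaf-child v dv)
      vx : Child v x
      vx = proj₁ (proj₂ (leaf-child v dv))

      p≢child : ∀ {w} → Child v w → p ≢ w
      p≢child (_ , lt) refl = ℕP.<-asym lt (proj₂ pv)

      -- `g` is the neighbour indicator with the parent `p` and the leaf child `x` removed. Its sum
      -- 3-1-1 = 1 yields the second child and also shows that there is no third.
      f g : Fin n → ℤ
      f w = A v w - ind w p
      g w = f w - ind w x

      A≤1 : ∀ w → A v w ℤ.≤ + 1
      A≤1 w with adj G v w
      ... | true = ℤP.≤-refl
      ... | false = ℤ.+≤+ z≤n

      Σf : sumFin f ≡ + 2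
      Σf = trans (drop-Σ (A v) p) (cong (_- + 1) dv)

      Σg : sumFin g ≡ + 1
      Σg = trans (drop-Σ f x) (cong (_- + 1) Σf)

      pick : ∃ λ y → + 0 ℤ.< g y
      pick = sum-pos {f = g} (subst (+ 0 ℤ.<_) (sym Σg) (ℤ.+<+ (s≤s z≤n)))

      y = proj₁ pick
      y≢x×f : y ≢ x × + 0 ℤ.< f y
      y≢x×f = discard (discard-≤ A≤1 p) x y (proj₂ pick)
      y≢p×A : y ≢ p × + 0 ℤ.< A v y
      y≢p×A = discard A≤1 p y (proj₂ y≢x×f)
      adj-pos : ∀ w → + 0 ℤ.< A v w → adj G v w ≡ true
      adj-pos w lt with adj G v w | lt
      ... | true | _ = refl
      ... | false | ℤ.+<+ ()
      vy : Child v y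
      vy with up-or-down (adj-pos y (proj₂ y≢p×A))
      ... | inj₁ c = c
      ... | inj₂ (e , lt) = ⊥-elim (proj₁ y≢p×A (parent! e lt (proj₁ pv) (proj₂ pv)))

      drop : ∀ {h : Fin n → ℤ} {a w} → h w ≡ + 1 → w ≢ a → h w - ind w a ≡ + 1
      drop hw w≢a = cong₂ _-_ hw (ind-≢ w≢a)

      f-nonneg : ∀ w → + 0 ℤ.≤ f w
      f-nonneg = drop-nonneg {f = A v} (λ w → b2z-nonneg (adj G v w)) {p} (A-true (adj-flip (proj₁ pv)))

      g-nonneg : ∀ w → + 0 ℤ.≤ g w
      g-nonneg = drop-nonneg {f = f} f-nonneg {x} (drop {A v} {p} {x} (A-true (proj₁ vx)) (p≢child vx ∘ sym))

      only-xy : ∀ w → Child v w → w ≡ x ⊎ w ≡ y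
      only-xy w c = by (w ≟ x) (w ≟ y)
        where
        g≡1 : w ≢ x → g w ≡ + 1
        g≡1 w≢x = drop {f} {x} {w} (drop {A v} {p} {w} (A-true (proj₁ c)) (p≢child c ∘ sym)) w≢x
        gy≡1 : g y ≡ + 1
        gy≡1 = drop {f} {x} {y} (drop {A v} {p} {y} (A-true (proj₁ vy)) (p≢child vy ∘ sym)) (proj₁ y≢x×f)
        absurd : + 0 ℤ.≤ + 1 - + 1 - + 1 → w ≡ x ⊎ w ≡ y
        absurd ()
        by : Dec (w ≡ x) → Dec (w ≡ y) → w ≡ x ⊎ w ≡ y
        by (yes q) _ = inj₁ q
        by (no _) (yes q) = inj₂ q
        by (no w≢x) (no w≢y) = absurd (subst (λ z → + 0 ℤ.≤ z - + 1 - + 1) Σg (sum≥₂ g-nonneg w≢y (g≡1 w≢x) gy≡1))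

    abstract
      children : ∃₂ λ x y → Children v x y
      children = x , y , record
        { child-x = vx
        ; leaf-x = proj₂ (proj₂ (leaf-child v dv))
        ; child-y = vy
        ; x≢y = proj₁ y≢x×f ∘ sym
        ; complete = only-xy
        }

  -- The first component is the pendant leaf at v, the second the next spine vertex; at leaves both are junk.
  step : ∀ v → d v ≡ + 1 ⊎ d v ≡ + 3 → Fin n × Fin n
  step v (inj₁ _) = v , v
  step v (inj₂ dv) = let (x , y , _) = children v dv in x , y

  hanging next : Fin n → Fin n
  hanging v = proj₁ (step v (degree-1-3 v))
  next v = proj₂ (step v (degree-1-3 v))

  children-step : ∀ v → d v ≡ + 3 → Children v (hanging v) (next v)
  children-step v dv = by (degree-1-3 v)
    where
    by : (c : d v ≡ + 1 ⊎ d v ≡ + 3) → Children v (proj₁ (step v c)) (proj₂ (step v c))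
    by (inj₁ q) = ⊥-elim (1≢3 (trans (sym q) dv))
    by (inj₂ q) = proj₂ (proj₂ (children v q))

  spine : ℕ → Fin n
  spine 0 = ρ
  spine 1 = v₁
  spine (suc (suc i)) = next (spine (suc i))

  pendant : ℕ → Fin n
  pendant u = hanging (spine (suc u))

  InnerBelow : ℕ → Set
  InnerBelow j = ∀ u → u ℕ.< j → d (spine (suc u)) ≡ + 3

  -- Ranks increase strictly along the spine, so `t` bounds the rank of `spine (suc t)` from below
  -- while `height` bounds it from above; a leaf must be met before the fuel is spent.
  search : ∀ fuel t → fuel ℕ.+ t ≡ height → t ℕ.≤ r (spine (suc t)) → InnerBelow t →
           ∃ λ j → InnerBelow j × d (spine (suc j)) ≡ + 1
  search fuel t eq t≤ inn = by fuel eq (degree-1-3 (spine (suc t)))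
    where
    by : ∀ fuel → fuel ℕ.+ t ≡ height → d (spine (suc t)) ≡ + 1 ⊎ d (spine (suc t)) ≡ + 3 →
         ∃ λ j → InnerBelow j × d (spine (suc j)) ≡ + 1
    by _ _ (inj₁ q) = t , inn , q
    by zero e _ = ⊥-elim (ℕP.<⇒≱ (rank< (spine (suc t))) (subst (ℕ._≤ r (spine (suc t))) e t≤))
    by (suc fuel) e (inj₂ q) = search fuel (suc t) (trans (ℕP.+-suc fuel t) e)
        (ℕP.≤-<-trans t≤ (proj₂ (Children.child-y (children-step (spine (suc t)) q)))) inn⁺
      where
      inn⁺ : InnerBelow (suc t)
      inn⁺ u (s≤s u≤t) with ℕP.m≤n⇒m<n∨m≡n u≤t
      ... | inj₁ u<t = inn u u<t
      ... | inj₂ refl = q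

  module Labelled (j : ℕ) (inner : InnerBelow j) (end : d (spine (suc j)) ≡ + 1) where
    module Cent = Centipede j
    open Cent using (C; pathV; pendV; toℕ-path; toℕ-pend; Edge; hang; kind; first; last; pend)

    N : ℕ
    N = Cent.n

    kids : ∀ u → u ℕ.< j → Children (spine (suc u)) (pendant u) (spine (suc (suc u)))
    kids u u<j = children-step (spine (suc u)) (inner u u<j)

    spine-child : ∀ i → i ℕ.≤ j → Child (spine i) (spine (suc i))
    spine-child zero _ = root-child
    spine-child (suc u) u<j = Children.child-y (kids u u<j)

    spine-mono : ∀ i i′ → i ℕ.< i′ → i′ ℕ.≤ suc j → r (spine i) ℕ.< r (spine i′)
    spine-mono i (suc i′) (s≤s i≤i′) (s≤s i′≤j) with ℕP.m≤n⇒m<n∨m≡n i≤i′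
    ... | inj₁ i<i′ = ℕP.<-trans (spine-mono i i′ i<i′ (ℕP.m≤n⇒m≤1+n i′≤j)) (proj₂ (spine-child i′ i′≤j))
    ... | inj₂ refl = proj₂ (spine-child i′ i′≤j)

    spine-inj : ∀ i i′ → i ℕ.≤ suc j → i′ ℕ.≤ suc j → spine i ≡ spine i′ → i ≡ i′
    spine-inj i i′ i≤ i′≤ e with ℕP.<-cmp i i′
    ... | tri< lt _ _ = ⊥-elim (ℕP.<-irrefl (cong r e) (spine-mono i i′ lt i′≤))
    ... | tri≈ _ eq _ = eq
    ... | tri> _ _ gt = ⊥-elim (ℕP.<-irrefl (cong r (sym e)) (spine-mono i′ i gt i≤))

    parent-unique : ∀ {a a′ b b′} → Child a b → Child a′ b′ → b ≡ b′ → a ≡ a′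
    parent-unique (e , lt) (e′ , lt′) refl = parent! e lt e′ lt′

    pendant-inj : ∀ u u′ → u ℕ.< j → u′ ℕ.< j → pendant u ≡ pendant u′ → u ≡ u′
    pendant-inj u u′ u<j u′<j e = ℕP.suc-injective (spine-inj (suc u) (suc u′) (ℕP.m<n⇒m<1+n u<j) (ℕP.m<n⇒m<1+n u′<j)
      (parent-unique (Children.child-x (kids u u<j)) (Children.child-x (kids u′ u′<j)) e))

    spine≢pendant : ∀ i u → i ℕ.≤ suc j → u ℕ.< j → spine i ≢ pendant u
    spine≢pendant zero u _ u<j e = root-lowest (trans (cong (adj G (spine (suc u))) e) (proj₁ c)) (subst (λ z → r (spine (suc u)) ℕ.< r z) (sym e) (proj₂ c))
      where c = Children.child-x (kids u u<j)
    spine≢pendant (suc i) u (s≤s i≤j) u<j e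
      with spine-inj i (suc u) (ℕP.m≤n⇒m≤1+n i≤j) (ℕP.m<n⇒m<1+n u<j) (parent-unique (spine-child i i≤j) (Children.child-x (kids u u<j)) e)
    ... | refl = Children.x≢y (kids u u<j) (sym e)

    label : ℕ → Fin n
    label a with a ℕP.≤? suc j
    ... | yes _ = spine a
    ... | no _ = pendant (a ℕ.∸ suc (suc j))

    label-path : ∀ {a} → a ℕ.≤ suc j → label a ≡ spine a
    label-path {a} a≤ with a ℕP.≤? suc j
    ... | yes _ = refl
    ... | no a≰ = ⊥-elim (a≰ a≤)

    label-pend : ∀ u → label (suc j ℕ.+ suc u) ≡ pendant u
    label-pend u with suc j ℕ.+ suc u ℕP.≤? suc j
    ... | yes a≤ = ⊥-elim (ℕP.m+1+n≰m (suc j) a≤)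
    ... | no _ = cong pendant (trans (cong (ℕ._∸ suc j) (ℕP.+-suc j u)) (ℕP.m+n∸m≡n (suc j) u))

    f : Fin N → Fin n
    f a = label (toℕ a)

    f-path : ∀ i (i≤ : i ℕ.≤ suc j) → f (pathV i i≤) ≡ spine i
    f-path i i≤ = trans (cong label (toℕ-path i i≤)) (label-path i≤)

    f-pend : ∀ u (u<j : u ℕ.< j) → f (pendV u u<j) ≡ pendant u
    f-pend u u<j = trans (cong label (toℕ-pend u u<j)) (label-pend u)

    data PathOrPend (a : Fin N) : Set where
      isPath : ∀ i (i≤ : i ℕ.≤ suc j) → a ≡ pathV i i≤ → PathOrPend a
      isPend : ∀ u (u<j : u ℕ.< j) → a ≡ pendV u u<j → PathOrPend a

    pathOrPend : ∀ a → PathOrPend a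
    pathOrPend a with kind a
    ... | first e = isPath 0 z≤n e
    ... | Cent.inner u u<j e = isPath (suc u) (s≤s (ℕP.<⇒≤ u<j)) e
    ... | last e = isPath (suc j) ℕP.≤-refl e
    ... | pend u u<j e = isPend u u<j e

    f-injective : ∀ {a b} → f a ≡ f b → a ≡ b
    f-injective {a} {b} e = by (pathOrPend a) (pathOrPend b)
      where
      link : ∀ {a′ b′ x y} → a ≡ a′ → b ≡ b′ → f a′ ≡ x → f b′ ≡ y → x ≡ y
      link refl refl ex ey = trans (sym ex) (trans e ey)
      by : PathOrPend a → PathOrPend b → a ≡ b
      by (isPath i i≤ ea) (isPath i′ i′≤ eb) with spine-inj i i′ i≤ i′≤ (link ea eb (f-path i i≤) (f-path i′ i′≤))
      ... | refl = trans ea (sym eb)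
      by (isPend u u<j ea) (isPend u′ u′<j eb) with pendant-inj u u′ u<j u′<j (link ea eb (f-pend u u<j) (f-pend u′ u′<j))
      ... | refl = trans ea (sym eb)
      by (isPath i i≤ ea) (isPend u u<j eb) = ⊥-elim (spine≢pendant i u i≤ u<j (link ea eb (f-path i i≤) (f-pend u u<j)))
      by (isPend u u<j ea) (isPath i i≤ eb) = ⊥-elim (spine≢pendant i u i≤ u<j (sym (link ea eb (f-pend u u<j) (f-path i i≤))))

    leaf-childless : ∀ {p w v} → d w ≡ + 1 → Child p w → Child w v → ⊥
    leaf-childless dw (pw , p<w) (wv , w<v) with leaf-only dw (adj-flip pw) wv
    ... | refl = ℕP.<-asym p<w w<v

    -- Induction on rank: the lower neighbour of `v` is already labelled. If it is internal, both of
    -- its children carry labels; if it is the root, `v` is `v₁`; any other leaf has no children.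
    f-surjective : ∀ v → ∃ λ a → f a ≡ v
    f-surjective v = go (suc (r v)) v (ℕP.n<1+n (r v))
      where
      go : ∀ m v → r v ℕ.< m → ∃ λ a → f a ≡ v
      go (suc m) v (s≤s v≤m) = root? (v ≟ ρ)
        where
        below : ∀ {w} → Child w v → ∀ {a} → f a ≡ w → Cent.Kind a → ∃ λ a → f a ≡ v
        below {w} c ea (first refl) with trans (sym ea) (f-path 0 z≤n)
        ... | refl = pathV 1 (s≤s z≤n) , trans (f-path 1 (s≤s z≤n)) (sym (leaf-only dρ (adj-flip v₁ρ) (proj₁ c)))
        below {w} c ea (Cent.inner u u<j refl) with trans (sym ea) (f-path (suc u) (s≤s (ℕP.<⇒≤ u<j)))
        ... | refl with Children.complete (kids u u<j) v c
        ... | inj₁ q = pendV u u<j , trans (f-pend u u<j) (sym q)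
        ... | inj₂ q = pathV (suc (suc u)) (s≤s u<j) , trans (f-path (suc (suc u)) (s≤s u<j)) (sym q)
        below {w} c ea (last refl) with trans (sym ea) (f-path (suc j) ℕP.≤-refl)
        ... | refl = ⊥-elim (leaf-childless end (spine-child j ℕP.≤-refl) c)
        below {w} c ea (pend u u<j refl) with trans (sym ea) (f-pend u u<j)
        ... | refl = ⊥-elim (leaf-childless (Children.leaf-x (kids u u<j)) (Children.child-x (kids u u<j)) c)
        root? : Dec (v ≡ ρ) → ∃ λ a → f a ≡ v
        root? (yes refl) = pathV 0 z≤n , f-path 0 z≤n
        root? (no v≢ρ) with lower v v≢ρ
        ... | w , wv , w<v with go m w (ℕP.<-≤-trans w<v v≤m)
        ... | a , ea = below (wv , w<v) ea (kind a)

    edge-child : ∀ {x y} → Edge x y → Child (label x) (label y)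
    edge-child {x} (Cent.step refl (s≤s (s≤s x≤j))) = subst₂ Child (sym (label-path (ℕP.m≤n⇒m≤1+n x≤j))) (sym (label-path (s≤s x≤j))) (spine-child x x≤j)
    edge-child {suc u} (hang (s≤s z≤n) u<j refl) = subst₂ Child (sym (label-path (ℕP.m≤n⇒m≤1+n u<j))) (sym (label-pend u)) (Children.child-x (kids u u<j))

    -- By uniqueness of parents: the centipede's own parent of `b` is mapped to a parent of `f b`,
    -- which must be `f a`, and `f` is injective.
    child-edge : ∀ {a b} → Child (f a) (f b) → Edge (toℕ a) (toℕ b)
    child-edge {a} {b} c = by (pathOrPend b)
      where
      via : ∀ a′ → Edge (toℕ a′) (toℕ b) → Edge (toℕ a) (toℕ b)
      via a′ e = subst (λ z → Edge (toℕ z) (toℕ b)) (f-injective (parent-unique (edge-child e) c refl)) e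
      by : PathOrPend b → Edge (toℕ a) (toℕ b)
      by (isPath zero i≤ refl) = ⊥-elim (root-lowest (subst (λ z → adj G (f a) z ≡ true) (f-path 0 z≤n) (proj₁ c)) (subst (λ z → r (f a) ℕ.< r z) (f-path 0 z≤n) (proj₂ c)))
      by (isPath (suc i) (s≤s i≤j) refl) = via (pathV i (ℕP.m≤n⇒m≤1+n i≤j))
        (subst₂ Edge (sym (toℕ-path i (ℕP.m≤n⇒m≤1+n i≤j))) (sym (toℕ-path (suc i) (s≤s i≤j))) (Cent.step refl (s≤s (s≤s i≤j))))
      by (isPend u u<j refl) = via (pathV (suc u) (ℕP.m≤n⇒m≤1+n u<j))
        (subst₂ Edge (sym (toℕ-path (suc u) (ℕP.m≤n⇒m≤1+n u<j))) (sym (toℕ-pend u u<j)) (hang (s≤s z≤n) u<j refl))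

    adj-f : ∀ a b → adj C a b ≡ adj G (f a) (f b)
    adj-f a b = bool-ext {adj C a b} {adj G (f a) (f b)} forth back
      where
      forth : adj C a b ≡ true → adj G (f a) (f b) ≡ true
      forth e with Cent.adj-sound {a} {b} e
      ... | inj₁ p = proj₁ (edge-child p)
      ... | inj₂ p = adj-flip (proj₁ (edge-child p))
      back : adj G (f a) (f b) ≡ true → adj C a b ≡ true
      back e with up-or-down e
      ... | inj₁ c = Cent.adj-complete {a} {b} (child-edge {a} {b} c)
      ... | inj₂ c = trans (adj-sym C a b) (Cent.adj-complete {b} {a} (child-edge {b} {a} c))

    g : Fin n → Fin N
    g v = proj₁ (f-surjective v)

    fg : ∀ v → f (g v) ≡ v
    fg v = proj₂ (f-surjective v)

    size : n ≡ N
    size = cantor-schröder-bernstein {f = g} {g = f} (λ {x} {y} e → trans (sym (fg x)) (trans (cong f e) (fg y))) f-injective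

    G≅C : G ≅ centipede (suc (suc j))
    G≅C = mk↔ₛ′ g f (λ a → f-injective (fg (f a))) fg ,
          λ v w → trans (cong₂ (adj G) (sym (fg v)) (sym (fg w))) (sym (adj-f (g v) (g w)))

  isCentipede : ∃ λ j → n ≡ Centipede.n j × G ≅ centipede (suc (suc j))
  isCentipede with search height 0 (ℕP.+-identityʳ height) z≤n (λ u ())
  ... | j , inner , end = j , Labelled.size j inner end , Labelled.G≅C j inner end

-- The single edge, and assembly of the remaining cases

centipede₂ : (G : Graph 2) → Connected G → G ≅ centipede 2
centipede₂ G conn = mk↔ₛ′ (λ v → v) (λ v → v) (λ _ → refl) (λ _ → refl) , same
  where
  edge₀₁ : adj G zero (suc zero) ≡ true
  edge₀₁ with connected-neighbour G conn zero (suc zero) (λ ())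
  ... | zero , e = ⊥-elim (Neighbours.adj-≢ G e refl)
  ... | suc zero , e = e
  same : ∀ v w → adj G v w ≡ adj (centipede 2) v w
  same zero zero = adj-irrefl G zero
  same zero (suc zero) = edge₀₁
  same (suc zero) zero = trans (adj-sym G (suc zero) zero) edge₀₁
  same (suc zero) (suc zero) = adj-irrefl G (suc zero)

double-injective : ∀ a b → suc a ℕ.+ suc a ≡ suc b ℕ.+ suc b → a ≡ b
double-injective a b e with ℕP.<-cmp a b
... | tri< lt _ _ = ⊥-elim (ℕP.<-irrefl e (ℕP.+-mono-< (s≤s lt) (s≤s lt)))
... | tri≈ _ eq _ = eq
... | tri> _ _ gt = ⊥-elim (ℕP.<-irrefl (sym e) (ℕP.+-mono-< (s≤s gt) (s≤s gt)))

centipede₃₊ : ∀ i (G : Graph (Centipede.n (suc i))) → (∀ x → lapCharPoly G x ≡ lapCharPoly (centipede (3 ℕ.+ i)) x) →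
              G ≅ centipede (3 ℕ.+ i)
centipede₃₊ i G iso = finish (Spine.isCentipede G D ranked root-lowest degree-1-3 leaf-only (has-leaf no-third)
                               du (proj₁ (proj₂ start)) vu (u≢u′ ∘ sym) du′ vu′)
  where
  module Cent = Centipede (suc i)
  2<n : 2 ℕ.< Cent.n
  2<n = subst (2 ℕ.<_) (sym Cent.n≡) (s≤s (s≤s (ℕP.≤-trans (s≤s z≤n) (ℕP.m≤n+m (suc (suc i)) i))))
  open Cospectral 2<n G Cent.C iso Cent.harmonic⇒constant Cent.Σd≡ (triangles≡0 Cent.ranked) Cent.Σquadratic≡0 Cent.Σcubic≡0
  open LeafPair (proj₂ (proj₂ start))
  open TreeAt u using (D; ranked; root-lowest)
  module T = CentipedeTwins i
  no-third : ∀ {u u′ v v′ w w′} → TwinLeaves G u u′ → TwinLeaves G v v′ → TwinLeaves G w w′ →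
             v ≢ u → v′ ≢ u → w ≢ u → w′ ≢ u → w ≢ v → w′ ≢ v → ⊥
  no-third = no-third-twins G Cent.C iso T.firstTwins T.lastTwins T.pₗ≢p₀ T.qₗ≢p₀ (residual-nonsingular i)
  finish : (∃ λ j → Cent.n ≡ Centipede.n j × G ≅ centipede (suc (suc j))) → G ≅ centipede (3 ℕ.+ i)
  -- The search along the spine returns a length of its own; equality of the vertex counts 2j+2
  -- identifies it with `suc i`.
  finish (j , e , G≅) = subst (λ j → G ≅ centipede (suc (suc j)))
    (sym (double-injective (suc i) j (trans (sym Cent.n≡) (trans e (Centipede.n≡ j))))) G≅

theorem5 : (k : ℕ) → 2 ≤ k → (m : ℕ) → (G : Graph m) →
    (∀ (x : ℤ) → lapCharPoly G x ≡ lapCharPoly (centipede k) x) →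
    G ≅ centipede k
theorem5 (suc (suc j)) (s≤s (s≤s z≤n)) m G iso = sized j size G iso
  where
  size : m ≡ Centipede.n j
  size = ℕP.≤-antisym (isospectral-≤ (laplacian (centipede (suc (suc j)))) (laplacian G) (λ x → sym (iso x)))
                      (isospectral-≤ (laplacian G) (laplacian (centipede (suc (suc j)))) iso)
  sized : ∀ j {m} → m ≡ Centipede.n j → (G : Graph m) → (∀ x → lapCharPoly G x ≡ lapCharPoly (centipede (suc (suc j))) x) →
          G ≅ centipede (suc (suc j))
  -- For `k ≡ 2` there are no internal vertices and the two leaves are adjacent, so connectedness
  -- alone has to decide.
  sized zero refl G iso = centipede₂ G (cospectral-connected G (centipede 2) iso (Centipede.harmonic⇒constant 0))
  sized (suc i) refl G iso = centipede₃₊ i G iso
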